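{- Let $n\ge 1$ and let $a_1,\dots,a_n$ be pairwise relatively prime positive integers. For a positive integer $t$ let $$p_A'(t)=\#\Big\{(m_1,\dots,m_n)\in\mathbb Z_{>0}^n:\ \sum_{k=1}^n m_ka_k=t\Big\}.$$ Then for every positive integer $t$, $$p_A'(t)=R'_t(a_1,\dots,a_n)+\sum_{j=1}^n\sigma_t(a_1,\dots,\hat a_j,\dots,a_n;a_j),$$ where $\hat a_j$ means that the entry $a_j$ is omitted, and $R'_t(a_1,\dots,a_n)=\operatorname{Res}(G_t(z),z=1)$ with $$G_t(z)=\frac{z^{t-1}}{(z^{a_1}-1)\cdots(z^{a_n}-1)}.$$
   Context: Fourier-Dedekind sum: for integers $c_1,\dots,c_m$ each relatively prime to a positive integer $c$, and $t\in\mathbb Z$, $$\sigma_t(c_1,\dots,c_m;c)=\frac1c\sum_{\lambda^c=1,\ \lambda\ne1}\frac{\lambda^t}{(\lambda^{c_1}-1)\cdots(\lambda^{c_m}-1)},$$ the sum being over all complex $c$-th roots of unity $\lambda\neq 1$ (so it is $0$ if $c=1$); an empty product in the denominator is $1$. $\operatorname{Res}(G(z),z=1)$ denotes the residue of the meromorphic function $G$ at $z=1$. -}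

module Defs where

module Counting where
  open import Data.Nat as ℕ using (ℕ; zero; suc; NonZero)
  import Data.Nat.Properties as ℕₚ
  open import Data.Fin as Fin using (Fin)
  open import Data.List using (List; []; _∷_; length; filter; cartesianProductWith; map; upTo)
  open import Data.List.Membership.Propositional using (_∈_)
  open import Data.List.Membership.Propositional.Properties
    using (∈-filter⁺; ∈-filter⁻; ∈-cartesianProductWith⁺; ∈-cartesianProductWith⁻; ∈-map⁺; ∈-map⁻; ∈-upTo⁺)
  open import Data.List.Relation.Unary.Any using (here)
  open import Data.List.Relation.Unary.All using ([])
  open import Data.List.Relation.Unary.AllPairs using ([]; _∷_)
  open import Data.List.Relation.Unary.Unique.Propositional using (Unique)
  import Data.List.Relation.Unary.Unique.Propositional.Properties as Unique
  open import Data.Product using (_,_) renaming (_×_ to _∧_)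
  open import Data.Vec using (Vec; []; _∷_; lookup)
  import Data.Vec.Properties as Vecₚ
  open import Data.Vec.Functional using (Vector)
  open import Function using (_∘_; _⇔_; mk⇔)
  open import Relation.Binary.PropositionalEquality as ≡ using (_≡_)
  open import Algebra.Properties.Semiring.Sum ℕₚ.+-*-semiring using () renaming (sum to ℕ-sum)

  weight : ∀ {n} → Vector ℕ n → Vec ℕ n → ℕ
  weight a m = ℕ-sum (λ k → lookup m k ℕ.* a k)

  -- The vectors with entries in {1, …, t}.  The bound t loses no solution when the weights aₖ are
  -- positive: see ∈-solutions.
  box : ∀ n → ℕ → List (Vec ℕ n)
  box zero    t = [] ∷ []
  box (suc n) t = cartesianProductWith _∷_ (map suc (upTo t)) (box n t)

  solutions : ∀ {n} → Vector ℕ n → ℕ → List (Vec ℕ n)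
  solutions {n} a t = filter (λ m → weight a m ℕ.≟ t) (box n t)

  p′ : ∀ {n} → Vector ℕ n → ℕ → ℕ
  p′ a t = length (solutions a t)

  box-complete : ∀ {n} t (m : Vec ℕ n) → (∀ k → 0 ℕ.< lookup m k) → (∀ k → lookup m k ℕ.≤ t) → m ∈ box n t
  box-complete t []          m>0 m≤t = here ≡.refl
  box-complete t (zero  ∷ m) m>0 m≤t with m>0 Fin.zero
  ... | ()
  box-complete t (suc x ∷ m) m>0 m≤t = ∈-cartesianProductWith⁺ _∷_
    (∈-map⁺ suc (∈-upTo⁺ (m≤t Fin.zero))) (box-complete t m (m>0 ∘ Fin.suc) (m≤t ∘ Fin.suc))

  box-positive : ∀ {n} t (m : Vec ℕ n) → m ∈ box n t → ∀ k → 0 ℕ.< lookup m k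
  box-positive {suc n} t m m∈ k with ∈-cartesianProductWith⁻ _∷_ (map suc (upTo t)) (box n t) m∈
  ... | x , m′ , x∈ , m′∈ , ≡.refl with ∈-map⁻ suc x∈
  box-positive {suc n} t m m∈ Fin.zero    | x , m′ , x∈ , m′∈ , ≡.refl | y , _ , ≡.refl = ℕ.s≤s ℕ.z≤n
  box-positive {suc n} t m m∈ (Fin.suc k) | x , m′ , x∈ , m′∈ , ≡.refl | _ = box-positive t m′ m′∈ k

  weight-bound : ∀ {n} (a : Vector ℕ n) → (∀ k → NonZero (a k)) → ∀ m k → lookup m k ℕ.≤ weight a m
  weight-bound a a>0 (x ∷ m) Fin.zero    = ℕₚ.≤-trans (ℕₚ.m≤m*n x (a Fin.zero) {{a>0 Fin.zero}}) (ℕₚ.m≤m+n _ _)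
  weight-bound a a>0 (x ∷ m) (Fin.suc k) = ℕₚ.≤-trans (weight-bound (a ∘ Fin.suc) (a>0 ∘ Fin.suc) m k) (ℕₚ.m≤n+m _ _)

  ∈-solutions : ∀ {n} (a : Vector ℕ n) → (∀ k → NonZero (a k)) → ∀ t m →
    m ∈ solutions a t ⇔ ((∀ k → 0 ℕ.< lookup m k) ∧ weight a m ≡ t)
  ∈-solutions {n} a a>0 t m = mk⇔
    (λ m∈ → let m∈box , e = ∈-filter⁻ (λ m → weight a m ℕ.≟ t) {xs = box n t} m∈ in box-positive t m m∈box , e)
    (λ { (m>0 , ≡.refl) → ∈-filter⁺ (λ m → weight a m ℕ.≟ t) (box-complete t m m>0 (weight-bound a a>0 m)) ≡.refl })

  box-unique : ∀ n t → Unique (box n t)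
  box-unique zero    t = [] ∷ []
  box-unique (suc n) t = Unique.cartesianProductWith⁺ _∷_ Vecₚ.∷-injective
    (Unique.map⁺ ℕₚ.suc-injective (Unique.upTo⁺ t)) (box-unique n t)

  solutions-unique : ∀ {n} (a : Vector ℕ n) t → Unique (solutions a t)
  solutions-unique {n} a t = Unique.filter⁺ (λ m → weight a m ℕ.≟ t) (box-unique n t)

module FieldOperations where
  open import Algebra.Apartness.Bundles using (HeytingCommutativeRing; HeytingField)
  open import Algebra.Bundles using (CommutativeRing)

  module FieldOps {c ℓ₁ ℓ₂} (F : HeytingField c ℓ₁ ℓ₂) where
    open HeytingField F public

    commutativeRing : CommutativeRing c ℓ₁
    commutativeRing = HeytingCommutativeRing.commutativeRing heytingCommutativeRing

    open CommutativeRing commutativeRing public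
      using (ring; semiring; commutativeSemiring; +-commutativeMonoid; *-commutativeMonoid; *-monoid; *-commutativeSemigroup; +-monoid)
    open import Algebra.Properties.Semiring.Exp semiring public
    open import Algebra.Properties.Semiring.Sum semiring public
    open import Algebra.Properties.Semiring.Mult semiring public using (_×_; ×-homo-+; ×-congʳ; ×-cong; ×-homo-1)

module FieldTheory where
  open FieldOperations
  open import Algebra.Apartness.Bundles using (HeytingCommutativeRing; HeytingField)
  open import Algebra.Bundles using (CommutativeRing)
  open import Data.Nat as ℕ using (ℕ; zero; suc; NonZero)
  import Data.Nat.Properties as ℕₚ
  open import Data.Nat.Coprimality using (Coprime; coprime-Bézout)
  open import Data.Nat.GCD using (module Bézout)
  open Bézout.Identity using (+-; -+)
  open import Relation.Binary.Definitions using (tri<; tri≈; tri>)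
  open import Data.Fin as Fin using (Fin; toℕ)
  import Data.Fin.Properties as Finₚ
  open import Data.Product hiding (_×_)
  open import Data.Sum using (_⊎_; inj₁; inj₂)
  open import Data.Empty using (⊥-elim)
  open import Data.Vec.Functional using (Vector)
  open import Function using (_∘_)
  open import Relation.Nullary using (¬_; contradiction)
  open import Relation.Binary.PropositionalEquality as ≡ using (_≡_; _≢_)
  open import Level using (_⊔_)

  module Field {c ℓ₁ ℓ₂} (F : HeytingField c ℓ₁ ℓ₂) where
    open FieldOps F public
    open import Algebra.Properties.CommutativeMonoid.Sum *-commutativeMonoid public
      using () renaming (sum to product; sum-cong-≋ to product-cong)
    open import Algebra.Apartness.Properties.HeytingCommutativeRing heytingCommutativeRing public
      using (x-0≈x; x#0y#0→xy#0; #-congʳ; #-congˡ; invertibleʳ⇒#)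
    open import Relation.Binary.Reasoning.Setoid setoid

    open import Algebra.Properties.Ring ring using (x[y-z]≈xy-xz; [y-z]x≈yx-zx; -‿distribʳ-*)
    open import Algebra.Properties.Group (CommutativeRing.+-group commutativeRing)
      using (//-rightDividesˡ; //-rightDividesʳ; x∙y⁻¹≈ε⇒x≈y)
    open import Algebra.Properties.AbelianGroup (CommutativeRing.+-abelianGroup commutativeRing)
      using (⁻¹-anti-homo‿-)
    open import Algebra.Properties.CommutativeSemigroup *-commutativeSemigroup
      using (interchange; x∙yz≈y∙xz)

    infix 9 _⁻¹[_]

    _⁻¹[_] : ∀ x → x # 0# → Carrier
    x ⁻¹[ x#0 ] = proj₁ (#⇒invertible x#0)

    ⁻¹-inverse : ∀ {x} (x#0 : x # 0#) → x * x ⁻¹[ x#0 ] ≈ 1#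
    ⁻¹-inverse {x} x#0 = trans (*-congʳ (sym (x-0≈x x))) (proj₂ (proj₂ (#⇒invertible x#0)))

    invertible⇒#0 : ∀ {x} y → x * y ≈ 1# → x # 0#
    invertible⇒#0 {x} y e = invertibleʳ⇒# (y , trans (*-congʳ (x-0≈x x)) e)

    #0-factor : ∀ {x y} → x * y # 0# → x # 0#
    #0-factor {x} {y} p = invertible⇒#0 (y * (x * y) ⁻¹[ p ]) (trans (sym (*-assoc x y _)) (⁻¹-inverse p))

    #⇒-#0 : ∀ {x y} → x # y → x - y # 0#
    #⇒-#0 p = invertible⇒#0 (proj₁ (#⇒invertible p)) (proj₂ (proj₂ (#⇒invertible p)))

    -#0⇒# : ∀ {x y} → x - y # 0# → x # y
    -#0⇒# p = invertibleʳ⇒# (_ , ⁻¹-inverse p)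

    x*y≈0⇒y≈0 : ∀ {x y} → x # 0# → x * y ≈ 0# → y ≈ 0#
    x*y≈0⇒y≈0 {x} {y} p e = begin
      y                        ≈⟨ *-identityˡ y ⟨
      1# * y                   ≈⟨ *-congʳ (trans (sym (⁻¹-inverse p)) (*-comm _ _)) ⟩
      x ⁻¹[ p ] * x * y        ≈⟨ *-assoc _ _ _ ⟩
      x ⁻¹[ p ] * (x * y)      ≈⟨ *-congˡ e ⟩
      x ⁻¹[ p ] * 0#           ≈⟨ zeroʳ _ ⟩
      0#                       ∎

    x-y≈0⇒x≈y : ∀ {x y} → x - y ≈ 0# → x ≈ y
    x-y≈0⇒x≈y {x} {y} = x∙y⁻¹≈ε⇒x≈y x y

    1^ : ∀ n → 1# ^ n ≈ 1#
    1^ zero    = refl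
    1^ (suc n) = trans (*-identityˡ _) (1^ n)

    ^-swap : ∀ x m n → (x ^ m) ^ n ≈ (x ^ n) ^ m
    ^-swap x m n = trans (^-assocʳ x m n) (trans (^-congʳ x (ℕₚ.*-comm m n)) (sym (^-assocʳ x n m)))

    ^-distrib-* : ∀ x y n → (x * y) ^ n ≈ x ^ n * y ^ n
    ^-distrib-* x y zero    = sym (*-identityˡ 1#)
    ^-distrib-* x y (suc n) = trans (*-congˡ (^-distrib-* x y n)) (interchange x y (x ^ n) (y ^ n))

    geometric : Carrier → ℕ → Carrier
    geometric x n = ∑[ k < n ] (x ^ toℕ k)

    geometric-step : ∀ x n → geometric x (suc n) ≈ 1# + x * geometric x n
    geometric-step x n = +-congˡ (sym (*-distribˡ-sum {n = n} x (λ k → x ^ toℕ k)))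

    geometric-sum : ∀ x n → (x - 1#) * geometric x n ≈ x ^ n - 1#
    geometric-sum x zero    = trans (zeroʳ _) (sym (-‿inverseʳ 1#))
    geometric-sum x (suc n) = begin
      (x - 1#) * geometric x (suc n)           ≈⟨ *-congˡ (geometric-step x n) ⟩
      (x - 1#) * (1# + x * geometric x n)      ≈⟨ eq₁ x (geometric x n) ⟩
      (x - 1#) + x * ((x - 1#) * geometric x n) ≈⟨ +-congˡ (*-congˡ (geometric-sum x n)) ⟩
      (x - 1#) + x * (x ^ n - 1#)              ≈⟨ eq₂ x (x ^ n) ⟩
      x * x ^ n - 1#                           ∎
      where
      eq₁ : ∀ x g → (x - 1#) * (1# + x * g) ≈ (x - 1#) + x * ((x - 1#) * g)
      eq₁ x g = trans (distribˡ _ _ _) (+-cong (*-identityʳ _) (x∙yz≈y∙xz _ _ _))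
      eq₂ : ∀ x p → (x - 1#) + x * (p - 1#) ≈ x * p - 1#
      eq₂ x p = begin
        (x - 1#) + x * (p - 1#)      ≈⟨ +-congˡ (trans (x[y-z]≈xy-xz x p 1#) (+-congˡ (-‿cong (*-identityʳ x)))) ⟩
        (x - 1#) + (x * p - x)       ≈⟨ +-comm _ _ ⟩
        (x * p - x) + (x - 1#)       ≈⟨ +-assoc _ _ _ ⟨
        x * p - x + x - 1#           ≈⟨ +-congʳ (//-rightDividesˡ x (x * p)) ⟩
        x * p - 1#                   ∎

    x^n#1⇒x#1 : ∀ {x} n → x ^ n # 1# → x # 1#
    x^n#1⇒x#1 {x} n p = -#0⇒# (#0-factor (#-congʳ (sym (geometric-sum x n)) (#⇒-#0 p)))

    sum#0 : ∀ {n} (f : Vector Carrier n) → sum f # 0# → ∃ λ i → f i # 0#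
    sum#0 {zero}  f p = contradiction p (#-irrefl refl)
    sum#0 {suc n} f p with #-cotrans p (sum (f ∘ Fin.suc))
    ... | inj₁ q = Fin.zero , #-congʳ (//-rightDividesʳ (sum (f ∘ Fin.suc)) (f Fin.zero)) (#⇒-#0 q)
    ... | inj₂ q = let i , r = sum#0 (f ∘ Fin.suc) q in Fin.suc i , r

    x*y≈1⇒y#1 : ∀ {x y} → x * y ≈ 1# → x # 1# → y # 1#
    x*y≈1⇒y#1 {x} {y} e p = -#0⇒# (#0-factor {y - 1#} { - x} (#-congʳ (begin
      x - 1#        ≈⟨ +-congˡ (-‿cong e) ⟨
      x - x * y     ≈⟨ eq x y ⟩
      (y - 1#) * - x ∎) (#⇒-#0 p)))
      where
      eq : ∀ x y → x - x * y ≈ (y - 1#) * - x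
      eq x y = begin
        x - x * y           ≈⟨ +-cong (*-identityˡ x) (-‿cong (*-comm y x)) ⟨
        1# * x - y * x      ≈⟨ [y-z]x≈yx-zx x 1# y ⟨
        (1# - y) * x        ≈⟨ *-congʳ (⁻¹-anti-homo‿- y 1#) ⟨
        - (y - 1#) * x      ≈⟨ trans (*-comm _ _) (trans (sym (-‿distribʳ-* x (y - 1#))) (-‿cong (*-comm x (y - 1#)))) ⟩
        - ((y - 1#) * x)    ≈⟨ -‿distribʳ-* (y - 1#) x ⟩
        (y - 1#) * - x      ∎

    root-power#1 : ∀ {λ′ c a} → λ′ ^ c ≈ 1# → λ′ # 1# → Coprime a c → λ′ ^ a # 1#
    root-power#1 {x} {c} {a} x^c x#1 cop with coprime-Bézout cop
    ... | +- m n e = x^n#1⇒x#1 m (#-congʳ (begin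
        x                     ≈⟨ *-identityʳ x ⟨
        x * 1#                ≈⟨ *-congˡ (trans (^-congˡ n x^c) (1^ n)) ⟨
        x * (x ^ c) ^ n       ≈⟨ *-congˡ (trans (^-assocʳ x c n) (^-congʳ x (ℕₚ.*-comm c n))) ⟩
        x * x ^ (n ℕ.* c)     ≈⟨ ^-congʳ x e ⟩
        x ^ (m ℕ.* a)         ≈⟨ trans (^-congʳ x (ℕₚ.*-comm m a)) (sym (^-assocʳ x a m)) ⟩
        (x ^ a) ^ m           ∎) x#1)
    ... | -+ m n e = x^n#1⇒x#1 m (x*y≈1⇒y#1 (begin
        x * (x ^ a) ^ m       ≈⟨ *-congˡ (trans (^-assocʳ x a m) (^-congʳ x (ℕₚ.*-comm a m))) ⟩
        x * x ^ (m ℕ.* a)     ≈⟨ ^-congʳ x e ⟩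
        x ^ (n ℕ.* c)         ≈⟨ trans (^-congʳ x (ℕₚ.*-comm n c)) (sym (^-assocʳ x c n)) ⟩
        (x ^ c) ^ n           ≈⟨ trans (^-congˡ n x^c) (1^ n) ⟩
        1#                    ∎) x#1)

    product#0 : ∀ {n} (f : Vector Carrier n) → (∀ i → f i # 0#) → product f # 0#
    product#0 {zero}  f p = invertible⇒#0 1# (*-identityˡ 1#)
    product#0 {suc n} f p = x#0y#0→xy#0 (p Fin.zero) (product#0 (f ∘ Fin.suc) (p ∘ Fin.suc))

    CharZero : Set ℓ₂
    CharZero = ∀ n .{{_ : NonZero n}} → n × 1# # 0#

    record PrimitiveRoot (n : ℕ) : Set (c ⊔ ℓ₁ ⊔ ℓ₂) where
      field
        ζ         : Carrier
        ζ^n≈1     : ζ ^ n ≈ 1#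
        order : ∀ k → 0 ℕ.< k → k ℕ.< n → ζ ^ k # 1#

    -- If every power of ζ in the middle half of the period is apart from 1, then so is every
    -- power in the period: doubling leads from the outer quarters to the middle half.
    module _ (n : ℕ) (ζ : Carrier) (ζ^n≈1 : ζ ^ n ≈ 1#)
      (middle : ∀ r → n ℕ.≤ 4 ℕ.* r → 4 ℕ.* r ℕ.≤ 3 ℕ.* n → ζ ^ r # 1#) where

      low : ∀ fuel m → 0 ℕ.< m → n ℕ.≤ m ℕ.+ fuel → 4 ℕ.* m ℕ.≤ 3 ℕ.* n → ζ ^ m # 1#
      low fuel m 0<m n≤ hi with ℕₚ.≤-total n (4 ℕ.* m)
      ... | inj₁ n≤4m = middle m n≤4m hi
      low zero m 0<m n≤ hi | inj₂ 4m≤n = middle m (ℕₚ.≤-trans n≤m (ℕₚ.m≤n*m m 4)) hi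
        where
        n≤m : n ℕ.≤ m
        n≤m = ℕₚ.≤-trans n≤ (ℕₚ.≤-reflexive (ℕₚ.+-identityʳ m))
      low (suc f) m 0<m n≤ hi | inj₂ 4m≤n = x^n#1⇒x#1 2
        (#-congʳ (trans (^-congʳ ζ (ℕₚ.*-comm 2 m)) (sym (^-assocʳ ζ m 2)))
          (low f (2 ℕ.* m) (ℕₚ.≤-trans 0<m (ℕₚ.m≤n*m m 2)) n≤′ hi′))
        where
        n≤′ : n ℕ.≤ 2 ℕ.* m ℕ.+ f
        n≤′ = ℕₚ.≤-trans n≤ (ℕₚ.≤-trans (ℕₚ.≤-reflexive (ℕₚ.+-suc m f))
          (ℕₚ.≤-trans (ℕₚ.+-monoˡ-≤ f (ℕₚ.+-monoˡ-≤ m 0<m))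
            (ℕₚ.≤-reflexive (≡.cong (λ t → m ℕ.+ t ℕ.+ f) (≡.sym (ℕₚ.+-identityʳ m))))))
        hi′ : 4 ℕ.* (2 ℕ.* m) ℕ.≤ 3 ℕ.* n
        hi′ = ℕₚ.≤-trans (ℕₚ.≤-reflexive (≡.trans (≡.sym (ℕₚ.*-assoc 4 2 m)) (ℕₚ.*-assoc 2 4 m)))
          (ℕₚ.≤-trans (ℕₚ.*-monoʳ-≤ 2 4m≤n) (ℕₚ.*-monoˡ-≤ n (ℕₚ.n≤1+n 2)))

      primitive-from-middle : ∀ k → 0 ℕ.< k → k ℕ.< n → ζ ^ k # 1#
      primitive-from-middle k 0<k k<n with ℕₚ.≤-total (4 ℕ.* k) (3 ℕ.* n)
      ... | inj₁ p = low n k 0<k (ℕₚ.m≤n+m n k) p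
      ... | inj₂ p = x*y≈1⇒y#1 (begin
          ζ ^ l * ζ ^ k  ≈⟨ ^-homo-* ζ l k ⟨
          ζ ^ (l ℕ.+ k)  ≈⟨ ^-congʳ ζ (ℕₚ.m∸n+n≡m (ℕₚ.<⇒≤ k<n)) ⟩
          ζ ^ n          ≈⟨ ζ^n≈1 ⟩
          1#             ∎) (low n l (ℕₚ.m<n⇒0<n∸m k<n) (ℕₚ.m≤n+m n l) l≤)
        where
        l = n ℕ.∸ k
        l≤ : 4 ℕ.* l ℕ.≤ 3 ℕ.* n
        l≤ = ℕₚ.≤-trans (ℕₚ.≤-reflexive (ℕₚ.*-distribˡ-∸ 4 n k)) (ℕₚ.≤-trans (ℕₚ.∸-monoʳ-≤ (4 ℕ.* n) p)
          (ℕₚ.≤-trans (ℕₚ.≤-reflexive (ℕₚ.m+n∸n≡m n (3 ℕ.* n))) (ℕₚ.m≤n*m n 3)))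

    -- An enumeration of the n-th roots of unity other than 1.  Constructively, "other than" is the
    -- apartness _#_ for the listed roots, and only its weak form ¬ (x ≈ 1#) is asked for in complete.
    record NontrivialRoots (n : ℕ) : Set (c ⊔ ℓ₁ ⊔ ℓ₂) where
      field
        root     : Fin (n ℕ.∸ 1) → Carrier
        root^n≈1 : ∀ i → root i ^ n ≈ 1#
        root#1   : ∀ i → root i # 1#
        distinct : ∀ {i j} → i ≢ j → root i # root j
        complete : ∀ x → x ^ n ≈ 1# → ¬ (x ≈ 1#) → ∃ λ i → x ≈ root i

    module _ (char0 : CharZero) (n : ℕ) .{{_ : NonZero n}} (pr : PrimitiveRoot n) where
      open PrimitiveRoot pr

      ζ^m#0 : ∀ {x} → x ^ n ≈ 1# → ∀ m → x ^ m # 0#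
      ζ^m#0 {x} e m = invertible⇒#0 (x ^ (m ℕ.* (n ℕ.∸ 1))) (begin
        x ^ m * x ^ (m ℕ.* (n ℕ.∸ 1))    ≈⟨ ^-homo-* x m _ ⟨
        x ^ (m ℕ.+ m ℕ.* (n ℕ.∸ 1))      ≈⟨ ^-congʳ x (≡.trans (≡.sym (ℕₚ.*-suc m (n ℕ.∸ 1))) (≡.trans (≡.cong (m ℕ.*_) (ℕₚ.suc-pred n)) (ℕₚ.*-comm m n))) ⟩
        x ^ (n ℕ.* m)                    ≈⟨ ^-assocʳ x n m ⟨
        (x ^ n) ^ m                      ≈⟨ trans (^-congˡ m e) (1^ m) ⟩
        1#                               ∎)

      powers-apart : ∀ i j → i ℕ.< j → j ℕ.< n → ζ ^ j # ζ ^ i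
      powers-apart i j i<j j<n = -#0⇒# (#-congʳ (begin
        ζ ^ i * (ζ ^ (j ℕ.∸ i) - 1#)       ≈⟨ eq (ζ ^ i) (ζ ^ (j ℕ.∸ i)) ⟩
        ζ ^ i * ζ ^ (j ℕ.∸ i) - ζ ^ i      ≈⟨ +-congʳ (^-homo-* ζ i (j ℕ.∸ i)) ⟨
        ζ ^ (i ℕ.+ (j ℕ.∸ i)) - ζ ^ i      ≈⟨ +-congʳ (^-congʳ ζ (ℕₚ.m+[n∸m]≡n (ℕₚ.<⇒≤ i<j))) ⟩
        ζ ^ j - ζ ^ i                      ∎)
        (x#0y#0→xy#0 (ζ^m#0 ζ^n≈1 i) (#⇒-#0 (order (j ℕ.∸ i) (ℕₚ.m<n⇒0<n∸m i<j) (ℕₚ.≤-<-trans (ℕₚ.m∸n≤m j i) j<n)))))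
        where
        eq : ∀ x y → x * (y - 1#) ≈ x * y - x
        eq x y = trans (x[y-z]≈xy-xz x y 1#) (+-congˡ (-‿cong (*-identityʳ x)))

      -- the powers of a nontrivial n-th root of unity sum to 0
      geometric-root : ∀ {x} → x ^ n ≈ 1# → x # 1# → geometric x n ≈ 0#
      geometric-root {x} e p = x*y≈0⇒y≈0 (#⇒-#0 p) (trans (geometric-sum x n) (trans (+-congʳ e) (-‿inverseʳ 1#)))

      geometric-1 : geometric 1# n ≈ n × 1#
      geometric-1 = trans (sum-cong-≋ {n = n} (λ k → 1^ (toℕ k))) (sum-replicate n)

      module _ (x : Carrier) (x^n≈1 : x ^ n ≈ 1#) where
        row : Fin n → Carrier
        row j = ∑[ k < n ] ((x * ζ ^ toℕ k) ^ toℕ j)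

        row≈ : ∀ j → row j ≈ x ^ toℕ j * geometric (ζ ^ toℕ j) n
        row≈ j = begin
          ∑[ k < n ] ((x * ζ ^ toℕ k) ^ toℕ j)            ≈⟨ sum-cong-≋ {n = n} (λ k → trans (^-distrib-* x (ζ ^ toℕ k) (toℕ j)) (*-congˡ (^-swap ζ (toℕ k) (toℕ j)))) ⟩
          ∑[ k < n ] (x ^ toℕ j * (ζ ^ toℕ j) ^ toℕ k)    ≈⟨ *-distribˡ-sum {n = n} (x ^ toℕ j) (λ k → (ζ ^ toℕ j) ^ toℕ k) ⟨
          x ^ toℕ j * geometric (ζ ^ toℕ j) n             ∎

        total : ∀ m → m ≡ n → (f : Fin m → Carrier) → (∀ j → f j ≈ x ^ toℕ j * geometric (ζ ^ toℕ j) n) → sum f ≈ n × 1#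
        total zero    e f h = ⊥-elim (ℕ.≢-nonZero⁻¹ n (≡.sym e))
        total (suc m) e f h = begin
          f Fin.zero + sum (f ∘ Fin.suc)  ≈⟨ +-cong (trans (h Fin.zero) (trans (*-identityˡ _) geometric-1))
                                              (trans (sum-cong-≋ {n = m} vanish) (sum-replicate-zero m)) ⟩
          n × 1# + 0#                     ≈⟨ +-identityʳ _ ⟩
          n × 1#                          ∎
          where
          vanish : ∀ j → f (Fin.suc j) ≈ 0#
          vanish j = trans (h (Fin.suc j)) (trans (*-congˡ (geometric-root
            (trans (^-swap ζ (suc (toℕ j)) n) (trans (^-congˡ (suc (toℕ j)) ζ^n≈1) (1^ (suc (toℕ j)))))
            (order (suc (toℕ j)) (ℕ.s≤s ℕ.z≤n) (≡.subst (suc (toℕ j) ℕ.<_) e (ℕ.s≤s (Finₚ.toℕ<n j)))))) (zeroʳ _))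

        column : Fin n → Carrier
        column k = geometric (x * ζ ^ toℕ k) n

        columns : sum column ≈ n × 1#
        columns = trans (∑-comm {m = n} {n = n} (λ k j → (x * ζ ^ toℕ k) ^ toℕ j)) (total n ≡.refl row row≈)

        is-power : ∃ λ k → x * ζ ^ toℕ {n} k ≈ 1#
        is-power =
          let k , p = sum#0 column (#-congʳ (sym columns) (char0 n))
              y = x * ζ ^ toℕ k
          in k , x-y≈0⇒x≈y (x*y≈0⇒y≈0 p (trans (*-comm _ _) (trans (geometric-sum y n) (trans (+-congʳ (begin
            y ^ n                        ≈⟨ ^-distrib-* x (ζ ^ toℕ k) n ⟩
            x ^ n * (ζ ^ toℕ k) ^ n      ≈⟨ *-cong x^n≈1 (trans (^-swap ζ (toℕ k) n) (trans (^-congˡ (toℕ k) ζ^n≈1) (1^ (toℕ k)))) ⟩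
            1# * 1#                      ≈⟨ *-identityˡ 1# ⟩
            1#                           ∎)) (-‿inverseʳ 1#)))))

      nontrivialRoots : NontrivialRoots n
      nontrivialRoots = record
        { root     = λ i → ζ ^ suc (toℕ i)
        ; root^n≈1 = λ i → trans (^-swap ζ (suc (toℕ i)) n) (trans (^-congˡ (suc (toℕ i)) ζ^n≈1) (1^ (suc (toℕ i))))
        ; root#1   = λ i → order (suc (toℕ i)) (ℕ.s≤s ℕ.z≤n) (bound i)
        ; distinct = λ {i} {j} i≢j → apart i j i≢j
        ; complete = full }
        where
        bound : ∀ (i : Fin (n ℕ.∸ 1)) → suc (toℕ i) ℕ.< n
        bound i = ≡.subst (suc (toℕ i) ℕ.<_) (ℕₚ.suc-pred n) (ℕ.s≤s (Finₚ.toℕ<n i))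
        apart : ∀ (i j : Fin (n ℕ.∸ 1)) → i ≢ j → ζ ^ suc (toℕ i) # ζ ^ suc (toℕ j)
        apart i j i≢j with ℕₚ.<-cmp (toℕ i) (toℕ j)
        ... | tri< p _ _ = #-sym (powers-apart _ _ (ℕ.s≤s p) (bound j))
        ... | tri≈ _ e _ = contradiction (Finₚ.toℕ-injective e) i≢j
        ... | tri> _ _ p = powers-apart _ _ (ℕ.s≤s p) (bound i)
        full : ∀ x → x ^ n ≈ 1# → ¬ (x ≈ 1#) → ∃ λ (i : Fin (n ℕ.∸ 1)) → x ≈ ζ ^ suc (toℕ i)
        full x x^n x≉1 with is-power x x^n
        ... | k , e = go (toℕ k) (Finₚ.toℕ<n k) e
          where
          go : ∀ k → k ℕ.< n → x * ζ ^ k ≈ 1# → ∃ λ (i : Fin (n ℕ.∸ 1)) → x ≈ ζ ^ suc (toℕ i)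
          go zero    k<n e = contradiction (trans (sym (*-identityʳ x)) e) x≉1
          go (suc k) k<n e = Fin.fromℕ< i<n , (begin
            x                                ≈⟨ *-identityʳ x ⟨
            x * 1#                           ≈⟨ *-congˡ (trans (^-congʳ ζ sum≡n) ζ^n≈1) ⟨
            x * ζ ^ (suc k ℕ.+ suc i)        ≈⟨ *-congˡ (^-homo-* ζ (suc k) (suc i)) ⟩
            x * (ζ ^ suc k * ζ ^ suc i)      ≈⟨ *-assoc _ _ _ ⟨
            x * ζ ^ suc k * ζ ^ suc i        ≈⟨ *-congʳ e ⟩
            1# * ζ ^ suc i                   ≈⟨ *-identityˡ _ ⟩
            ζ ^ suc i                        ≈⟨ ^-congʳ ζ (≡.cong suc (≡.sym (Finₚ.toℕ-fromℕ< i<n))) ⟩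
            ζ ^ suc (toℕ (Fin.fromℕ< i<n))   ∎)
            where
            i = n ℕ.∸ suc (suc k)
            i<n : i ℕ.< n ℕ.∸ 1
            i<n = ℕₚ.∸-monoʳ-< {n} {suc (suc k)} {1} (ℕ.s≤s (ℕ.s≤s ℕ.z≤n)) k<n
            sum≡n : suc k ℕ.+ suc i ≡ n
            sum≡n = ≡.trans (ℕₚ.+-suc (suc k) i) (ℕₚ.m+[n∸m]≡n k<n)

module SeriesTheory where
  open FieldOperations
  open FieldTheory
  open import Algebra.Apartness.Bundles using (HeytingCommutativeRing; HeytingField)
  open import Algebra.Bundles using (CommutativeRing)
  open import Data.Nat as ℕ using (ℕ; zero; suc; NonZero)
  import Data.Nat.Properties as ℕₚ
  open import Data.Fin as Fin using (Fin; toℕ)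
  import Data.Fin.Properties as Finₚ
  import Data.Fin.Permutation as Perm
  open import Data.Product hiding (_×_)
  open import Data.Vec.Functional using (Vector)
  open import Function using (_∘_)
  open import Relation.Binary.PropositionalEquality as ≡ using (_≡_; _≢_)
  open import Level using (_⊔_)

  module RingOps {c ℓ} (R : CommutativeRing c ℓ) where
    open CommutativeRing R public
    open import Algebra.Properties.Semiring.Exp semiring public using (_^_; ^-homo-*)
    open import Algebra.Properties.CommutativeMonoid.Sum *-commutativeMonoid public
      using () renaming (sum to product)
    open import Relation.Binary.Reasoning.Setoid setoid public
    open import Algebra.Properties.CommutativeSemigroup *-commutativeSemigroup public

  module PowerSeries {c ℓ₁ ℓ₂} (F : HeytingField c ℓ₁ ℓ₂) where
    open Field F
    open import Relation.Binary.Reasoning.Setoid setoid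
    open import Algebra.Properties.CommutativeSemigroup (CommutativeRing.+-commutativeSemigroup commutativeRing)
      using (x∙yz≈y∙xz)

    Series : Set c
    Series = ℕ → Carrier

    infix  4 _≋_
    infixl 6 _⊞_
    infixl 7 _⊛_

    _≋_ : Series → Series → Set ℓ₁
    f ≋ g = ∀ n → f n ≈ g n

    _⊞_ _⊛_ : Series → Series → Series
    (f ⊞ g) n = f n + g n
    (f ⊛ g) n = ∑[ k < suc n ] (f (toℕ k) * g (n ℕ.∸ toℕ k))

    ⊟_ 0+_ : Series → Series
    (⊟ f) n = - f n
    (0+ f) zero    = 0#
    (0+ f) (suc n) = f n

    shift : Series → Series
    shift f n = f (suc n)

    0S 1S : Series
    0S _ = 0#
    1S zero    = 1#
    1S (suc _) = 0#

    ⊛-cong : ∀ {f f′ g g′} → f ≋ f′ → g ≋ g′ → f ⊛ g ≋ f′ ⊛ g′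
    ⊛-cong p q n = sum-cong-≋ {n = suc n} (λ k → *-cong (p (toℕ k)) (q (n ℕ.∸ toℕ k)))

    ⊛-distribʳ : ∀ h f g → (f ⊞ g) ⊛ h ≋ f ⊛ h ⊞ g ⊛ h
    ⊛-distribʳ h f g n = trans
      (sum-cong-≋ {n = suc n} (λ k → distribʳ (h (n ℕ.∸ toℕ k)) (f (toℕ k)) (g (toℕ k))))
      (∑-distrib-+ {n = suc n} (λ k → f (toℕ k) * h (n ℕ.∸ toℕ k)) (λ k → g (toℕ k) * h (n ℕ.∸ toℕ k)))

    scale-⊛ : ∀ x f g n → ((λ k → x * f k) ⊛ g) n ≈ x * (f ⊛ g) n
    scale-⊛ x f g n = trans
      (sum-cong-≋ {n = suc n} (λ k → *-assoc x (f (toℕ k)) (g (n ℕ.∸ toℕ k))))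
      (sym (*-distribˡ-sum {n = suc n} x (λ k → f (toℕ k) * g (n ℕ.∸ toℕ k))))

    zero-⊛ : ∀ g → 0S ⊛ g ≋ 0S
    zero-⊛ g n = trans (sum-cong-≋ {n = suc n} (λ k → zeroˡ (g (n ℕ.∸ toℕ k)))) (sum-replicate-zero (suc n))

    ⊛-comm : ∀ f g → f ⊛ g ≋ g ⊛ f
    ⊛-comm f g n = trans (∑-permute {n = suc n} (λ k → f (toℕ k) * g (n ℕ.∸ toℕ k)) Perm.reverse)
      (sum-cong-≋ {n = suc n} λ k → trans (*-comm _ _) (*-cong
        (reflexive (≡.cong g (≡.trans (≡.cong (n ℕ.∸_) (Finₚ.opposite-prop k)) (ℕₚ.m∸[m∸n]≡n (ℕₚ.≤-pred (Finₚ.toℕ<n k))))))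
        (reflexive (≡.cong f (Finₚ.opposite-prop k)))))

    ⊛-assoc : ∀ f g h → (f ⊛ g) ⊛ h ≋ f ⊛ (g ⊛ h)
    ⊛-assoc f g h zero    = +-congʳ (begin
      (f 0 * g 0 + 0#) * h 0  ≈⟨ *-congʳ (+-identityʳ _) ⟩
      f 0 * g 0 * h 0         ≈⟨ *-assoc _ _ _ ⟩
      f 0 * (g 0 * h 0)       ≈⟨ *-congˡ (+-identityʳ _) ⟨
      f 0 * (g 0 * h 0 + 0#)  ∎)
    ⊛-assoc f g h (suc n) = begin
      (f 0 * g 0 + 0#) * h (suc n) + (shift (f ⊛ g) ⊛ h) n
        ≈⟨ +-cong (trans (*-congʳ (+-identityʳ _)) (*-assoc _ _ _)) (⊛-distribʳ h (λ k → f 0 * shift g k) (shift f ⊛ g) n) ⟩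
      f 0 * (g 0 * h (suc n)) + (((λ k → f 0 * shift g k) ⊛ h) n + ((shift f ⊛ g) ⊛ h) n)
        ≈⟨ +-congˡ (+-cong (scale-⊛ (f 0) (shift g) h n) (⊛-assoc (shift f) g h n)) ⟩
      f 0 * (g 0 * h (suc n)) + (f 0 * (shift g ⊛ h) n + (shift f ⊛ (g ⊛ h)) n)
        ≈⟨ +-assoc _ _ _ ⟨
      f 0 * (g 0 * h (suc n)) + f 0 * (shift g ⊛ h) n + (shift f ⊛ (g ⊛ h)) n
        ≈⟨ +-congʳ (distribˡ _ _ _) ⟨
      f 0 * (g ⊛ h) (suc n) + (shift f ⊛ (g ⊛ h)) n
        ∎

    ⊛-identityˡ : ∀ f → 1S ⊛ f ≋ f
    ⊛-identityˡ f zero    = trans (+-identityʳ _) (*-identityˡ _)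
    ⊛-identityˡ f (suc n) = trans (+-cong (*-identityˡ _) (zero-⊛ f n)) (+-identityʳ _)

    seriesRing : CommutativeRing c ℓ₁
    seriesRing = record
      { Carrier = Series ; _≈_ = _≋_ ; _+_ = _⊞_ ; _*_ = _⊛_ ; -_ = ⊟_ ; 0# = 0S ; 1# = 1S
      ; isCommutativeRing = record
        { isRing = record
          { +-isAbelianGroup = record
            { isGroup = record
              { isMonoid = record
                { isSemigroup = record
                  { isMagma = record
                    { isEquivalence = record { refl = λ n → refl ; sym = λ p n → sym (p n) ; trans = λ p q n → trans (p n) (q n) }
                    ; ∙-cong = λ p q n → +-cong (p n) (q n) }
                  ; assoc = λ f g h n → +-assoc (f n) (g n) (h n) }
                ; identity = (λ f n → +-identityˡ (f n)) , (λ f n → +-identityʳ (f n)) }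
              ; inverse = (λ f n → -‿inverseˡ (f n)) , (λ f n → -‿inverseʳ (f n))
              ; ⁻¹-cong = λ p n → -‿cong (p n) }
            ; comm = λ f g n → +-comm (f n) (g n) }
          ; *-cong = ⊛-cong
          ; *-assoc = ⊛-assoc
          ; *-identity = ⊛-identityˡ , λ f n → trans (⊛-comm f 1S n) (⊛-identityˡ f n)
          ; distrib = (λ f g h n → trans (⊛-comm f (g ⊞ h) n) (trans (⊛-distribʳ f g h n)
                        (+-cong (⊛-comm g f n) (⊛-comm h f n))))
                    , ⊛-distribʳ }
        ; *-comm = ⊛-comm }
      }

    module S = RingOps seriesRing

    -- The inverse g of a power series f with invertible constant term satisfies
    -- g₀ = 1 / f₀ and gₙ₊₁ = - (f₁gₙ + … + fₙ₊₁g₀) / f₀.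
    module Inverse (f : Series) (i : Carrier) (f₀i : f 0 * i ≈ 1#) where
      -- correct up to order n
      approx : ℕ → Series
      approx _       zero    = i
      approx zero    (suc m) = 0#
      approx (suc n) (suc m) = - (i * (shift f ⊛ approx n) m)

      inverse : Series
      inverse n = approx n n

      approx-step : ∀ n m → m ℕ.≤ n → approx n m ≈ approx (suc n) m
      approx-step n       zero    _           = refl
      approx-step (suc n) (suc m) (ℕ.s≤s m≤n) = -‿cong (*-congˡ (sum-cong-≋ {n = suc m} λ k →
        *-congˡ {f (suc (toℕ k))} (approx-step n (m ℕ.∸ toℕ k) (ℕₚ.≤-trans (ℕₚ.m∸n≤m m (toℕ k)) m≤n))))

      approx-stable : ∀ d m → approx (d ℕ.+ m) m ≈ inverse m
      approx-stable zero    m = refl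
      approx-stable (suc d) m = trans (sym (approx-step (d ℕ.+ m) m (ℕₚ.m≤n+m m d))) (approx-stable d m)

      approx-inverse : ∀ n m → m ℕ.≤ n → approx n m ≈ inverse m
      approx-inverse n m m≤n = ≡.subst (λ t → approx t m ≈ inverse m) (ℕₚ.m∸n+n≡m m≤n) (approx-stable (n ℕ.∸ m) m)

      inverse-correct : f ⊛ inverse ≋ 1S
      inverse-correct zero    = trans (+-identityʳ _) f₀i
      inverse-correct (suc m) = begin
        f 0 * - (i * (shift f ⊛ approx m) m) + (shift f ⊛ inverse) m
          ≈⟨ +-congʳ (trans (sym (-‿distribʳ-* _ _)) (-‿cong (trans (sym (*-assoc _ _ _)) (trans (*-congʳ f₀i) (*-identityˡ _))))) ⟩
        - (shift f ⊛ approx m) m + (shift f ⊛ inverse) m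
          ≈⟨ +-congˡ (sum-cong-≋ {n = suc m} λ k → *-congˡ {f (suc (toℕ k))} (sym (approx-inverse m (m ℕ.∸ toℕ k) (ℕₚ.m∸n≤m m (toℕ k))))) ⟩
        - (shift f ⊛ approx m) m + (shift f ⊛ approx m) m
          ≈⟨ -‿inverseˡ _ ⟩
        0# ∎
        where open import Algebra.Properties.Ring ring using (-‿distribʳ-*)

    -- A series f stands for Σₙ f n · wⁿ in the local parameter w = z - 1, so a polynomial in z
    -- becomes its Taylor expansion at z = 1.
    w z : Series
    w = 0+ 1S
    z = 1S ⊞ w

    w⊛shift : ∀ f → f 0 ≈ 0# → w ⊛ shift f ≋ f
    w⊛shift f f₀ zero    = trans (trans (+-identityʳ _) (zeroˡ _)) (sym f₀)
    w⊛shift f f₀ (suc n) = trans (+-cong (zeroˡ _) (⊛-identityˡ (shift f) n)) (+-identityˡ _)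

    -- P / Q = w⁻ᵒʳᵈᵉʳ (coeff₀ + coeff₁ w + coeff₂ w² + …), with denominators cleared; P and Q are
    -- the Taylor expansions at z = 1 of the numerator and the denominator.
    record LaurentExpansion (P Q : Series) : Set (c ⊔ ℓ₁) where
      field
        order     : ℕ
        coeff     : Series
        expansion : coeff ⊛ Q ≋ (w S.^ order) ⊛ P

    -- the coefficient of w⁻¹, which is 0 if order = 0 and coeffₙ if order = n + 1
    residue : ∀ {P Q} → LaurentExpansion P Q → Carrier
    residue L = (0+ LaurentExpansion.coeff L) (LaurentExpansion.order L)

    z^0 : ∀ a → (z S.^ a) 0 ≈ 1#
    z^0 zero    = refl
    z^0 (suc a) = trans (+-identityʳ _) (trans (*-cong (+-identityʳ 1#) (z^0 a)) (*-identityˡ 1#))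

    z^1 : ∀ a → (z S.^ a) 1 ≈ a × 1#
    z^1 zero    = refl
    z^1 (suc a) = begin
      (1# + 0#) * (z S.^ a) 1 + ((0# + 1#) * (z S.^ a) 0 + 0#)
        ≈⟨ +-cong (trans (*-congʳ (+-identityʳ 1#)) (trans (*-identityˡ _) (z^1 a)))
             (trans (+-identityʳ _) (trans (*-cong (+-identityˡ 1#) (z^0 a)) (*-identityˡ 1#))) ⟩
      a × 1# + 1#
        ≈⟨ +-comm _ _ ⟩
      1# + a × 1# ∎

    -- 1 / (zᵃ - 1) has a simple pole at z = 1: zᵃ - 1 = w (a + …)
    reciprocal : CharZero → ∀ a .{{_ : NonZero a}} → LaurentExpansion 1S ((z S.^ a) S.- 1S)
    reciprocal char0 a = record
      { order = 1
      ; coeff = inverse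
      ; expansion = S.begin
          inverse ⊛ q              S.≈⟨ S.*-congˡ {inverse} {q} {w ⊛ shift q} (S.sym {w ⊛ shift q} {q} (w⊛shift q q₀)) ⟩
          inverse ⊛ (w ⊛ shift q)  S.≈⟨ S.x∙yz≈y∙xz inverse w (shift q) ⟩
          w ⊛ (inverse ⊛ shift q)  S.≈⟨ S.*-congˡ {w} {inverse ⊛ shift q} {1S} (S.trans {inverse ⊛ shift q} {shift q ⊛ inverse} {1S} (⊛-comm inverse (shift q)) inverse-correct) ⟩
          w ⊛ 1S                   S.≈⟨ (λ n → refl) ⟩
          w S.^ 1                  S.≈⟨ S.*-identityʳ (w S.^ 1) ⟨
          (w S.^ 1) ⊛ 1S           S.∎ }
      where
      q : Series
      q = (z S.^ a) S.- 1S
      q₀ : q 0 ≈ 0#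
      q₀ = trans (+-congʳ (z^0 a)) (-‿inverseʳ 1#)
      q₁ : q 1 ≈ a × 1#
      q₁ = trans (+-cong (z^1 a) -0#≈0#) (+-identityʳ _)
        where open import Algebra.Properties.Ring ring using (-0#≈0#)
      q₁#0 : q 1 # 0#
      q₁#0 = #-congʳ (sym q₁) (char0 a)
      open Inverse (shift q) (q 1 ⁻¹[ q₁#0 ]) (⁻¹-inverse q₁#0)

    infixl 7 _·_ _⊙_

    _·_ : ∀ {Q Q′} → LaurentExpansion 1S Q → LaurentExpansion 1S Q′ → LaurentExpansion 1S (Q ⊛ Q′)
    _·_ {Q} {Q′} L L′ = record
      { order = L.order ℕ.+ L′.order
      ; coeff = L.coeff ⊛ L′.coeff
      ; expansion = S.begin
          (L.coeff ⊛ L′.coeff) ⊛ (Q ⊛ Q′)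
            S.≈⟨ S.interchange L.coeff L′.coeff Q Q′ ⟩
          (L.coeff ⊛ Q) ⊛ (L′.coeff ⊛ Q′)
            S.≈⟨ ⊛-cong L.expansion L′.expansion ⟩
          ((w S.^ L.order) ⊛ 1S) ⊛ ((w S.^ L′.order) ⊛ 1S)
            S.≈⟨ ⊛-cong (S.*-identityʳ (w S.^ L.order)) (S.*-identityʳ (w S.^ L′.order)) ⟩
          (w S.^ L.order) ⊛ (w S.^ L′.order)
            S.≈⟨ S.^-homo-* w L.order L′.order ⟨
          w S.^ (L.order ℕ.+ L′.order)
            S.≈⟨ S.*-identityʳ (w S.^ (L.order ℕ.+ L′.order)) ⟨
          (w S.^ (L.order ℕ.+ L′.order)) ⊛ 1S S.∎ }
      where
      module L = LaurentExpansion L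
      module L′ = LaurentExpansion L′

    _⊙_ : ∀ P {Q} → LaurentExpansion 1S Q → LaurentExpansion P Q
    _⊙_ P {Q} L = record
      { order = L.order
      ; coeff = P ⊛ L.coeff
      ; expansion = S.begin
          (P ⊛ L.coeff) ⊛ Q              S.≈⟨ ⊛-assoc P L.coeff Q ⟩
          P ⊛ (L.coeff ⊛ Q)              S.≈⟨ ⊛-cong {P} (λ n → refl) L.expansion ⟩
          P ⊛ ((w S.^ L.order) ⊛ 1S)     S.≈⟨ ⊛-cong {P} (λ n → refl) (S.*-identityʳ (w S.^ L.order)) ⟩
          P ⊛ (w S.^ L.order)            S.≈⟨ ⊛-comm P (w S.^ L.order) ⟩
          (w S.^ L.order) ⊛ P            S.∎ }
      where
      module L = LaurentExpansion L

    reciprocals : CharZero → ∀ {n} (a : Vector ℕ n) → (∀ k → NonZero (a k)) →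
      LaurentExpansion 1S (S.product (λ k → (z S.^ a k) S.- 1S))
    reciprocals char0 {zero}  a a>0 = record { order = 0 ; coeff = 1S ; expansion = λ n → refl }
    reciprocals char0 {suc n} a a>0 =
      reciprocal char0 (a Fin.zero) {{a>0 Fin.zero}} · reciprocals char0 (a ∘ Fin.suc) (a>0 ∘ Fin.suc)

module Sums where
  open FieldTheory
  open SeriesTheory
  open import Algebra.Apartness.Bundles using (HeytingField)
  open import Data.Nat as ℕ using (ℕ; NonZero)
  open import Data.Nat.Coprimality using (Coprime)
  open import Data.Fin using (Fin)
  open import Data.Vec.Functional using (Vector)

  module FourierDedekind {c ℓ₁ ℓ₂} (F : HeytingField c ℓ₁ ℓ₂)
    (char0 : Field.CharZero F) (roots : ∀ n .{{_ : NonZero n}} → Field.NontrivialRoots F n) where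
    open Field F
    open PowerSeries F

    module _ {m} (cs : Vector ℕ m) (c : ℕ) .{{_ : NonZero c}} (coprime : ∀ i → Coprime (cs i) c) where
      open NontrivialRoots (roots c)

      denominator : Fin (c ℕ.∸ 1) → Carrier
      denominator k = product (λ i → root k ^ cs i - 1#)

      denominator#0 : ∀ k → denominator k # 0#
      denominator#0 k = product#0 (λ i → root k ^ cs i - 1#)
        (λ i → #⇒-#0 (root-power#1 (root^n≈1 k) (root#1 k) (coprime i)))

    -- c⁻¹ · Σ λᵗ / ((λ^c₁ - 1) ⋯ (λ^cₘ - 1)), summed over the c-th roots of unity λ ≠ 1
    σ : ℕ → ∀ {m} (cs : Vector ℕ m) (c : ℕ) .{{_ : NonZero c}} → (∀ i → Coprime (cs i) c) → Carrier
    σ t cs c coprime =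
      (c × 1#) ⁻¹[ char0 c ] *
      ∑[ k < c ℕ.∸ 1 ] (root k ^ t * denominator cs c coprime k ⁻¹[ denominator#0 cs c coprime k ])
      where open NontrivialRoots (roots c)

    module _ (t : ℕ) {n} (a : Vector ℕ n) (a>0 : ∀ k → NonZero (a k)) where

      -- zᵗ⁻¹ / ((z^a₁ - 1) ⋯ (z^aₙ - 1)) at z = 1
      G : LaurentExpansion (z S.^ (t ℕ.∸ 1)) (S.product (λ k → (z S.^ a k) S.- 1S))
      G = (z S.^ (t ℕ.∸ 1)) ⊙ reciprocals char0 a a>0

      R′ : Carrier
      R′ = residue G

module RationalLemmas where
  open import Data.Rational
  open import Data.Rational.Properties
  import Data.Rational.Unnormalised as ℚᵘ
  import Data.Rational.Unnormalised.Properties as ℚᵘₚ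
  open import Data.Integer as ℤ using (-[1+_])
  import Data.Integer.Properties as ℤₚ
  open import Data.Nat as ℕ using (ℕ; zero; suc)
  import Data.Nat.Properties as ℕₚ
  open import Data.Product
  open import Data.Sum using (inj₁; inj₂)
  open import Relation.Binary.PropositionalEquality
  open import Relation.Nullary.Decidable using (dec⇒maybe)
  open import Tactic.RingSolver.Core.AlmostCommutativeRing using (AlmostCommutativeRing; fromCommutativeRing)
  open import Tactic.RingSolver using (solve-∀; solve)
  open import Data.List using ([]; _∷_)
  open import Level using (0ℓ)

  ℚ-ring : AlmostCommutativeRing 0ℓ 0ℓ
  ℚ-ring = fromCommutativeRing +-*-commutativeRing (λ x → dec⇒maybe (0ℚ ≟ x))

  private
    cancel : ∀ a b → a + (b - a) ≡ b
    cancel = solve-∀ ℚ-ring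
    flip- : ∀ a b → a - b ≡ - (b - a)
    flip- = solve-∀ ℚ-ring

  ≤-by : ∀ {a b t} → 0ℚ ≤ t → b - a ≡ t → a ≤ b
  ≤-by {a} {b} 0≤t refl = subst₂ _≤_ (+-identityʳ a) (cancel a b) (+-monoʳ-≤ a 0≤t)

  <-by : ∀ {a b t} → 0ℚ < t → b - a ≡ t → a < b
  <-by {a} {b} 0<t refl = subst₂ _<_ (+-identityʳ a) (cancel a b) (+-monoʳ-< a 0<t)

  0≤- : ∀ {a b} → a ≤ b → 0ℚ ≤ b - a
  0≤- {a} {b} a≤b = subst (_≤ b - a) (+-inverseʳ a) (+-monoˡ-≤ (- a) a≤b)

  0<- : ∀ {a b} → a < b → 0ℚ < b - a
  0<- {a} {b} a<b = subst (_< b - a) (+-inverseʳ a) (+-monoˡ-< (- a) a<b)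

  0≤+ : ∀ {a b} → 0ℚ ≤ a → 0ℚ ≤ b → 0ℚ ≤ a + b
  0≤+ p q = +-mono-≤ p q

  0<+ : ∀ {a b} → 0ℚ < a → 0ℚ < b → 0ℚ < a + b
  0<+ p q = +-mono-< p q

  0<+≤ : ∀ {a b} → 0ℚ < a → 0ℚ ≤ b → 0ℚ < a + b
  0<+≤ p q = +-mono-<-≤ p q

  0≤* : ∀ {a b} → 0ℚ ≤ a → 0ℚ ≤ b → 0ℚ ≤ a * b
  0≤* {a} {b} p q = nonNegative⁻¹ (a * b) {{nonNeg*nonNeg⇒nonNeg a {{nonNegative p}} b {{nonNegative q}}}}

  0<* : ∀ {a b} → 0ℚ < a → 0ℚ < b → 0ℚ < a * b
  0<* {a} {b} p q = positive⁻¹ (a * b) {{pos*pos⇒pos a {{positive p}} b {{positive q}}}}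

  *-mono : ∀ {a b c d} → 0ℚ ≤ a → 0ℚ ≤ d → a ≤ b → c ≤ d → a * c ≤ b * d
  *-mono {a} {b} {c} {d} 0≤a 0≤d a≤b c≤d = ≤-trans
    (*-monoˡ-≤-nonNeg a {{nonNegative 0≤a}} c≤d) (*-monoʳ-≤-nonNeg d {{nonNegative 0≤d}} a≤b)

  *-monoˡ : ∀ {a b} c → 0ℚ ≤ c → a ≤ b → c * a ≤ c * b
  *-monoˡ c 0≤c = *-monoˡ-≤-nonNeg c {{nonNegative 0≤c}}

  *-monoʳ : ∀ {a b} c → 0ℚ ≤ c → a ≤ b → a * c ≤ b * c
  *-monoʳ c 0≤c = *-monoʳ-≤-nonNeg c {{nonNegative 0≤c}}

  0≤neg : ∀ {a} → a ≤ 0ℚ → 0ℚ ≤ - a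
  0≤neg p = neg-antimono-≤ p

  0≤sq : ∀ a → 0ℚ ≤ a * a
  0≤sq a with ≤-total 0ℚ a
  ... | inj₁ p = 0≤* p p
  ... | inj₂ p = subst (0ℚ ≤_) (eq a) (0≤* (0≤neg p) (0≤neg p))
    where
    eq : ∀ a → - a * - a ≡ a * a
    eq = solve-∀ ℚ-ring

  0<½ : 0ℚ < ½
  0<½ = positive⁻¹ ½

  0<1 : 0ℚ < 1ℚ
  0<1 = positive⁻¹ 1ℚ

  0≤1 : 0ℚ ≤ 1ℚ
  0≤1 = <⇒≤ 0<1

  half : ∀ a → ½ * a + ½ * a ≡ a
  half = solve-∀ ℚ-ring

  0<half : ∀ {a} → 0ℚ < a → 0ℚ < ½ * a
  0<half = 0<* 0<½

  a≤∣a∣ : ∀ a → a ≤ ∣ a ∣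
  a≤∣a∣ a with ≤-total 0ℚ a
  ... | inj₁ p = ≤-reflexive (sym (0≤p⇒∣p∣≡p p))
  ... | inj₂ p = ≤-trans p (0≤∣p∣ a)

  -a≤∣a∣ : ∀ a → - a ≤ ∣ a ∣
  -a≤∣a∣ a = subst (- a ≤_) (∣-p∣≡∣p∣ a) (a≤∣a∣ (- a))

  ∣∣≤ : ∀ {a b} → a ≤ b → - a ≤ b → ∣ a ∣ ≤ b
  ∣∣≤ {a} {b} p q with ∣p∣≡p∨∣p∣≡-p a
  ... | inj₁ e = subst (_≤ b) (sym e) p
  ... | inj₂ e = subst (_≤ b) (sym e) q

  ∣∣² : ∀ a → ∣ a ∣ * ∣ a ∣ ≡ a * a
  ∣∣² a = trans (sym (∣p*q∣≡∣p∣*∣q∣ a a)) (0≤p⇒∣p∣≡p (0≤sq a))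

  inv : ∀ {b} → 0ℚ < b → ∃ λ c → 0ℚ < c × b * c ≡ 1ℚ
  inv {b} p = 1/ b , positive⁻¹ (1/ b) {{1/pos⇒pos b}} , *-inverseʳ b
    where instance
      _ : Positive b
      _ = positive p
      _ : NonZero b
      _ = pos⇒nonZero b

  shrink : ∀ {ε b} → 0ℚ < ε → 0ℚ < b → ∃ λ δ → 0ℚ < δ × δ * b ≡ ε
  shrink {ε} {b} pε pb with inv pb
  ... | c , pc , e = ε * c , 0<* pε pc , trans (*-assoc ε c b) (trans (cong (ε *_) (trans (*-comm c b) e)) (*-identityʳ ε))

  ι : ℕ → ℚ
  ι zero    = 0ℚ
  ι (suc n) = 1ℚ + ι n

  0≤ι : ∀ n → 0ℚ ≤ ι n
  0≤ι zero    = ≤-refl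
  0≤ι (suc n) = 0≤+ 0≤1 (0≤ι n)

  0<ι : ∀ n → 0ℚ < ι (suc n)
  0<ι n = 0<+≤ 0<1 (0≤ι n)

  ι-+ : ∀ m n → ι (m ℕ.+ n) ≡ ι m + ι n
  ι-+ zero    n = sym (+-identityˡ (ι n))
  ι-+ (suc m) n = trans (cong (1ℚ +_) (ι-+ m n)) (sym (+-assoc 1ℚ (ι m) (ι n)))

  ι-mono : ∀ {m n} → m ℕ.≤ n → ι m ≤ ι n
  ι-mono {n = n} ℕ.z≤n = 0≤ι n
  ι-mono (ℕ.s≤s p) = +-monoʳ-≤ 1ℚ (ι-mono p)

  private
    ι-toℚᵘ : ∀ n → toℚᵘ (ι n) ℚᵘ.≃ ℚᵘ.mkℚᵘ (ℤ.+ n) 0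
    ι-toℚᵘ zero = ℚᵘ.*≡* refl
    ι-toℚᵘ (suc n) = ℚᵘₚ.≃-trans (toℚᵘ-homo-+ 1ℚ (ι n))
      (ℚᵘₚ.≃-trans (ℚᵘₚ.+-congʳ (toℚᵘ 1ℚ) (ι-toℚᵘ n))
        (ℚᵘ.*≡* (cong (ℤ._* ℤ.+ 1) (cong (λ x → ℤ.+ 1 ℤ.+ x) (ℤₚ.*-identityʳ (ℤ.+ n))))))

  arch : ∀ q → ∃ λ n → q ≤ ι n
  arch (mkℚ -[1+ k ] d c) = 0 , <⇒≤ (negative⁻¹ (mkℚ -[1+ k ] d c))
  arch (mkℚ (ℤ.+ k) d c) = k , toℚᵘ-cancel-≤ {mkℚ (ℤ.+ k) d c} {ι k} (ℚᵘₚ.≤-respʳ-≃ (ℚᵘₚ.≃-sym (ι-toℚᵘ k))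
     (ℚᵘ.*≤* (subst₂ ℤ._≤_ (ℤₚ.pos-* k 1) (ℤₚ.pos-* k (suc d)) (ℤ.+≤+ (ℕₚ.*-monoʳ-≤ k (ℕ.s≤s (ℕ.z≤n {d})))))))

  arch⁻¹ : ∀ {ε} → 0ℚ < ε → ∀ b → ∃ λ n → b ≤ ε * ι n
  arch⁻¹ {ε} p b with inv p
  ... | c , pc , e with arch (c * b)
  ... | n , q = n , ≤-trans (≤-reflexive eq) (*-monoˡ ε (<⇒≤ p) q)
    where
    eq : b ≡ ε * (c * b)
    eq = trans (sym (*-identityˡ b)) (trans (cong (_* b) (sym e)) (*-assoc ε c b))

module GaussianRationals where
  open RationalLemmas
  open import Algebra.Bundles using (CommutativeRing)
  open import Data.Rational hiding (∣_∣)
  open import Data.Rational using (∣_∣)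
  open import Data.Rational.Properties
  open import Data.Product
  open import Relation.Binary.PropositionalEquality
  open import Relation.Nullary
  open import Relation.Nullary.Decidable using (map′; dec⇒maybe)
  open import Relation.Nullary.Decidable using (_×-dec_)
  open import Tactic.RingSolver.Core.AlmostCommutativeRing using (AlmostCommutativeRing; fromCommutativeRing)
  open import Tactic.RingSolver using (solve-∀; solve)
  open import Data.List using ([]; _∷_)
  open import Data.Sum using (inj₁; inj₂)
  open import Level using (0ℓ)

  infix 5 _+i_
  record ℚ[i] : Set where
    constructor _+i_
    field
      re im : ℚ
  open ℚ[i] public

  infixl 6 _⊕_ _⊖_
  infixl 7 _⊗_
  infix  8 ⊝_

  _⊕_ _⊗_ _⊖_ : ℚ[i] → ℚ[i] → ℚ[i]
  (a +i b) ⊕ (c +i d) = (a + c) +i (b + d)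
  (a +i b) ⊗ (c +i d) = (a * c - b * d) +i (a * d + b * c)

  ⊝_ : ℚ[i] → ℚ[i]
  ⊝ (a +i b) = (- a) +i (- b)

  z ⊖ w = z ⊕ (⊝ w)

  0G 1G : ℚ[i]
  0G = 0ℚ +i 0ℚ
  1G = 1ℚ +i 0ℚ

  _≟G_ : (z w : ℚ[i]) → Dec (z ≡ w)
  (a +i b) ≟G (c +i d) =
    map′ (λ { (refl , refl) → refl }) (λ { refl → refl , refl }) ((a ≟ c) ×-dec (b ≟ d))

  private
    ⊗-assoc-re : ∀ a b c d e f → (a * c - b * d) * e - (a * d + b * c) * f ≡ a * (c * e - d * f) - b * (c * f + d * e)
    ⊗-assoc-re = solve-∀ ℚ-ring
    ⊗-assoc-im : ∀ a b c d e f → (a * c - b * d) * f + (a * d + b * c) * e ≡ a * (c * f + d * e) + b * (c * e - d * f)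
    ⊗-assoc-im = solve-∀ ℚ-ring
    ⊗-comm-re : ∀ a b c d → a * c - b * d ≡ c * a - d * b
    ⊗-comm-re = solve-∀ ℚ-ring
    ⊗-comm-im : ∀ a b c d → a * d + b * c ≡ c * b + d * a
    ⊗-comm-im = solve-∀ ℚ-ring
    ⊗-id-re : ∀ a b → 1ℚ * a - 0ℚ * b ≡ a
    ⊗-id-re = solve-∀ ℚ-ring
    ⊗-id-im : ∀ a b → 1ℚ * b + 0ℚ * a ≡ b
    ⊗-id-im = solve-∀ ℚ-ring
    ⊗-dist-re : ∀ a b c d e f → a * (c + e) - b * (d + f) ≡ (a * c - b * d) + (a * e - b * f)
    ⊗-dist-re = solve-∀ ℚ-ring
    ⊗-dist-im : ∀ a b c d e f → a * (d + f) + b * (c + e) ≡ (a * d + b * c) + (a * f + b * e)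
    ⊗-dist-im = solve-∀ ℚ-ring

  ⊕-assoc : ∀ x y z → (x ⊕ y) ⊕ z ≡ x ⊕ (y ⊕ z)
  ⊕-assoc (a +i b) (c +i d) (e +i f) = cong₂ _+i_ (+-assoc a c e) (+-assoc b d f)
  ⊕-comm : ∀ x y → x ⊕ y ≡ y ⊕ x
  ⊕-comm (a +i b) (c +i d) = cong₂ _+i_ (+-comm a c) (+-comm b d)
  ⊕-idˡ : ∀ x → 0G ⊕ x ≡ x
  ⊕-idˡ (a +i b) = cong₂ _+i_ (+-identityˡ a) (+-identityˡ b)
  ⊕-invʳ : ∀ x → x ⊕ ⊝ x ≡ 0G
  ⊕-invʳ (a +i b) = cong₂ _+i_ (+-inverseʳ a) (+-inverseʳ b)
  ⊗-assoc : ∀ x y z → (x ⊗ y) ⊗ z ≡ x ⊗ (y ⊗ z)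
  ⊗-assoc (a +i b) (c +i d) (e +i f) = cong₂ _+i_ (⊗-assoc-re a b c d e f) (⊗-assoc-im a b c d e f)
  ⊗-comm : ∀ x y → x ⊗ y ≡ y ⊗ x
  ⊗-comm (a +i b) (c +i d) = cong₂ _+i_ (⊗-comm-re a b c d) (⊗-comm-im a b c d)
  ⊗-idˡ : ∀ x → 1G ⊗ x ≡ x
  ⊗-idˡ (a +i b) = cong₂ _+i_ (⊗-id-re a b) (⊗-id-im a b)
  ⊗-distribˡ : ∀ x y z → x ⊗ (y ⊕ z) ≡ x ⊗ y ⊕ x ⊗ z
  ⊗-distribˡ (a +i b) (c +i d) (e +i f) = cong₂ _+i_ (⊗-dist-re a b c d e f) (⊗-dist-im a b c d e f)

  ℚ[i]-commutativeRing : CommutativeRing 0ℓ 0ℓ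
  ℚ[i]-commutativeRing = record
    { Carrier = ℚ[i] ; _≈_ = _≡_ ; _+_ = _⊕_ ; _*_ = _⊗_ ; -_ = ⊝_ ; 0# = 0G ; 1# = 1G
    ; isCommutativeRing = record
      { isRing = record
        { +-isAbelianGroup = record
          { isGroup = record
            { isMonoid = record
              { isSemigroup = record
                { isMagma = record { isEquivalence = isEquivalence ; ∙-cong = cong₂ _⊕_ }
                ; assoc = ⊕-assoc }
              ; identity = ⊕-idˡ , λ x → trans (⊕-comm x 0G) (⊕-idˡ x) }
            ; inverse = (λ x → trans (⊕-comm (⊝ x) x) (⊕-invʳ x)) , ⊕-invʳ
            ; ⁻¹-cong = cong ⊝_ }
          ; comm = ⊕-comm }
        ; *-cong = cong₂ _⊗_
        ; *-assoc = ⊗-assoc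
        ; *-identity = ⊗-idˡ , λ x → trans (⊗-comm x 1G) (⊗-idˡ x)
        ; distrib = ⊗-distribˡ , λ x y z → trans (⊗-comm (y ⊕ z) x)
            (trans (⊗-distribˡ x y z) (cong₂ _⊕_ (⊗-comm x y) (⊗-comm x z))) }
      ; *-comm = ⊗-comm }
    }

  G-ring : AlmostCommutativeRing 0ℓ 0ℓ
  G-ring = fromCommutativeRing ℚ[i]-commutativeRing (λ x → dec⇒maybe (0G ≟G x))

  -- The ℓ¹-norm, equivalent to the modulus: |z| ≤ ∥ z ∥ ≤ √2 |z|.
  ∥_∥ : ℚ[i] → ℚ
  ∥ a +i b ∥ = ∣ a ∣ + ∣ b ∣

  0≤∥∥ : ∀ z → 0ℚ ≤ ∥ z ∥
  0≤∥∥ (a +i b) = 0≤+ (0≤∣p∣ a) (0≤∣p∣ b)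

  ∥⊝∥ : ∀ z → ∥ ⊝ z ∥ ≡ ∥ z ∥
  ∥⊝∥ (a +i b) = cong₂ _+_ (∣-p∣≡∣p∣ a) (∣-p∣≡∣p∣ b)

  private
    mid : ∀ a b c d → (a + b) + (c + d) ≡ (a + c) + (b + d)
    mid = solve-∀ ℚ-ring
    foil : ∀ a b c d → (a * c + b * d) + (a * d + b * c) ≡ (a + b) * (c + d)
    foil = solve-∀ ℚ-ring

  ∥⊕∥ : ∀ z w → ∥ z ⊕ w ∥ ≤ ∥ z ∥ + ∥ w ∥
  ∥⊕∥ (a +i b) (c +i d) = ≤-trans (+-mono-≤ (∣p+q∣≤∣p∣+∣q∣ a c) (∣p+q∣≤∣p∣+∣q∣ b d))
    (≤-reflexive (mid (∣ a ∣) (∣ c ∣) (∣ b ∣) (∣ d ∣)))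

  ∥⊖∥ : ∀ z w → ∥ z ⊖ w ∥ ≤ ∥ z ∥ + ∥ w ∥
  ∥⊖∥ z w = subst (λ t → ∥ z ⊖ w ∥ ≤ ∥ z ∥ + t) (∥⊝∥ w) (∥⊕∥ z (⊝ w))

  ∥⊗∥ : ∀ z w → ∥ z ⊗ w ∥ ≤ ∥ z ∥ * ∥ w ∥
  ∥⊗∥ (a +i b) (c +i d) = ≤-trans (+-mono-≤
    (≤-trans (∣p-q∣≤∣p∣+∣q∣ (a * c) (b * d)) (≤-reflexive (cong₂ _+_ (∣p*q∣≡∣p∣*∣q∣ a c) (∣p*q∣≡∣p∣*∣q∣ b d))))
    (≤-trans (∣p+q∣≤∣p∣+∣q∣ (a * d) (b * c)) (≤-reflexive (cong₂ _+_ (∣p*q∣≡∣p∣*∣q∣ a d) (∣p*q∣≡∣p∣*∣q∣ b c)))))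
    (≤-reflexive (foil (∣ a ∣) (∣ b ∣) (∣ c ∣) (∣ d ∣)))

  ∥0∥ : ∥ 0G ∥ ≡ 0ℚ
  ∥0∥ = refl

  ∥1∥ : ∥ 1G ∥ ≡ 1ℚ
  ∥1∥ = refl

  ∥re∥ : ∀ z → ∣ re z ∣ ≤ ∥ z ∥
  ∥re∥ (a +i b) = ≤-by (0≤∣p∣ b) (eq (∣ a ∣) (∣ b ∣))
    where
    eq : ∀ x y → x + y - x ≡ y
    eq = solve-∀ ℚ-ring

  ∥im∥ : ∀ z → ∣ im z ∣ ≤ ∥ z ∥
  ∥im∥ (a +i b) = ≤-by (0≤∣p∣ a) (eq (∣ a ∣) (∣ b ∣))
    where
    eq : ∀ x y → x + y - y ≡ x
    eq = solve-∀ ℚ-ring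

  ∥x-y∥-sym : ∀ x y → ∥ x ⊖ y ∥ ≡ ∥ y ⊖ x ∥
  ∥x-y∥-sym x y = trans (cong ∥_∥ (eq x y)) (∥⊝∥ (y ⊖ x))
    where
    eq : ∀ x y → x ⊖ y ≡ ⊝ (y ⊖ x)
    eq = solve-∀ G-ring

  ∥△∥ : ∀ x y z → ∥ x ⊖ z ∥ ≤ ∥ x ⊖ y ∥ + ∥ y ⊖ z ∥
  ∥△∥ x y z = subst (λ t → ∥ t ∥ ≤ ∥ x ⊖ y ∥ + ∥ y ⊖ z ∥) (eq x y z) (∥⊕∥ (x ⊖ y) (y ⊖ z))
    where
    eq : ∀ x y z → (x ⊖ y) ⊕ (y ⊖ z) ≡ x ⊖ z
    eq = solve-∀ G-ring

  ∣_∣² : ℚ[i] → ℚ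
  ∣ a +i b ∣² = a * a + b * b

  2ℚ : ℚ
  2ℚ = 1ℚ + 1ℚ

  ∥∥²≤2∣∣² : ∀ z → ∥ z ∥ * ∥ z ∥ ≤ 2ℚ * ∣ z ∣²
  ∥∥²≤2∣∣² (a +i b) = ≤-by (0≤sq (∣ a ∣ - ∣ b ∣))
    (trans (cong (λ t → 2ℚ * t - (∣ a ∣ + ∣ b ∣) * (∣ a ∣ + ∣ b ∣)) (sym (cong₂ _+_ (∣∣² a) (∣∣² b)))) (eq (∣ a ∣) (∣ b ∣)))
    where
    eq : ∀ x y → (1ℚ + 1ℚ) * (x * x + y * y) - (x + y) * (x + y) ≡ (x - y) * (x - y)
    eq = solve-∀ ℚ-ring

  recip : ∀ q → Dec (q ≡ 0ℚ) → ℚ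
  recip q (yes _)  = 0ℚ
  recip q (no q≢0) = 1/_ q {{≢-nonZero q≢0}}

  -- the inverse in ℚ[i], with value 0 at 0
  _⁻ᴳ : ℚ[i] → ℚ[i]
  (a +i b) ⁻ᴳ = (a * r) +i (- b * r)
    where r = recip (∣ a +i b ∣²) (∣ a +i b ∣² ≟ 0ℚ)

  module _ {δ : ℚ} (z : ℚ[i]) (0<δ : 0ℚ < δ) (δ≤z : δ ≤ ∥ z ∥) where
    private
      0<z : 0ℚ < ∥ z ∥
      0<z = <-≤-trans 0<δ δ≤z
      a = re z
      b = im z
      n = ∣ z ∣²
      n≢0 : n ≢ 0ℚ
      n≢0 e = <-irrefl refl (<-≤-trans (0<* 0<z 0<z) (≤-trans (∥∥²≤2∣∣² z) (≤-reflexive (cong (2ℚ *_) e))))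
      r = recip n (n ≟ 0ℚ)
      nr : n * r ≡ 1ℚ
      nr with n ≟ 0ℚ
      ... | yes e = contradiction e n≢0
      ... | no ne = *-inverseʳ n {{≢-nonZero ne}}
      0≤n : 0ℚ ≤ n
      0≤n = 0≤+ (0≤sq a) (0≤sq b)
      0≤r : 0ℚ ≤ r
      0≤r with ≤-total 0ℚ r
      ... | inj₁ p = p
      ... | inj₂ p = contradiction
          (<-≤-trans 0<1 (subst (_≤ 0ℚ) nr (≤-trans (*-monoˡ n 0≤n p) (≤-reflexive (*-zeroʳ n)))))
          (<-irrefl refl)

    ⁻ᴳ-inverse : z ⊗ z ⁻ᴳ ≡ 1G
    ⁻ᴳ-inverse = cong₂ _+i_ (trans (eq₁ a b r) nr) (eq₂ a b r)
      where
      eq₁ : ∀ a b r → a * (a * r) - b * (- b * r) ≡ (a * a + b * b) * r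
      eq₁ = solve-∀ ℚ-ring
      eq₂ : ∀ a b r → a * (- b * r) + b * (a * r) ≡ 0ℚ
      eq₂ = solve-∀ ℚ-ring

    ⁻ᴳ-bound : δ * ∥ z ⁻ᴳ ∥ ≤ 2ℚ
    ⁻ᴳ-bound = ≤-trans (*-monoʳ (∥ z ⁻ᴳ ∥) (0≤∥∥ (z ⁻ᴳ)) δ≤z)
      (≤-trans (≤-reflexive eq) (≤-trans (*-monoʳ r 0≤r (∥∥²≤2∣∣² z)) (≤-reflexive eq′)))
      where
      nm : ∥ z ⁻ᴳ ∥ ≡ ∥ z ∥ * r
      nm = trans (cong₂ _+_ (trans (∣p*q∣≡∣p∣*∣q∣ a r) (cong (∣ a ∣ *_) (0≤p⇒∣p∣≡p 0≤r)))
            (trans (∣p*q∣≡∣p∣*∣q∣ (- b) r) (cong₂ _*_ (∣-p∣≡∣p∣ b) (0≤p⇒∣p∣≡p 0≤r))))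
            (sym (*-distribʳ-+ r (∣ a ∣) (∣ b ∣)))
      eq : ∥ z ∥ * ∥ z ⁻ᴳ ∥ ≡ ∥ z ∥ * ∥ z ∥ * r
      eq = trans (cong (∥ z ∥ *_) nm) (sym (*-assoc (∥ z ∥) (∥ z ∥) r))
      eq′ : 2ℚ * n * r ≡ 2ℚ
      eq′ = trans (*-assoc 2ℚ n r) (trans (cong (2ℚ *_) nr) (*-identityʳ 2ℚ))

module ComplexNumbers where
  open RationalLemmas
  open GaussianRationals
  open import Algebra.Apartness.Bundles using (HeytingField)
  open import Data.Rational using (ℚ; 0ℚ; 1ℚ; ½; _+_; _*_; -_; _-_; _≤_; _<_)
  open import Data.Rational.Properties
  open import Data.Nat as ℕ using (ℕ; zero; suc)
  import Data.Nat.Properties as ℕₚ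
  open import Data.Product
  open import Data.Sum using (_⊎_; inj₁; inj₂)
  open import Relation.Binary.PropositionalEquality
  open import Relation.Nullary
  open import Tactic.RingSolver using (solve-∀)
  open import Level using (0ℓ)

  Eventually : (ℕ → Set) → Set
  Eventually P = ∃ λ N → ∀ n → N ℕ.≤ n → P n

  ev-map : ∀ {P Q} → (∀ {n} → P n → Q n) → Eventually P → Eventually Q
  ev-map f (N , p) = N , λ n N≤n → f (p n N≤n)

  ev-zip : ∀ {P Q R} → (∀ {n} → P n → Q n → R n) → Eventually P → Eventually Q → Eventually R
  ev-zip f (N , p) (M , q) = N ℕ.⊔ M , λ n l → f (p n (ℕₚ.≤-trans (ℕₚ.m≤m⊔n N M) l)) (q n (ℕₚ.≤-trans (ℕₚ.m≤n⊔m N M) l))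

  -- ℂ as the completion of ℚ(i): a Cauchy sequence of Gaussian rationals is a pair of Cauchy
  -- sequences of rationals, the real and the imaginary part.
  record ℂ : Set where
    no-eta-equality
    constructor mkℂ
    field
      seq    : ℕ → ℚ[i]
      cauchy : ∀ ε → 0ℚ < ε → ∃ λ N → ∀ m n → N ℕ.≤ m → N ℕ.≤ n → ∥ seq m ⊖ seq n ∥ ≤ ε
  open ℂ public

  infix 4 _≈_ _#_

  record _≈_ (x y : ℂ) : Set where
    constructor mk≈
    field close : ∀ ε → 0ℚ < ε → Eventually (λ n → ∥ seq x n ⊖ seq y n ∥ ≤ ε)
  open _≈_ public

  record _#_ (x y : ℂ) : Set where
    constructor mk#
    field
      gap     : ℚ
      0<gap   : 0ℚ < gap
      distant : Eventually (λ n → gap ≤ ∥ seq x n ⊖ seq y n ∥)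
  open _#_ public

  private
    x⊖x : ∀ x → x ⊖ x ≡ 0G
    x⊖x = solve-∀ G-ring

    ½+½ : ∀ {a b ε} → a ≤ ½ * ε → b ≤ ½ * ε → a + b ≤ ε
    ½+½ {ε = ε} p q = ≤-trans (+-mono-≤ p q) (≤-reflexive (half ε))

  pointwise : ∀ {x y} → (∀ n → seq x n ≡ seq y n) → x ≈ y
  pointwise {x} {y} eq = mk≈ λ ε 0<ε → 0 , λ n _ →
    subst (λ t → ∥ seq x n ⊖ t ∥ ≤ ε) (eq n) (subst (λ t → ∥ t ∥ ≤ ε) (sym (x⊖x (seq x n))) (<⇒≤ 0<ε))

  ≈-refl : ∀ {x} → x ≈ x
  ≈-refl = pointwise λ n → refl

  ≈-sym : ∀ {x y} → x ≈ y → y ≈ x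
  ≈-sym {x} {y} p = mk≈ λ ε 0<ε → ev-map (λ {n} → subst (_≤ ε) (∥x-y∥-sym (seq x n) (seq y n))) (close p ε 0<ε)

  ≈-trans : ∀ {x y z} → x ≈ y → y ≈ z → x ≈ z
  ≈-trans {x} {y} {z} p q = mk≈ λ ε 0<ε → ev-zip
    (λ {n} a b → ≤-trans (∥△∥ (seq x n) (seq y n) (seq z n)) (½+½ a b))
    (close p (½ * ε) (0<half 0<ε)) (close q (½ * ε) (0<half 0<ε))

  half< : ∀ {e} → 0ℚ < e → ½ * e < e
  half< {e} 0<e = <-by (0<half 0<e) (eq e)
    where
    eq : ∀ e → e - ½ * e ≡ ½ * e
    eq = solve-∀ ℚ-ring

  abstract
    bounded : ∀ x → ∃ λ B → 0ℚ < B × Eventually (λ n → ∥ seq x n ∥ ≤ B)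
    bounded x with cauchy x 1ℚ 0<1
    ... | N , p = ∥ seq x N ∥ + 1ℚ , +-mono-≤-< (0≤∥∥ (seq x N)) 0<1 , N , λ n N≤n →
      ≤-trans (subst (λ t → ∥ t ∥ ≤ ∥ seq x N ∥ + ∥ seq x n ⊖ seq x N ∥) (eq (seq x N) (seq x n)) (∥⊕∥ (seq x N) (seq x n ⊖ seq x N)))
        (+-monoʳ-≤ (∥ seq x N ∥) (p n N N≤n ℕₚ.≤-refl))
      where
      eq : ∀ a b → a ⊕ (b ⊖ a) ≡ b
      eq = solve-∀ G-ring

  private
    ⊕-diff : ∀ a b c d → ∥ (a ⊕ b) ⊖ (c ⊕ d) ∥ ≤ ∥ a ⊖ c ∥ + ∥ b ⊖ d ∥
    ⊕-diff a b c d = subst (λ t → ∥ t ∥ ≤ ∥ a ⊖ c ∥ + ∥ b ⊖ d ∥) (eq a b c d) (∥⊕∥ (a ⊖ c) (b ⊖ d))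
      where
      eq : ∀ a b c d → (a ⊖ c) ⊕ (b ⊖ d) ≡ (a ⊕ b) ⊖ (c ⊕ d)
      eq = solve-∀ G-ring

    ⊝-diff : ∀ a b → ∥ ⊝ a ⊖ ⊝ b ∥ ≡ ∥ a ⊖ b ∥
    ⊝-diff a b = trans (cong ∥_∥ (eq a b)) (∥⊝∥ (a ⊖ b))
      where
      eq : ∀ a b → ⊝ a ⊖ ⊝ b ≡ ⊝ (a ⊖ b)
      eq = solve-∀ G-ring

  ⊗-diff : ∀ a b c d → ∥ a ⊗ b ⊖ c ⊗ d ∥ ≤ ∥ b ⊖ d ∥ * ∥ a ∥ + ∥ a ⊖ c ∥ * ∥ d ∥
  ⊗-diff a b c d = subst (λ t → ∥ t ∥ ≤ ∥ b ⊖ d ∥ * ∥ a ∥ + ∥ a ⊖ c ∥ * ∥ d ∥) (eq a b c d)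
    (≤-trans (∥⊕∥ ((b ⊖ d) ⊗ a) ((a ⊖ c) ⊗ d)) (+-mono-≤ (∥⊗∥ (b ⊖ d) a) (∥⊗∥ (a ⊖ c) d)))
    where
    eq : ∀ a b c d → (b ⊖ d) ⊗ a ⊕ (a ⊖ c) ⊗ d ≡ a ⊗ b ⊖ c ⊗ d
    eq = solve-∀ G-ring

  infixl 6 _+ℂ_
  infixl 7 _*ℂ_
  infix  8 -ℂ_

  Cauchy : (ℕ → ℚ[i]) → Set
  Cauchy s = ∀ ε → 0ℚ < ε → ∃ λ N → ∀ m n → N ℕ.≤ m → N ℕ.≤ n → ∥ s m ⊖ s n ∥ ≤ ε

  late : ∀ x y {d e} → 0ℚ < d → 0ℚ < e → ∃ λ N →
    (∀ m n → N ℕ.≤ m → N ℕ.≤ n → ∥ seq x m ⊖ seq x n ∥ ≤ d) ×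
    (∀ m n → N ℕ.≤ m → N ℕ.≤ n → ∥ seq y m ⊖ seq y n ∥ ≤ e)
  late x y {d} {e} p q =
    let N , a = cauchy x d p
        M , b = cauchy y e q
    in N ℕ.⊔ M ,
    (λ m n p q → a m n (ℕₚ.m⊔n≤o⇒m≤o N M p) (ℕₚ.m⊔n≤o⇒m≤o N M q)) ,
    (λ m n p q → b m n (ℕₚ.m⊔n≤o⇒n≤o N M p) (ℕₚ.m⊔n≤o⇒n≤o N M q))

  abstract
    +-cauchy : ∀ x y → Cauchy (λ n → seq x n ⊕ seq y n)
    +-cauchy x y ε 0<ε =
      let N , p , q = late x y (0<half 0<ε) (0<half 0<ε)
      in N , λ m n a b → ≤-trans (⊕-diff (seq x m) (seq y m) (seq x n) (seq y n)) (½+½ (p m n a b) (q m n a b))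

    *-cauchy : ∀ x y → Cauchy (λ n → seq x n ⊗ seq y n)
    *-cauchy x y ε 0<ε =
      let B , 0<B , bx = bounded x
          C , 0<C , by = bounded y
          N , bb = ev-zip {Q = λ n → ∥ seq y n ∥ ≤ C} {R = λ n → (∥ seq x n ∥ ≤ B) × (∥ seq y n ∥ ≤ C)} _,_ bx by
          δ , 0<δ , eδ = shrink (0<half 0<ε) 0<B
          η , 0<η , eη = shrink (0<half 0<ε) 0<C
          M , cx , cy = late x y 0<η 0<δ
      in N ℕ.⊔ M , λ m n a b →
        let xm = seq x m ; xn = seq x n ; ym = seq y m ; yn = seq y n
            a₁ = ℕₚ.m⊔n≤o⇒m≤o N M a
            b₁ = ℕₚ.m⊔n≤o⇒m≤o N M b
            a₂ = ℕₚ.m⊔n≤o⇒n≤o N M a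
            b₂ = ℕₚ.m⊔n≤o⇒n≤o N M b
        in ≤-trans (⊗-diff xm ym xn yn)
        (½+½ (≤-trans (*-mono (0≤∥∥ (ym ⊖ yn)) (<⇒≤ 0<B) (cy m n a₂ b₂) (proj₁ (bb m a₁)))
                (≤-reflexive eδ))
             (≤-trans (*-mono (0≤∥∥ (xm ⊖ xn)) (<⇒≤ 0<C) (cx m n a₂ b₂) (proj₂ (bb n b₁)))
                (≤-reflexive eη)))

    neg-cauchy : ∀ x → Cauchy (λ n → ⊝ seq x n)
    neg-cauchy x ε 0<ε = let N , p = cauchy x ε 0<ε in
      N , λ m n a b → subst (_≤ ε) (sym (⊝-diff (seq x m) (seq x n))) (p m n a b)

    const-cauchy : ∀ z → Cauchy (λ _ → z)
    const-cauchy z ε 0<ε = 0 , λ _ _ _ _ → subst (λ t → ∥ t ∥ ≤ ε) (sym (x⊖x z)) (<⇒≤ 0<ε)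

  _+ℂ_ _*ℂ_ : ℂ → ℂ → ℂ
  x +ℂ y = mkℂ (λ n → seq x n ⊕ seq y n) (+-cauchy x y)
  x *ℂ y = mkℂ (λ n → seq x n ⊗ seq y n) (*-cauchy x y)

  -ℂ_ : ℂ → ℂ
  -ℂ x = mkℂ (λ n → ⊝ seq x n) (neg-cauchy x)

  const : ℚ[i] → ℂ
  const z = mkℂ (λ _ → z) (const-cauchy z)

  0ℂ 1ℂ : ℂ
  0ℂ = const 0G
  1ℂ = const 1G

  +-congℂ : ∀ {x x′ y y′} → x ≈ x′ → y ≈ y′ → x +ℂ y ≈ x′ +ℂ y′
  +-congℂ {x} {x′} {y} {y′} p q = mk≈ λ ε 0<ε → ev-zip
    (λ {n} a b → ≤-trans (⊕-diff (seq x n) (seq y n) (seq x′ n) (seq y′ n)) (½+½ a b))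
    (close p (½ * ε) (0<half 0<ε)) (close q (½ * ε) (0<half 0<ε))

  -‿congℂ : ∀ {x y} → x ≈ y → -ℂ x ≈ -ℂ y
  -‿congℂ {x} {y} p = mk≈ λ ε 0<ε → ev-map
    (λ {n} → subst (_≤ ε) (sym (⊝-diff (seq x n) (seq y n)))) (close p ε 0<ε)

  *-congℂ : ∀ {x x′ y y′} → x ≈ x′ → y ≈ y′ → x *ℂ y ≈ x′ *ℂ y′
  *-congℂ {x} {x′} {y} {y′} p q = mk≈ λ ε 0<ε →
    let B , 0<B , bx = bounded x
        C , 0<C , by = bounded y′
        δ , 0<δ , eδ = shrink (0<half 0<ε) 0<B
        η , 0<η , eη = shrink (0<half 0<ε) 0<C
    in ev-zip {P = λ n → (∥ seq x n ∥ ≤ B) × (∥ seq y′ n ∥ ≤ C)}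
              {Q = λ n → (∥ seq y n ⊖ seq y′ n ∥ ≤ δ) × (∥ seq x n ⊖ seq x′ n ∥ ≤ η)}
      (λ {n} bxy cyx → ≤-trans (⊗-diff (seq x n) (seq y n) (seq x′ n) (seq y′ n))
        (½+½ (≤-trans (*-mono (0≤∥∥ (seq y n ⊖ seq y′ n)) (<⇒≤ 0<B) (proj₁ cyx) (proj₁ bxy)) (≤-reflexive eδ))
             (≤-trans (*-mono (0≤∥∥ (seq x n ⊖ seq x′ n)) (<⇒≤ 0<C) (proj₂ cyx) (proj₂ bxy)) (≤-reflexive eη))))
      (ev-zip _,_ bx by) (ev-zip _,_ (close q δ 0<δ) (close p η 0<η))

  #-sym : ∀ {x y} → x # y → y # x
  #-sym {x} {y} (mk# e p d) = mk# e p (ev-map (λ {n} → subst (e ≤_) (∥x-y∥-sym (seq x n) (seq y n))) d)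

  #-irrefl : ∀ {x y} → x ≈ y → ¬ (x # y)
  #-irrefl x≈y (mk# e 0<e (N , d)) =
    let M , c = close x≈y (½ * e) (0<half 0<e)
    in <-irrefl refl (<-≤-trans (half< 0<e) (≤-trans (d (N ℕ.⊔ M) (ℕₚ.m≤m⊔n N M)) (c (N ℕ.⊔ M) (ℕₚ.m≤n⊔m N M))))

  -- A lower bound at one late enough index persists.
  private
    persists : ∀ {x y e} N → (∀ m n → N ℕ.≤ m → N ℕ.≤ n → ∥ seq x m ⊖ seq x n ∥ ≤ e) →
      (∀ m n → N ℕ.≤ m → N ℕ.≤ n → ∥ seq y m ⊖ seq y n ∥ ≤ e) → 0ℚ < e →
      (e + e) + e ≤ ∥ seq x N ⊖ seq y N ∥ → x # y
    persists {x} {y} {e} N cx cy 0<e big = mk# e 0<e (N , λ n N≤n →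
      let xN = seq x N; yN = seq y N; xn = seq x n; yn = seq y n
          t = ≤-trans (∥△∥ xN xn yN) (+-mono-≤ (cx N n ℕₚ.≤-refl N≤n)
                (≤-trans (∥△∥ xn yn yN) (+-monoʳ-≤ (∥ xn ⊖ yn ∥) (cy n N N≤n ℕₚ.≤-refl))))
          in ≤-by (0≤- (≤-trans big t)) (eq e (∥ xn ⊖ yn ∥)))
      where
      eq : ∀ e d → d - e ≡ e + (d + e) - (e + e + e)
      eq = solve-∀ ℚ-ring

    third : ∀ {e} → 0ℚ < e → ∃ λ d → 0ℚ < d × (d + d) + d ≤ ½ * e
    third {e} p = ½ * (½ * (½ * e)) , 0<half (0<half (0<half p)) ,
      ≤-by (<⇒≤ (0<half (0<half (0<half p)))) (eq e)
      where
      eq : ∀ e → ½ * e - (½ * (½ * (½ * e)) + ½ * (½ * (½ * e)) + ½ * (½ * (½ * e))) ≡ ½ * (½ * (½ * e))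
      eq = solve-∀ ℚ-ring

  #-cotrans : ∀ {x y} → x # y → ∀ z → (x # z) ⊎ (z # y)
  #-cotrans {x} {y} (mk# e 0<e (N₀ , d)) z =
    let δ , 0<δ , 3δ≤ = third 0<e
        N₁ , cx , cy = late x y 0<δ 0<δ
        N₂ , cz , _ = late z z 0<δ 0<δ
        N = N₀ ℕ.⊔ (N₁ ℕ.⊔ N₂)
        N₀≤ = ℕₚ.m≤m⊔n N₀ (N₁ ℕ.⊔ N₂)
        N₁≤ = ℕₚ.≤-trans (ℕₚ.m≤m⊔n N₁ N₂) (ℕₚ.m≤n⊔m N₀ (N₁ ℕ.⊔ N₂))
        N₂≤ = ℕₚ.≤-trans (ℕₚ.m≤n⊔m N₁ N₂) (ℕₚ.m≤n⊔m N₀ (N₁ ℕ.⊔ N₂))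
    in case N δ 0<δ 3δ≤ (d N N₀≤)
      (λ m n p q → cx m n (ℕₚ.≤-trans N₁≤ p) (ℕₚ.≤-trans N₁≤ q))
      (λ m n p q → cy m n (ℕₚ.≤-trans N₁≤ p) (ℕₚ.≤-trans N₁≤ q))
      (λ m n p q → cz m n (ℕₚ.≤-trans N₂≤ p) (ℕₚ.≤-trans N₂≤ q))
      (≤-total (½ * e) (∥ seq x N ⊖ seq z N ∥))
    where
    eq : ∀ e a b → b - ½ * e ≡ (a + b - e) + (½ * e - a)
    eq = solve-∀ ℚ-ring
    case : ∀ N δ → 0ℚ < δ → δ + δ + δ ≤ ½ * e → e ≤ ∥ seq x N ⊖ seq y N ∥ →
      (∀ m n → N ℕ.≤ m → N ℕ.≤ n → ∥ seq x m ⊖ seq x n ∥ ≤ δ) →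
      (∀ m n → N ℕ.≤ m → N ℕ.≤ n → ∥ seq y m ⊖ seq y n ∥ ≤ δ) →
      (∀ m n → N ℕ.≤ m → N ℕ.≤ n → ∥ seq z m ⊖ seq z n ∥ ≤ δ) →
      (½ * e ≤ ∥ seq x N ⊖ seq z N ∥) ⊎ (∥ seq x N ⊖ seq z N ∥ ≤ ½ * e) → (x # z) ⊎ (z # y)
    case N δ 0<δ 3δ≤ d cx cy cz (inj₁ p) = inj₁ (persists N cx cz 0<δ (≤-trans 3δ≤ p))
    case N δ 0<δ 3δ≤ d cx cy cz (inj₂ p) = inj₂ (persists N cz cy 0<δ (≤-trans 3δ≤
        (≤-by (0≤+ (0≤- (≤-trans d (∥△∥ (seq x N) (seq z N) (seq y N)))) (0≤- p))
          (eq e (∥ seq x N ⊖ seq z N ∥) (∥ seq z N ⊖ seq y N ∥)))))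

  tightℂ : ∀ x y → (¬ (x # y) → x ≈ y) × (x ≈ y → ¬ (x # y))
  tightℂ x y = to , #-irrefl
    where
    case : ¬ (x # y) → ∀ {δ N ε} n → (∀ i j → N ℕ.≤ i → N ℕ.≤ j → ∥ seq x i ⊖ seq x j ∥ ≤ δ) →
       (∀ i j → N ℕ.≤ i → N ℕ.≤ j → ∥ seq y i ⊖ seq y j ∥ ≤ δ) → N ℕ.≤ n → 0ℚ < δ →
       δ + δ + δ ≤ ½ * ε → 0ℚ < ε →
       (∥ seq x n ⊖ seq y n ∥ ≤ ε) ⊎ (ε ≤ ∥ seq x n ⊖ seq y n ∥) → ∥ seq x n ⊖ seq y n ∥ ≤ ε
    case ¬# n cx cy N≤n 0<δ 3δ≤ 0<ε (inj₁ p) = p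
    case ¬# n cx cy N≤n 0<δ 3δ≤ 0<ε (inj₂ p) = contradiction (persists n
          (λ i j a b → cx i j (ℕₚ.≤-trans N≤n a) (ℕₚ.≤-trans N≤n b))
          (λ i j a b → cy i j (ℕₚ.≤-trans N≤n a) (ℕₚ.≤-trans N≤n b)) 0<δ
          (≤-trans 3δ≤ (≤-trans (<⇒≤ (half< 0<ε)) p))) ¬#
    to : ¬ (x # y) → x ≈ y
    to ¬# = mk≈ λ ε 0<ε → let δ , 0<δ , 3δ≤ = third 0<ε ; N , cx , cy = late x y 0<δ 0<δ in
      N , λ n N≤n → case ¬# n cx cy N≤n 0<δ 3δ≤ 0<ε (≤-total (∥ seq x n ⊖ seq y n ∥) ε)

  module _ (x : ℂ) (gp : ℚ) (0<gp : 0ℚ < gp) (far : Eventually (λ n → gp ≤ ∥ seq x n ∥)) where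
    private
      B : ℚ
      B = 2ℚ * proj₁ (inv 0<gp)
      0<B : 0ℚ < B
      0<B = 0<* (0<+ 0<1 0<1) (proj₁ (proj₂ (inv 0<gp)))
      bnd : ∀ n → gp ≤ ∥ seq x n ∥ → ∥ seq x n ⁻ᴳ ∥ ≤ B
      bnd n p = subst₂ _≤_ eq (*-comm c 2ℚ) (*-monoˡ c (<⇒≤ 0<c) (⁻ᴳ-bound (seq x n) 0<gp p))
        where
        c = proj₁ (inv 0<gp)
        0<c = proj₁ (proj₂ (inv 0<gp))
        w = ∥ seq x n ⁻ᴳ ∥
        eq : c * (gp * w) ≡ w
        eq = trans (sym (*-assoc c gp w)) (trans (cong (_* w) (trans (*-comm c gp) (proj₂ (proj₂ (inv 0<gp))))) (*-identityˡ w))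
      diff : ∀ m n → gp ≤ ∥ seq x m ∥ → gp ≤ ∥ seq x n ∥ →
        ∥ seq x m ⁻ᴳ ⊖ seq x n ⁻ᴳ ∥ ≤ ∥ seq x n ⊖ seq x m ∥ * (B * B)
      diff m n p q = subst (λ t → ∥ t ∥ ≤ ∥ seq x n ⊖ seq x m ∥ * (B * B)) eq
        (≤-trans (∥⊗∥ (b ⊖ a) (a′ ⊗ b′)) (*-monoˡ (∥ b ⊖ a ∥) (0≤∥∥ (b ⊖ a))
          (≤-trans (∥⊗∥ a′ b′) (*-mono (0≤∥∥ a′) (<⇒≤ 0<B) (bnd m p) (bnd n q)))))
        where
        a = seq x m
        b = seq x n
        a′ = a ⁻ᴳ
        b′ = b ⁻ᴳ
        e₁ : ∀ a b a′ b′ → (b ⊖ a) ⊗ (a′ ⊗ b′) ≡ a′ ⊗ (b ⊗ b′) ⊖ b′ ⊗ (a ⊗ a′)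
        e₁ = solve-∀ G-ring
        e₂ : ∀ a b → a ⊗ 1G ⊖ b ⊗ 1G ≡ a ⊖ b
        e₂ = solve-∀ G-ring
        eq : (b ⊖ a) ⊗ (a′ ⊗ b′) ≡ a′ ⊖ b′
        eq = trans (e₁ a b a′ b′) (trans (cong₂ (λ s t → a′ ⊗ s ⊖ b′ ⊗ t) (⁻ᴳ-inverse b 0<gp q) (⁻ᴳ-inverse a 0<gp p)) (e₂ a′ b′))

    abstract
      inv-cauchy : Cauchy (λ n → seq x n ⁻ᴳ)
      inv-cauchy ε 0<ε =
        let δ , 0<δ , eδ = shrink 0<ε (0<* 0<B 0<B)
            N , c = cauchy x δ 0<δ
        in N ℕ.⊔ proj₁ far , λ m n p q →
        ≤-trans (diff m n (proj₂ far m (ℕₚ.m⊔n≤o⇒n≤o N (proj₁ far) p)) (proj₂ far n (ℕₚ.m⊔n≤o⇒n≤o N (proj₁ far) q)))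
          (≤-trans (*-monoʳ (B * B) (<⇒≤ (0<* 0<B 0<B))
             (c n m (ℕₚ.m⊔n≤o⇒m≤o N (proj₁ far) q) (ℕₚ.m⊔n≤o⇒m≤o N (proj₁ far) p))) (≤-reflexive eδ))

    invℂ : ℂ
    invℂ = mkℂ (λ n → seq x n ⁻ᴳ) inv-cauchy

    invℂ-inverse : x *ℂ invℂ ≈ 1ℂ
    invℂ-inverse = mk≈ λ ε 0<ε → ev-map (λ {n} p → subst (λ t → ∥ t ⊖ 1G ∥ ≤ ε) (sym (⁻ᴳ-inverse (seq x n) 0<gp p)) (<⇒≤ 0<ε)) far

  *-commℂ : ∀ x y → x *ℂ y ≈ y *ℂ x
  *-commℂ x y = pointwise λ n → ⊗-comm (seq x n) (seq y n)

  invertible : ∀ {x y} → x # y → ∃ λ w → (w *ℂ (x +ℂ -ℂ y) ≈ 1ℂ) × ((x +ℂ -ℂ y) *ℂ w ≈ 1ℂ)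
  invertible {x} {y} (mk# e p d) = w , ≈-trans (*-commℂ w (x +ℂ -ℂ y)) eq , eq
    where
    w = invℂ (x +ℂ -ℂ y) e p d
    eq = invℂ-inverse (x +ℂ -ℂ y) e p d

  private
    factor-far : ∀ {B c} → 0ℚ < c → B * c ≡ 1ℚ → ∀ a z → ∥ a ∥ ≤ B → ∥ a ⊗ z ⊖ 1G ∥ ≤ ½ → ½ * c ≤ ∥ z ∥
    factor-far {B} {c} 0<c Bc a z a≤B p = subst (½ * c ≤_) eq (*-monoʳ c (<⇒≤ 0<c) lo)
      where
      e₁ : ∀ a z → a ⊗ z ⊖ (a ⊗ z ⊖ 1G) ≡ 1G
      e₁ = solve-∀ G-ring
      e₂ : ∀ t → t - ½ ≡ t + ½ - 1ℚ
      e₂ = solve-∀ ℚ-ring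
      e₃ : ∀ b z c → b * z * c ≡ b * c * z
      e₃ = solve-∀ ℚ-ring
      lo′ : 1ℚ ≤ B * ∥ z ∥ + ½
      lo′ = ≤-trans (≤-reflexive (trans (sym ∥1∥) (cong ∥_∥ (sym (e₁ a z)))))
        (≤-trans (∥⊖∥ (a ⊗ z) (a ⊗ z ⊖ 1G)) (+-mono-≤ (≤-trans (∥⊗∥ a z) (*-monoʳ (∥ z ∥) (0≤∥∥ z) a≤B)) p))
      lo : ½ ≤ B * ∥ z ∥
      lo = ≤-by (0≤- lo′) (e₂ (B * ∥ z ∥))
      eq : B * ∥ z ∥ * c ≡ ∥ z ∥
      eq = trans (e₃ B (∥ z ∥) c) (trans (cong (_* ∥ z ∥) Bc) (*-identityˡ (∥ z ∥)))

  invertible⁻¹ : ∀ {x y} → ∃ (λ w → (w *ℂ (x +ℂ -ℂ y) ≈ 1ℂ) × ((x +ℂ -ℂ y) *ℂ w ≈ 1ℂ)) → x # y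
  invertible⁻¹ {x} {y} (w , e , _) =
    let B , 0<B , bw = bounded w
        c , 0<c , Bc = inv 0<B
    in mk# (½ * c) (0<half 0<c)
      (ev-zip (λ {n} → factor-far 0<c Bc (seq w n) (seq x n ⊖ seq y n)) bw (close e ½ 0<½))

  ℂ-heytingField : HeytingField 0ℓ 0ℓ 0ℓ
  ℂ-heytingField = record
    { Carrier = ℂ ; _≈_ = _≈_ ; _#_ = _#_ ; _+_ = _+ℂ_ ; _*_ = _*ℂ_ ; -_ = -ℂ_ ; 0# = 0ℂ ; 1# = 1ℂ
    ; isHeytingField = record
      { isHeytingCommutativeRing = record
        { isCommutativeRing = record
          { isRing = record
            { +-isAbelianGroup = record
              { isGroup = record
                { isMonoid = record
                  { isSemigroup = record
                    { isMagma = record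
                      { isEquivalence = record { refl = ≈-refl ; sym = ≈-sym ; trans = ≈-trans }
                      ; ∙-cong = +-congℂ }
                    ; assoc = λ x y z → pointwise λ n → ⊕-assoc (seq x n) (seq y n) (seq z n) }
                  ; identity = (λ x → pointwise λ n → ⊕-idˡ (seq x n))
                             , (λ x → pointwise λ n → trans (⊕-comm (seq x n) 0G) (⊕-idˡ (seq x n))) }
                ; inverse = (λ x → pointwise λ n → trans (⊕-comm (⊝ seq x n) (seq x n)) (⊕-invʳ (seq x n)))
                          , (λ x → pointwise λ n → ⊕-invʳ (seq x n))
                ; ⁻¹-cong = -‿congℂ }
              ; comm = λ x y → pointwise λ n → ⊕-comm (seq x n) (seq y n) }
            ; *-cong = *-congℂ
            ; *-assoc = λ x y z → pointwise λ n → ⊗-assoc (seq x n) (seq y n) (seq z n)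
            ; *-identity = (λ x → pointwise λ n → ⊗-idˡ (seq x n))
                         , (λ x → pointwise λ n → trans (⊗-comm (seq x n) 1G) (⊗-idˡ (seq x n)))
            ; distrib = (λ x y z → pointwise λ n → ⊗-distribˡ (seq x n) (seq y n) (seq z n))
                      , (λ x y z → pointwise λ n → distribʳ (seq x n) (seq y n) (seq z n)) }
          ; *-comm = *-commℂ }
        ; isApartnessRelation = record { irrefl = #-irrefl ; sym = #-sym ; cotrans = #-cotrans }
        ; #⇒invertible = invertible
        ; invertible⇒# = invertible⁻¹ }
      ; tight = tightℂ }
    }
    where
    distribʳ : ∀ x y z → (y ⊕ z) ⊗ x ≡ y ⊗ x ⊕ z ⊗ x
    distribʳ = solve-∀ G-ring

-- A rational point v of the unit circle with a small argument is iterated until it has passed a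
-- quarter turn.  A suitable power of v is then nearly a primitive n-th root of unity, and Newton's
-- iteration starting there converges to an exact one.

module NewtonIteration where
  open RationalLemmas
  open GaussianRationals
  open ComplexNumbers
  open import Algebra.Apartness.Bundles using (HeytingField)
  open import Data.Rational using (ℚ; 0ℚ; 1ℚ; ½; positive; _+_; _*_; -_; _-_; _≤_; _<_)
  open import Data.Rational.Properties
  open import Data.Nat as ℕ using (ℕ; zero; suc)
  import Data.Nat.Properties as ℕₚ
  open import Data.Product
  open import Data.Sum using (_⊎_; inj₁; inj₂)
  open import Relation.Binary.PropositionalEquality
  open import Relation.Nullary
  open import Tactic.RingSolver using (solve-∀)

  infixr 8 _^G_
  _^G_ : ℚ[i] → ℕ → ℚ[i]
  z ^G zero  = 1G
  z ^G suc n = z ⊗ z ^G n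

  ^G-distrib : ∀ z w n → (z ⊗ w) ^G n ≡ z ^G n ⊗ w ^G n
  ^G-distrib z w zero = refl
  ^G-distrib z w (suc n) = trans (cong ((z ⊗ w) ⊗_) (^G-distrib z w n)) (eq z w (z ^G n) (w ^G n))
    where
    eq : ∀ z w a b → (z ⊗ w) ⊗ (a ⊗ b) ≡ (z ⊗ a) ⊗ (w ⊗ b)
    eq = solve-∀ G-ring

  ιG : ℕ → ℚ[i]
  ιG zero    = 0G
  ιG (suc n) = 1G ⊕ ιG n

  ιG-ι : ∀ n → ιG n ≡ (ι n +i 0ℚ)
  ιG-ι zero = refl
  ιG-ι (suc n) = trans (cong (1G ⊕_) (ιG-ι n)) (cong (1ℚ + ι n +i_) refl)

  ∥ι∥ : ∀ q → 0ℚ ≤ q → ∥ q +i 0ℚ ∥ ≡ q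
  ∥ι∥ q p = trans (cong₂ _+_ (0≤p⇒∣p∣≡p p) refl) (+-identityʳ q)

  ∥ιG∥ : ∀ n → ∥ ιG n ∥ ≡ ι n
  ∥ιG∥ n = trans (cong ∥_∥ (ιG-ι n)) (∥ι∥ (ι n) (0≤ι n))

  -- the quadratic remainder of (1 - x)ⁿ
  rem : ℚ[i] → ℕ → ℚ[i]
  rem x zero    = 0G
  rem x (suc n) = ιG n ⊕ rem x n ⊗ (1G ⊖ x)

  rem-eq : ∀ x n → (1G ⊖ x) ^G n ≡ 1G ⊖ ιG n ⊗ x ⊕ x ⊗ x ⊗ rem x n
  rem-eq x zero = eq x
    where
    eq : ∀ x → 1G ≡ 1G ⊖ 0G ⊗ x ⊕ x ⊗ x ⊗ 0G
    eq = solve-∀ G-ring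
  rem-eq x (suc n) = trans (cong ((1G ⊖ x) ⊗_) (rem-eq x n)) (eq x (ιG n) (rem x n))
    where
    eq : ∀ x n q → (1G ⊖ x) ⊗ (1G ⊖ n ⊗ x ⊕ x ⊗ x ⊗ q) ≡ 1G ⊖ (1G ⊕ n) ⊗ x ⊕ x ⊗ x ⊗ (n ⊕ q ⊗ (1G ⊖ x))
    eq = solve-∀ G-ring

  remBound : ℕ → ℚ
  remBound zero    = 0ℚ
  remBound (suc n) = ι n + remBound n * 2ℚ

  0≤2 : 0ℚ ≤ 2ℚ
  0≤2 = 0≤+ 0≤1 0≤1

  0≤remBound : ∀ n → 0ℚ ≤ remBound n
  0≤remBound zero    = ≤-refl
  0≤remBound (suc n) = 0≤+ (0≤ι n) (0≤* (0≤remBound n) 0≤2)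

  ∥1⊖∥ : ∀ x → ∥ x ∥ ≤ 1ℚ → ∥ 1G ⊖ x ∥ ≤ 2ℚ
  ∥1⊖∥ x p = ≤-trans (∥⊖∥ 1G x) (+-mono-≤ (≤-reflexive ∥1∥) p)

  rem-bound : ∀ x → ∥ x ∥ ≤ 1ℚ → ∀ n → ∥ rem x n ∥ ≤ remBound n
  rem-bound x p zero    = ≤-reflexive ∥0∥
  rem-bound x p (suc n) = ≤-trans (∥⊕∥ (ιG n) (rem x n ⊗ (1G ⊖ x)))
    (+-mono-≤ (≤-reflexive (∥ιG∥ n)) (≤-trans (∥⊗∥ (rem x n) (1G ⊖ x))
      (*-mono (0≤∥∥ (rem x n)) 0≤2 (rem-bound x p n) (∥1⊖∥ x p))))

  8ℚ : ℚ
  8ℚ = 2ℚ * (2ℚ * 2ℚ)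

  0≤8 : 0ℚ ≤ 8ℚ
  0≤8 = 0≤* 0≤2 (0≤* 0≤2 0≤2)

  1≤2 : 1ℚ ≤ 2ℚ
  1≤2 = ≤-by {1ℚ} {2ℚ} {1ℚ} 0≤1 refl

  8-dec : ∀ a b → 0ℚ ≤ b → 8ℚ * (a - b) ≤ 8ℚ * a
  8-dec a b p = *-monoˡ {a - b} {a} 8ℚ 0≤8 (≤-by {a - b} {a} p (eq a b))
    where
    eq : ∀ a b → a - (a - b) ≡ b
    eq = solve-∀ ℚ-ring

  -- The iteration w ↦ w (1 - (wᶜ - 1) / c).  It needs no division by w and agrees with
  -- Newton's iteration for zᶜ - 1 up to second order.
  module Newton (c : ℕ) {γ : ℚ} (0≤γ : 0ℚ ≤ γ) (γ≤1 : γ ≤ 1ℚ) (cγ : ι c * γ ≡ 1ℚ) where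
    K A : ℚ
    K = remBound c
    A = 1ℚ + 2ℚ * K

    err corr step : ℚ[i] → ℚ[i]
    err w  = w ^G c ⊖ 1G
    corr w = (γ +i 0ℚ) ⊗ err w
    step w = w ⊗ (1G ⊖ corr w)

    corr-bound : ∀ w → ∥ corr w ∥ ≤ ∥ err w ∥
    corr-bound w = ≤-trans (∥⊗∥ (γ +i 0ℚ) (err w)) (≤-trans
      (*-monoʳ (∥ err w ∥) (0≤∥∥ (err w)) (≤-trans (≤-reflexive (∥ι∥ γ 0≤γ)) γ≤1))
      (≤-reflexive (*-identityˡ (∥ err w ∥))))

    c-corr : ∀ w → ιG c ⊗ corr w ≡ err w
    c-corr w = trans (sym (⊗-assoc (ιG c) (γ +i 0ℚ) (err w)))
      (trans (cong (_⊗ err w) eq) (⊗-idˡ (err w)))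
      where
      eq₁ : ∀ a b → a * b - 0ℚ * 0ℚ ≡ a * b
      eq₁ = solve-∀ ℚ-ring
      eq₂ : ∀ a b → a * 0ℚ + 0ℚ * b ≡ 0ℚ
      eq₂ = solve-∀ ℚ-ring
      eq : ιG c ⊗ (γ +i 0ℚ) ≡ 1G
      eq = trans (cong (_⊗ (γ +i 0ℚ)) (ιG-ι c)) (cong₂ _+i_ (trans (eq₁ (ι c) γ) cγ) (eq₂ (ι c) γ))

    err-step : ∀ w → err (step w) ≡
      (corr w ⊗ corr w ⊗ rem (corr w) c) ⊗ (1G ⊕ err w) ⊖ err w ⊗ err w
    err-step w = trans (cong (_⊖ 1G) (trans (^G-distrib w (1G ⊖ corr w) c)
        (cong (w ^G c ⊗_) (trans (rem-eq (corr w) c) (cong (λ t → 1G ⊖ t ⊕ corr w ⊗ corr w ⊗ rem (corr w) c) (c-corr w))))))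
      (eq (w ^G c) (corr w ⊗ corr w ⊗ rem (corr w) c))
      where
      eq : ∀ u r → u ⊗ (1G ⊖ (u ⊖ 1G) ⊕ r) ⊖ 1G ≡ r ⊗ (1G ⊕ (u ⊖ 1G)) ⊖ (u ⊖ 1G) ⊗ (u ⊖ 1G)
      eq = solve-∀ G-ring

    -- quadratic convergence
    err-bound : ∀ w → ∥ err w ∥ ≤ 1ℚ → ∥ err (step w) ∥ ≤ ∥ err w ∥ * (∥ err w ∥ * A)
    err-bound w p = subst (λ t → ∥ t ∥ ≤ E * (E * A)) (sym (err-step w))
      (≤-trans (∥⊖∥ (x ⊗ x ⊗ r ⊗ (1G ⊕ e)) (e ⊗ e))
        (≤-trans (+-mono-≤ b₁ (∥⊗∥ e e)) (≤-reflexive (eq E K))))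
      where
      e = err w
      x = corr w
      r = rem x c
      E = ∥ e ∥
      eq : ∀ E K → E * E * K * (1ℚ + 1ℚ) + E * E ≡ E * (E * (1ℚ + (1ℚ + 1ℚ) * K))
      eq = solve-∀ ℚ-ring
      x≤ : ∥ x ∥ ≤ E
      x≤ = corr-bound w
      0≤E = 0≤∥∥ e
      b₁ : ∥ x ⊗ x ⊗ r ⊗ (1G ⊕ e) ∥ ≤ E * E * K * 2ℚ
      b₁ = ≤-trans (∥⊗∥ (x ⊗ x ⊗ r) (1G ⊕ e)) (*-mono (0≤∥∥ (x ⊗ x ⊗ r)) 0≤2
        (≤-trans (∥⊗∥ (x ⊗ x) r) (*-mono (0≤∥∥ (x ⊗ x)) (0≤remBound c)
          (≤-trans (∥⊗∥ x x) (*-mono (0≤∥∥ x) 0≤E x≤ x≤)) (rem-bound x (≤-trans x≤ p) c)))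
        (≤-trans (∥⊕∥ 1G e) (+-mono-≤ (≤-reflexive ∥1∥) p)))

    module Iterate (w₀ : ℚ[i]) (d₀ : ℚ) (0<d : 0ℚ < d₀) (dA : d₀ * A ≤ ½) (8d≤1 : 8ℚ * d₀ ≤ 1ℚ)
      (w₀≤2 : ∥ w₀ ∥ ≤ 2ℚ) (e≤d : ∥ err w₀ ∥ ≤ d₀) where

      w : ℕ → ℚ[i]
      w zero    = w₀
      w (suc n) = step (w n)

      d : ℕ → ℚ
      d zero    = d₀
      d (suc n) = ½ * d n

      0<d_ : ∀ n → 0ℚ < d n
      0<d_ zero    = 0<d
      0<d_ (suc n) = 0<half (0<d_ n)

      d≤d₀ : ∀ n → d n ≤ d₀
      d≤d₀ zero    = ≤-refl
      d≤d₀ (suc n) = ≤-trans (<⇒≤ (half< (0<d_ n))) (d≤d₀ n)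

      0≤A : 0ℚ ≤ A
      0≤A = 0≤+ 0≤1 (0≤* 0≤2 (0≤remBound c))

      d≤1 : ∀ n → d n ≤ 1ℚ
      d≤1 n = ≤-trans (d≤d₀ n) (≤-trans (≤-by (0≤* (0≤+ 0≤2 (0≤+ 0≤2 (0≤+ 0≤2 0≤1))) (<⇒≤ 0<d)) (eq d₀)) 8d≤1)
        where
        eq : ∀ d → (1ℚ + 1ℚ) * ((1ℚ + 1ℚ) * (1ℚ + 1ℚ)) * d - d ≡ ((1ℚ + 1ℚ) + ((1ℚ + 1ℚ) + ((1ℚ + 1ℚ) + 1ℚ))) * d
        eq = solve-∀ ℚ-ring

      err≤ : ∀ n → ∥ err (w n) ∥ ≤ d n
      err≤ zero    = e≤d
      err≤ (suc n) = ≤-trans (err-bound (w n) (≤-trans (err≤ n) (d≤1 n)))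
        (≤-trans (*-mono (0≤∥∥ (err (w n))) (<⇒≤ 0<½) (err≤ n)
          (≤-trans (*-monoʳ A 0≤A (≤-trans (err≤ n) (d≤d₀ n))) dA)) (≤-reflexive (*-comm (d n) ½)))

      moved : ∀ a D n → ∥ w n ∥ ≤ 2ℚ + 2ℚ → ∥ w n ⊖ a ∥ ≤ 8ℚ * (D - d n) → ∥ w (suc n) ⊖ a ∥ ≤ 8ℚ * (D - d (suc n))
      moved a D n p q = ≤-trans (∥△∥ (w (suc n)) (w n) a) (≤-trans (+-mono-≤ mv q) (≤-reflexive (eq₂ (d n) D)))
        where
        eq₁ : ∀ w x → w ⊗ (1G ⊖ x) ⊖ w ≡ ⊝ (w ⊗ x)
        eq₁ = solve-∀ G-ring
        eq₂ : ∀ d D → (1ℚ + 1ℚ + (1ℚ + 1ℚ)) * d + (1ℚ + 1ℚ) * ((1ℚ + 1ℚ) * (1ℚ + 1ℚ)) * (D - d)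
            ≡ (1ℚ + 1ℚ) * ((1ℚ + 1ℚ) * (1ℚ + 1ℚ)) * (D - ½ * d)
        eq₂ = solve-∀ ℚ-ring
        mv : ∥ w (suc n) ⊖ w n ∥ ≤ (2ℚ + 2ℚ) * d n
        mv = ≤-trans (≤-reflexive (trans (cong ∥_∥ (eq₁ (w n) (corr (w n)))) (∥⊝∥ (w n ⊗ corr (w n)))))
          (≤-trans (∥⊗∥ (w n) (corr (w n))) (*-mono (0≤∥∥ (w n)) (<⇒≤ (0<d_ n)) p
            (≤-trans (corr-bound (w n)) (err≤ n))))

      near′ : ∀ n → ∥ w n ⊖ w₀ ∥ ≤ 8ℚ * (d₀ - d n)
      w≤4 : ∀ n → ∥ w n ∥ ≤ 2ℚ + 2ℚ
      near′ zero    = ≤-reflexive (trans (cong ∥_∥ (⊕-invʳ w₀)) (trans ∥0∥ (eq d₀)))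
        where
        eq : ∀ d → 0ℚ ≡ (1ℚ + 1ℚ) * ((1ℚ + 1ℚ) * (1ℚ + 1ℚ)) * (d - d)
        eq = solve-∀ ℚ-ring
      near′ (suc n) = moved w₀ d₀ n (w≤4 n) (near′ n)
      w≤4 n = ≤-trans (≤-reflexive (cong ∥_∥ (eq w₀ (w n)))) (≤-trans (∥⊕∥ w₀ (w n ⊖ w₀))
        (+-mono-≤ w₀≤2 (≤-trans (near′ n) (≤-trans (8-dec d₀ (d n) (<⇒≤ (0<d_ n))) (≤-trans 8d≤1 1≤2)))))
        where
        eq : ∀ a b → b ≡ a ⊕ (b ⊖ a)
        eq = solve-∀ G-ring

      near : ∀ n → ∥ w n ⊖ w₀ ∥ ≤ 8ℚ * d₀
      near n = ≤-trans (near′ n) (8-dec d₀ (d n) (<⇒≤ (0<d_ n)))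

      d-decay : ∀ n → d n * ι (suc n) ≤ d₀
      d-decay zero    = ≤-reflexive (*-identityʳ d₀)
      d-decay (suc n) = ≤-trans (≤-by (0≤* (<⇒≤ (0<half (0<d_ n))) (0≤ι n)) (eq (d n) (ι n))) (d-decay n)
        where
        eq : ∀ d m → d * (1ℚ + m) - ½ * d * (1ℚ + (1ℚ + m)) ≡ ½ * d * m
        eq = solve-∀ ℚ-ring

      step≤ : ∀ n k → ∥ w (k ℕ.+ n) ⊖ w n ∥ ≤ 8ℚ * (d n - d (k ℕ.+ n))
      step≤ n zero = ≤-reflexive (trans (cong ∥_∥ (⊕-invʳ (w n))) (trans ∥0∥ (eq (d n))))
        where
        eq : ∀ d → 0ℚ ≡ (1ℚ + 1ℚ) * ((1ℚ + 1ℚ) * (1ℚ + 1ℚ)) * (d - d)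
        eq = solve-∀ ℚ-ring
      step≤ n (suc k) = moved (w n) (d n) (k ℕ.+ n) (w≤4 (k ℕ.+ n)) (step≤ n k)

      tail≤ : ∀ n m → n ℕ.≤ m → ∥ w m ⊖ w n ∥ ≤ 8ℚ * d n
      tail≤ n m n≤m = subst (λ t → ∥ w t ⊖ w n ∥ ≤ 8ℚ * d n) (ℕₚ.m∸n+n≡m n≤m)
        (≤-trans (step≤ n k) (8-dec (d n) (d (k ℕ.+ n)) (<⇒≤ (0<d_ (k ℕ.+ n)))))
        where
        k = m ℕ.∸ n

      d-small : ∀ ε → 0ℚ < ε → ∃ λ N → ∀ n → N ℕ.≤ n → (8ℚ + 8ℚ) * d n ≤ ε
      d-small ε 0<ε =
        let N , p = arch⁻¹ 0<ε ((8ℚ + 8ℚ) * d₀)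
        in N , λ n N≤n → *-cancelʳ-≤-pos (ι (suc n)) {{positive (0<ι n)}}
          (≤-trans (≤-reflexive (*-assoc (8ℚ + 8ℚ) (d n) (ι (suc n)))) (≤-trans (*-monoˡ (8ℚ + 8ℚ) (0≤+ 0≤8 0≤8) (d-decay n))
            (≤-trans p (*-monoˡ ε (<⇒≤ 0<ε) (ι-mono (ℕₚ.m≤n⇒m≤1+n N≤n))))))

      abstract
        w-cauchy : Cauchy w
        w-cauchy ε 0<ε =
          let N , p = d-small ε 0<ε
          in N , λ m n a b → ≤-trans (∥△∥ (w m) (w N) (w n))
            (≤-trans (+-mono-≤ (tail≤ N m a) (≤-trans (≤-reflexive (∥x-y∥-sym (w N) (w n))) (tail≤ N n b)))
              (≤-trans (≤-reflexive (sym (*-distribʳ-+ (d N) 8ℚ 8ℚ))) (p N ℕₚ.≤-refl)))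

      root : ℂ
      root = mkℂ w w-cauchy

      root-close : ∀ ε → 0ℚ < ε → Eventually (λ n → ∥ w n ^G c ⊖ 1G ∥ ≤ ε)
      root-close ε 0<ε =
        let N , p = d-small ε 0<ε
        in N , λ n a → ≤-trans (err≤ n) (≤-trans (≤-by (0≤* (0≤+ 0≤8 0≤7) (<⇒≤ (0<d_ n))) (eq (d n))) (p n a))
        where
        0≤7 : 0ℚ ≤ 2ℚ + (2ℚ + (2ℚ + 1ℚ))
        0≤7 = 0≤+ 0≤2 (0≤+ 0≤2 (0≤+ 0≤2 0≤1))
        eq : ∀ d → ((1ℚ + 1ℚ) * ((1ℚ + 1ℚ) * (1ℚ + 1ℚ)) + (1ℚ + 1ℚ) * ((1ℚ + 1ℚ) * (1ℚ + 1ℚ))) * d - d ≡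
             ((1ℚ + 1ℚ) * ((1ℚ + 1ℚ) * (1ℚ + 1ℚ)) + ((1ℚ + 1ℚ) + ((1ℚ + 1ℚ) + ((1ℚ + 1ℚ) + 1ℚ)))) * d
        eq = solve-∀ ℚ-ring

module CircleRotation where
  open RationalLemmas
  open GaussianRationals
  open ComplexNumbers
  open NewtonIteration
  open import Data.Rational using (ℚ; 0ℚ; 1ℚ; ½; positive; _+_; _*_; -_; _-_; _≤_; _<_; ∣_∣)
  open import Data.Rational.Properties
  open import Data.Nat as ℕ using (ℕ; zero; suc)
  import Data.Nat.Properties as ℕₚ
  import Data.Nat.DivMod as ℕ
  open import Data.Product
  open import Data.Sum using (_⊎_; inj₁; inj₂)
  open import Relation.Binary.PropositionalEquality
  open import Relation.Nullary
  open import Tactic.RingSolver using (solve-∀)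

  ^G-+ : ∀ z m n → z ^G (m ℕ.+ n) ≡ z ^G m ⊗ z ^G n
  ^G-+ z zero    n = sym (⊗-idˡ (z ^G n))
  ^G-+ z (suc m) n = trans (cong (z ⊗_) (^G-+ z m n)) (sym (⊗-assoc z (z ^G m) (z ^G n)))

  ^G-* : ∀ z m n → z ^G (m ℕ.* n) ≡ (z ^G n) ^G m
  ^G-* z zero    n = refl
  ^G-* z (suc m) n = trans (^G-+ z n (m ℕ.* n)) (cong (z ^G n ⊗_) (^G-* z m n))

  iG : ℚ[i]
  iG = 0ℚ +i 1ℚ

  ∥i∥ : ∥ iG ∥ ≡ 1ℚ
  ∥i∥ = refl

  ∣⊗∣² : ∀ z w → ∣ z ⊗ w ∣² ≡ ∣ z ∣² * ∣ w ∣²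
  ∣⊗∣² (a +i b) (c +i d) = eq a b c d
    where
    eq : ∀ a b c d → (a * c - b * d) * (a * c - b * d) + (a * d + b * c) * (a * d + b * c) ≡ (a * a + b * b) * (c * c + d * d)
    eq = solve-∀ ℚ-ring

  Unit : ℚ[i] → Set
  Unit z = ∣ z ∣² ≡ 1ℚ

  Unit-⊗ : ∀ {z w} → Unit z → Unit w → Unit (z ⊗ w)
  Unit-⊗ {z} {w} p q = trans (∣⊗∣² z w) (trans (cong₂ _*_ p q) (*-identityˡ 1ℚ))

  Unit-^ : ∀ {z} → Unit z → ∀ n → Unit (z ^G n)
  Unit-^ p zero    = refl
  Unit-^ {z} p (suc n) = Unit-⊗ {z} {z ^G n} p (Unit-^ p n)

  sq≤1 : ∀ a → a * a ≤ 1ℚ → a ≤ 1ℚ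
  sq≤1 a p = go (≤-total a 1ℚ)
    where
    go : (a ≤ 1ℚ) ⊎ (1ℚ ≤ a) → a ≤ 1ℚ
    go (inj₁ q) = q
    go (inj₂ q) = ≤-trans (subst (_≤ a * a) (*-identityˡ a) (*-monoʳ a (≤-trans 0≤1 q) q)) p

  unit-sq : ∀ x y → x * x + y * y ≡ 1ℚ → x * x ≤ 1ℚ
  unit-sq x y e = ≤-by {x * x} {1ℚ} (0≤sq y) (trans (cong (_- x * x) (sym e)) (eq x y))
    where
    eq : ∀ x y → x * x + y * y - x * x ≡ y * y
    eq = solve-∀ ℚ-ring

  Unit-re : ∀ z → Unit z → ∣ re z ∣ ≤ 1ℚ
  Unit-re (x +i y) e = sq≤1 (∣ x ∣) (≤-trans (≤-reflexive (∣∣² x)) (unit-sq x y e))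

  Unit-im : ∀ z → Unit z → ∣ im z ∣ ≤ 1ℚ
  Unit-im (x +i y) e = sq≤1 (∣ y ∣) (≤-trans (≤-reflexive (∣∣² y)) (unit-sq y x (trans (+-comm (y * y) (x * x)) e)))

  Unit-norm : ∀ z → Unit z → ∥ z ∥ ≤ 2ℚ
  Unit-norm z e = +-mono-≤ (Unit-re z e) (Unit-im z e)

  ≤-ball : ∀ {a b e} → ∣ a - b ∣ ≤ e → a ≤ b + e
  ≤-ball {a} {b} {e} p = ≤-by (0≤- (≤-trans (a≤∣a∣ (a - b)) p)) (eq a b e)
    where
    eq : ∀ a b e → b + e - a ≡ e - (a - b)
    eq = solve-∀ ℚ-ring

  ≥-ball : ∀ {a b e} → ∣ a - b ∣ ≤ e → b - e ≤ a
  ≥-ball {a} {b} {e} p = ≤-by (0≤- (≤-trans (-a≤∣a∣ (a - b)) p)) (eq a b e)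
    where
    eq : ∀ a b e → a - (b - e) ≡ e - - (a - b)
    eq = solve-∀ ℚ-ring

  module Rotation (C S : ℚ) (0<C : 0ℚ < C) (C≤1 : C ≤ 1ℚ) (0<S : 0ℚ < S) (1-C≤S : 1ℚ - C ≤ S)
    (CS : C * C + S * S ≡ 1ℚ) where

    0≤C = <⇒≤ 0<C
    0≤S = <⇒≤ 0<S

    v : ℚ[i]
    v = C +i S

    V : ℕ → ℚ[i]
    V = v ^G_

    V-unit : ∀ k → Unit (V k)
    V-unit = Unit-^ {v} CS

    θ : ℚ
    θ = S + S

    0≤θ : 0ℚ ≤ θ
    0≤θ = 0≤+ 0≤S 0≤S

    v-1 : ∥ v ⊖ 1G ∥ ≤ θ
    v-1 = +-mono-≤ (∣∣≤ (≤-trans (≤-by {C - 1ℚ} {0ℚ} (0≤- C≤1) (eq C)) 0≤S) (≤-trans (≤-reflexive (eq₁ C)) 1-C≤S))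
       (∣∣≤ (≤-reflexive (+-identityʳ S)) (≤-by (0≤+ 0≤S 0≤S) (eq₂ S)))
      where
      eq : ∀ C → 0ℚ - (C - 1ℚ) ≡ 1ℚ - C
      eq = solve-∀ ℚ-ring
      eq₁ : ∀ C → - (C - 1ℚ) ≡ 1ℚ - C
      eq₁ = solve-∀ ℚ-ring
      eq₂ : ∀ S → S - - (S + 0ℚ) ≡ S + S
      eq₂ = solve-∀ ℚ-ring

    -- k further steps move a point by at most 2kθ
    drift : ∀ k m → ∥ V (k ℕ.+ m) ⊖ V m ∥ ≤ ι k * (θ * 2ℚ)
    drift zero m = ≤-reflexive (trans (cong ∥_∥ (⊕-invʳ (V m))) (trans ∥0∥ (sym (*-zeroˡ (θ * 2ℚ)))))
    drift (suc k) m = ≤-trans (∥△∥ (v ⊗ V (k ℕ.+ m)) (V (k ℕ.+ m)) (V m))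
      (≤-trans (+-mono-≤ one (drift k m)) (≤-reflexive (eq₁ (ι k) (θ * 2ℚ))))
      where
      z = V (k ℕ.+ m)
      eq : ∀ v z → v ⊗ z ⊖ z ≡ (v ⊖ 1G) ⊗ z
      eq = solve-∀ G-ring
      eq₁ : ∀ k t → t + k * t ≡ (1ℚ + k) * t
      eq₁ = solve-∀ ℚ-ring
      one : ∥ v ⊗ z ⊖ z ∥ ≤ θ * 2ℚ
      one = ≤-trans (≤-reflexive (cong ∥_∥ (eq v z))) (≤-trans (∥⊗∥ (v ⊖ 1G) z)
        (*-mono (0≤∥∥ (v ⊖ 1G)) 0≤2 v-1 (Unit-norm z (V-unit (k ℕ.+ m)))))

    Good : ℕ → Set
    Good k = (- θ ≤ re (V k)) × (0ℚ ≤ im (V k))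

    record Quarter : Set where
      field
        Q     : ℕ
        good  : ∀ k → k ℕ.≤ Q → Good k
        there : re (V Q) ≤ 0ℚ

    good0 : Good 0
    good0 = ≤-trans (neg-antimono-≤ 0≤θ) 0≤1 , ≤-refl

    extend : ∀ k → (∀ j → j ℕ.≤ k → Good j) → Good (suc k) → ∀ j → j ℕ.≤ suc k → Good j
    extend k g h j j≤ = go (ℕₚ.m≤n⇒m<n∨m≡n j≤)
      where
      go : (j ℕ.< suc k) ⊎ (j ≡ suc k) → Good j
      go (inj₁ p)    = g j (ℕₚ.≤-pred p)
      go (inj₂ refl) = h

    walk : ∀ fuel k → (∀ j → j ℕ.≤ k → Good j) → 0ℚ < re (V k) → S ≤ im (V k) →
      re (V k) ≤ S * S * ι fuel → Quarter
    walk zero k g 0<x _ x≤ = contradiction (<-≤-trans 0<x (≤-trans x≤ (≤-reflexive (*-zeroʳ (S * S))))) (<-irrefl refl)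
    walk (suc f) k g 0<x S≤y x≤ = go (≤-total x′ 0ℚ) (x′ Data.Rational.≟ 0ℚ)
      where
      import Data.Rational
      x = re (V k)
      y = im (V k)
      x′ = C * x - S * y
      y′ = C * y + S * x
      0≤x = <⇒≤ 0<x
      0≤y = ≤-trans 0≤S S≤y
      0≤y′ : 0ℚ ≤ y′
      0≤y′ = 0≤+ (0≤* 0≤C 0≤y) (0≤* 0≤S 0≤x)
      y≤1 : y ≤ 1ℚ
      y≤1 = ≤-trans (a≤∣a∣ y) (Unit-im (V k) (V-unit k))
      eq₁ : ∀ C S x y → C * x - S * y - - (S + S) ≡ C * x + (S * (1ℚ - y) + S)
      eq₁ = solve-∀ ℚ-ring
      good′ : Good (suc k)
      good′ = ≤-by (0≤+ (0≤* 0≤C 0≤x) (0≤+ (0≤* 0≤S (0≤- y≤1)) 0≤S)) (eq₁ C S x y) , 0≤y′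
      g′ : ∀ j → j ℕ.≤ suc k → Good j
      g′ = extend k g good′
      x′≤ : x′ ≤ S * S * ι f
      x′≤ = ≤-by (0≤+ (0≤- x≤) (0≤+ (0≤* (0≤- C≤1) 0≤x) (0≤* 0≤S (0≤- S≤y)))) (eq C S x y (ι f))
        where
        eq : ∀ C S x y f → S * S * f - (C * x - S * y) ≡ (S * S * (1ℚ + f) - x) + ((1ℚ - C) * x + S * (y - S))
        eq = solve-∀ ℚ-ring
      S≤y′ : 0ℚ ≤ x′ → S ≤ y′
      S≤y′ 0≤x′ = ≤-trans S≤y (≤-by (0≤+ (0≤* (0≤- C≤1) 0≤y′) (0≤* 0≤S 0≤x′))
          (trans (cong (λ t → y′ - t) (trans (sym (*-identityˡ y)) (cong (_* y) (sym CS)))) (eq C S x y)))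
        where
        eq : ∀ C S x y → (C * y + S * x) - (C * C + S * S) * y ≡ (1ℚ - C) * (C * y + S * x) + S * (C * x - S * y)
        eq = solve-∀ ℚ-ring
      go : (x′ ≤ 0ℚ) ⊎ (0ℚ ≤ x′) → Dec (x′ ≡ 0ℚ) → Quarter
      go (inj₁ p) _ = record { Q = suc k ; good = g′ ; there = p }
      go (inj₂ p) (yes e) = record { Q = suc k ; good = g′ ; there = ≤-reflexive e }
      go (inj₂ p) (no ne) = walk f (suc k) g′ (≰⇒> (λ q → ne (≤-antisym q p))) (S≤y′ p) x′≤

    re-v1 : ∀ C S → C * 1ℚ - S * 0ℚ ≡ C
    re-v1 = solve-∀ ℚ-ring
    im-v1 : ∀ C S → C * 0ℚ + S * 1ℚ ≡ S
    im-v1 = solve-∀ ℚ-ring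

    quarter : Quarter
    quarter =
      let n , p = arch⁻¹ (0<* 0<S 0<S) C
      in walk n 1 (extend 0 (λ { .0 ℕ.z≤n → good0 }) good1)
           (<-≤-trans 0<C (≤-reflexive (sym (re-v1 C S))))
           (≤-reflexive (sym (im-v1 C S)))
           (≤-trans (≤-reflexive (re-v1 C S)) p)
      where
      good1 : Good 1
      good1 = ≤-trans (≤-trans (neg-antimono-≤ 0≤θ) 0≤C) (≤-reflexive (sym (re-v1 C S)))
            , ≤-trans 0≤S (≤-reflexive (sym (im-v1 C S)))

    open Quarter quarter

    near-i : ∥ V Q ⊖ iG ∥ ≤ θ + θ
    near-i = +-mono-≤ x-near y-near
      where
      x = re (V Q)
      y = im (V Q)
      -x≤θ : - x ≤ θ
      -x≤θ = subst (- x ≤_) (eq θ) (neg-antimono-≤ (proj₁ (good Q ℕₚ.≤-refl)))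
        where
        eq : ∀ a → - - a ≡ a
        eq = solve-∀ ℚ-ring
      x-near : ∣ x - 0ℚ ∣ ≤ θ
      x-near = ∣∣≤ (≤-trans (≤-reflexive (eq x)) (≤-trans there 0≤θ)) (≤-trans (≤-reflexive (eq₁ x)) -x≤θ)
        where
        eq : ∀ x → x - 0ℚ ≡ x
        eq = solve-∀ ℚ-ring
        eq₁ : ∀ x → - (x - 0ℚ) ≡ - x
        eq₁ = solve-∀ ℚ-ring
      0≤y = proj₂ (good Q ℕₚ.≤-refl)
      y≤1 : y ≤ 1ℚ
      y≤1 = ≤-trans (a≤∣a∣ y) (Unit-im (V Q) (V-unit Q))
      -x≤1 : - x ≤ 1ℚ
      -x≤1 = ≤-trans (-a≤∣a∣ x) (Unit-re (V Q) (V-unit Q))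
      xy : 1ℚ - y * y ≡ x * x
      xy = trans (cong (_- y * y) (sym (V-unit Q))) (eq (x * x) (y * y))
        where
        eq : ∀ a b → a + b - b ≡ a
        eq = solve-∀ ℚ-ring
      1-y : 1ℚ - y ≤ - x
      1-y = ≤-by (0≤+ (0≤* 0≤y (0≤- y≤1)) (0≤* (0≤neg there) (0≤- -x≤1)))
        (trans (eq₀ (- x - (1ℚ - y)) (x * x)) (trans (cong (λ t → - x - (1ℚ - y) + (t - x * x)) (sym xy)) (eq x y)))
        where
        eq₀ : ∀ a b → a ≡ a + (b - b)
        eq₀ = solve-∀ ℚ-ring
        eq : ∀ x y → - x - (1ℚ - y) + (1ℚ - y * y - x * x) ≡ y * (1ℚ - y) + - x * (1ℚ - - x)
        eq = solve-∀ ℚ-ring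
      y-near : ∣ y - 1ℚ ∣ ≤ θ
      y-near = ∣∣≤ (≤-trans (≤-by {y - 1ℚ} {0ℚ} (0≤- y≤1) (eq y)) 0≤θ) (≤-trans (≤-reflexive (eq₁ y)) (≤-trans 1-y -x≤θ))
        where
        eq : ∀ y → 0ℚ - (y - 1ℚ) ≡ 1ℚ - y
        eq = solve-∀ ℚ-ring
        eq₁ : ∀ y → - (y - 1ℚ) ≡ 1ℚ - y
        eq₁ = solve-∀ ℚ-ring

    module Start (c : ℕ) .{{_ : ℕ.NonZero c}} where
      p L t : ℕ
      p = suc (Q ℕ./ c)
      L = c ℕ.* p
      t = L ℕ.∸ Q

      L-eq : L ≡ c ℕ.+ (Q ℕ./ c) ℕ.* c
      L-eq = ℕₚ.*-comm c p

      Q≤L : Q ℕ.≤ L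
      Q≤L = ℕₚ.≤-trans (ℕₚ.≤-reflexive (ℕ.m≡m%n+[m/n]*n Q c)) (ℕₚ.≤-trans
        (ℕₚ.+-monoˡ-≤ ((Q ℕ./ c) ℕ.* c) (ℕₚ.<⇒≤ (ℕ.m%n<n Q c))) (ℕₚ.≤-reflexive (sym L-eq)))

      L≤ : L ℕ.≤ c ℕ.+ Q
      L≤ = ℕₚ.≤-trans (ℕₚ.≤-reflexive L-eq) (ℕₚ.+-monoʳ-≤ c (ℕ.m/n*n≤m Q c))

      β : ℚ
      β = (2ℚ + 2ℚ * ι c) * θ

      over : ∀ j → j ℕ.≤ c → ∥ V (j ℕ.+ Q) ⊖ V Q ∥ ≤ ι c * (θ * 2ℚ)
      over j j≤c = ≤-trans (drift j Q) (*-monoʳ (θ * 2ℚ) (0≤* 0≤θ 0≤2) (ι-mono j≤c))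

      t≤c : t ℕ.≤ c
      t≤c = ℕₚ.m≤n+o⇒m∸n≤o L Q (ℕₚ.≤-trans L≤ (ℕₚ.≤-reflexive (ℕₚ.+-comm c Q)))

      near-L : ∥ V L ⊖ iG ∥ ≤ β
      near-L = ≤-trans (∥△∥ (V L) (V Q) iG) (≤-trans
        (+-mono-≤ (subst (λ n → ∥ V n ⊖ V Q ∥ ≤ ι c * (θ * 2ℚ)) (ℕₚ.m∸n+n≡m Q≤L) (over t t≤c)) near-i)
        (≤-reflexive (eq (ι c) θ)))
        where
        eq : ∀ c h → c * (h * (1ℚ + 1ℚ)) + (h + h) ≡ (1ℚ + 1ℚ + (1ℚ + 1ℚ) * c) * h
        eq = solve-∀ ℚ-ring

      0≤cθ : 0ℚ ≤ ι c * θ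
      0≤cθ = 0≤* (0≤ι c) 0≤θ

      first-quarter : ∀ k → k ℕ.≤ L → (- β ≤ re (V k)) × (- β ≤ im (V k))
      first-quarter k k≤L = go (ℕₚ.≤-total k Q)
        where
        go : (k ℕ.≤ Q) ⊎ (Q ℕ.≤ k) → (- β ≤ re (V k)) × (- β ≤ im (V k))
        go (inj₁ k≤Q) = ≤-trans (≤-by (0≤+ 0≤θ (0≤+ 0≤cθ 0≤cθ)) (eq (ι c) θ)) (proj₁ (good k k≤Q))
                      , ≤-trans (≤-by (0≤+ (0≤+ 0≤θ 0≤θ) (0≤+ 0≤cθ 0≤cθ)) (eq′ (ι c) θ)) (proj₂ (good k k≤Q))
          where
          eq : ∀ c h → - h - - ((1ℚ + 1ℚ + (1ℚ + 1ℚ) * c) * h) ≡ h + (c * h + c * h)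
          eq = solve-∀ ℚ-ring
          eq′ : ∀ c h → 0ℚ - - ((1ℚ + 1ℚ + (1ℚ + 1ℚ) * c) * h) ≡ h + h + (c * h + c * h)
          eq′ = solve-∀ ℚ-ring
        go (inj₂ Q≤k) = subst (λ n → (- β ≤ re (V n)) × (- β ≤ im (V n))) (ℕₚ.m∸n+n≡m Q≤k)
            ( ≤-trans (≤-by (0≤+ (0≤- (proj₁ gQ)) 0≤θ) (eq (re (V Q)) (ι c) θ)) (≥-ball {re (V (j ℕ.+ Q))} {re (V Q)} (≤-trans (∥re∥ (V (j ℕ.+ Q) ⊖ V Q)) ov))
            , ≤-trans (≤-by (0≤+ (proj₂ gQ) (0≤+ 0≤θ 0≤θ)) (eq′ (im (V Q)) (ι c) θ)) (≥-ball {im (V (j ℕ.+ Q))} {im (V Q)} (≤-trans (∥im∥ (V (j ℕ.+ Q) ⊖ V Q)) ov)))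
          where
          j = k ℕ.∸ Q
          gQ = good Q ℕₚ.≤-refl
          ov = over j (ℕₚ.≤-trans (ℕₚ.∸-monoˡ-≤ Q k≤L) t≤c)
          eq : ∀ x c h → x - c * (h * (1ℚ + 1ℚ)) - - ((1ℚ + 1ℚ + (1ℚ + 1ℚ) * c) * h) ≡ x - - h + h
          eq = solve-∀ ℚ-ring
          eq′ : ∀ x c h → x - c * (h * (1ℚ + 1ℚ)) - - ((1ℚ + 1ℚ + (1ℚ + 1ℚ) * c) * h) ≡ x + (h + h)
          eq′ = solve-∀ ℚ-ring

      u : ℚ[i]
      u = V L

      0≤β : 0ℚ ≤ β
      0≤β = 0≤* (0≤+ 0≤2 (0≤* 0≤2 (0≤ι c))) 0≤θ

      -- multiplication by u is nearly a quarter turn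
      turn : ∀ z → Unit z → ∥ u ⊗ z ⊖ iG ⊗ z ∥ ≤ β + β
      turn z e = ≤-trans (≤-reflexive (cong ∥_∥ (eq u iG z))) (≤-trans (∥⊗∥ (u ⊖ iG) z)
        (≤-trans (*-mono (0≤∥∥ (u ⊖ iG)) 0≤2 near-L (Unit-norm z e)) (≤-reflexive (eq′ β))))
        where
        eq : ∀ u i z → u ⊗ z ⊖ i ⊗ z ≡ (u ⊖ i) ⊗ z
        eq = solve-∀ G-ring
        eq′ : ∀ b → b * (1ℚ + 1ℚ) ≡ b + b
        eq′ = solve-∀ ℚ-ring

      turn-re : ∀ z → Unit z → re (u ⊗ z) ≤ - im z + (β + β)
      turn-re z e = ≤-ball {re (u ⊗ z)} { - im z} (subst (λ s → ∣ re (u ⊗ z) - s ∣ ≤ β + β) (eq (re z) (im z))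
          (≤-trans (∥re∥ (u ⊗ z ⊖ iG ⊗ z)) (turn z e)))
        where
        eq : ∀ x y → 0ℚ * x - 1ℚ * y ≡ - y
        eq = solve-∀ ℚ-ring

      turn-im : ∀ z → Unit z → re z - (β + β) ≤ im (u ⊗ z)
      turn-im z e = ≥-ball {im (u ⊗ z)} {re z} (subst (λ s → ∣ im (u ⊗ z) - s ∣ ≤ β + β) (eq (re z) (im z))
          (≤-trans (∥im∥ (u ⊗ z ⊖ iG ⊗ z)) (turn z e)))
        where
        eq : ∀ x y → 0ℚ * y + 1ℚ * x ≡ x
        eq = solve-∀ ℚ-ring

      second-quarter : ∀ k → k ℕ.≤ L ℕ.+ L → - (β + β + β) ≤ im (V k)
      second-quarter k k≤ = go (ℕₚ.≤-total k L)
        where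
        go : (k ℕ.≤ L) ⊎ (L ℕ.≤ k) → - (β + β + β) ≤ im (V k)
        go (inj₁ q) = ≤-trans (≤-by (0≤+ 0≤β 0≤β) (eq β)) (proj₂ (first-quarter k q))
          where
          eq : ∀ b → - b - - (b + b + b) ≡ b + b
          eq = solve-∀ ℚ-ring
        go (inj₂ q) = subst (λ n → - (β + β + β) ≤ im n) (trans (sym (^G-+ v L j)) (cong V (ℕₚ.m+[n∸m]≡n q)))
            (≤-trans (≤-by (0≤- (proj₁ (first-quarter j j≤))) (eq (re (V j)) β)) (turn-im (V j) (V-unit j)))
          where
          j = k ℕ.∸ L
          j≤ : j ℕ.≤ L
          j≤ = ℕₚ.m≤n+o⇒m∸n≤o k L k≤
          eq : ∀ x b → x - (b + b) - - (b + b + b) ≡ x - - b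
          eq = solve-∀ ℚ-ring

      5β 9β : ℚ
      5β = β + β + (β + β + β)
      9β = 5β + (β + β + (β + β))

      left-half : ∀ k → L ℕ.≤ k → k ℕ.≤ L ℕ.+ (L ℕ.+ L) → re (V k) ≤ 5β
      left-half k L≤k k≤ = subst (λ n → re n ≤ 5β) (trans (sym (^G-+ v L j)) (cong V (ℕₚ.m+[n∸m]≡n L≤k)))
          (≤-trans (turn-re (V j) (V-unit j)) (≤-by (0≤- (second-quarter j (ℕₚ.m≤n+o⇒m∸n≤o k L k≤))) (eq (im (V j)) β)))
        where
        j = k ℕ.∸ L
        eq : ∀ y b → b + b + (b + b + b) - (- y + (b + b)) ≡ y - - (b + b + b)
        eq = solve-∀ ℚ-ring

      w₀ : ℚ[i]
      w₀ = V (4 ℕ.* p)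

      w₀-norm : ∥ w₀ ∥ ≤ 2ℚ
      w₀-norm = Unit-norm w₀ (V-unit (4 ℕ.* p))

      w₀^ : ∀ r → w₀ ^G r ≡ V (r ℕ.* (4 ℕ.* p))
      w₀^ r = sym (^G-* v r (4 ℕ.* p))

      w₀-root : ∥ w₀ ^G c ⊖ 1G ∥ ≤ 9β
      w₀-root = ≤-trans (≤-reflexive (cong (λ s → ∥ s ⊖ 1G ∥) four)) (≤-trans fourth (≤-reflexive (eq β)))
        where
        eq : ∀ b → (b * (1ℚ + 1ℚ) + b) * (1ℚ + 1ℚ) + (b * (1ℚ + 1ℚ) + b) ≡ b + b + (b + b + b) + (b + b + (b + b))
        eq = solve-∀ ℚ-ring
        c4p : c ℕ.* (4 ℕ.* p) ≡ 4 ℕ.* L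
        c4p = trans (sym (ℕₚ.*-assoc c 4 p)) (trans (cong (ℕ._* p) (ℕₚ.*-comm c 4)) (ℕₚ.*-assoc 4 c p))
        sq : ∀ u → u ⊗ (u ⊗ (u ⊗ (u ⊗ 1G))) ≡ (u ⊗ u) ⊗ (u ⊗ u)
        sq = solve-∀ G-ring
        four : w₀ ^G c ≡ (u ⊗ u) ⊗ (u ⊗ u)
        four = trans (w₀^ c) (trans (cong V c4p) (trans (^G-* v 4 L) (sq u)))
        uU : ∥ u ∥ ≤ 2ℚ
        uU = Unit-norm u (V-unit L)
        second : ∥ u ⊗ u ⊖ iG ⊗ iG ∥ ≤ β * 2ℚ + β
        second = ≤-trans (⊗-diff u u iG iG) (+-mono-≤ (*-mono (0≤∥∥ (u ⊖ iG)) 0≤2 near-L uU)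
          (≤-trans (≤-reflexive (trans (cong (∥ u ⊖ iG ∥ *_) ∥i∥) (*-identityʳ (∥ u ⊖ iG ∥)))) near-L))
        0≤β3 : 0ℚ ≤ β * 2ℚ + β
        0≤β3 = 0≤+ (0≤* 0≤β 0≤2) 0≤β
        ii = iG ⊗ iG
        ∥ii∥ : ∥ ii ∥ ≡ 1ℚ
        ∥ii∥ = refl
        fourth : ∥ (u ⊗ u) ⊗ (u ⊗ u) ⊖ 1G ∥ ≤ (β * 2ℚ + β) * 2ℚ + (β * 2ℚ + β)
        fourth = ≤-trans (⊗-diff (u ⊗ u) (u ⊗ u) ii ii) (+-mono-≤
          (*-mono (0≤∥∥ (u ⊗ u ⊖ ii)) 0≤2 second (Unit-norm (u ⊗ u) (Unit-⊗ {u} {u} (V-unit L) (V-unit L))))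
          (≤-trans (≤-reflexive (trans (cong (∥ u ⊗ u ⊖ ii ∥ *_) ∥ii∥) (*-identityʳ (∥ u ⊗ u ⊖ ii ∥)))) second))

      w₀-left : ∀ r → c ℕ.≤ 4 ℕ.* r → 4 ℕ.* r ℕ.≤ 3 ℕ.* c → re (w₀ ^G r) ≤ 9β
      w₀-left r lo hi = subst (λ s → re s ≤ 9β) (sym (w₀^ r)) (≤-trans (left-half (r ℕ.* (4 ℕ.* p)) lo′ hi′)
          (≤-by (0≤+ (0≤+ 0≤β 0≤β) (0≤+ 0≤β 0≤β)) (eq 5β β)))
        where
        eq : ∀ a b → a + (b + b + (b + b)) - a ≡ b + b + (b + b)
        eq = solve-∀ ℚ-ring
        e : r ℕ.* (4 ℕ.* p) ≡ (4 ℕ.* r) ℕ.* p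
        e = trans (sym (ℕₚ.*-assoc r 4 p)) (cong (ℕ._* p) (ℕₚ.*-comm r 4))
        lo′ : L ℕ.≤ r ℕ.* (4 ℕ.* p)
        lo′ = ℕₚ.≤-trans (ℕₚ.*-monoˡ-≤ p lo) (ℕₚ.≤-reflexive (sym e))
        hi′ : r ℕ.* (4 ℕ.* p) ℕ.≤ L ℕ.+ (L ℕ.+ L)
        hi′ = ℕₚ.≤-trans (ℕₚ.≤-reflexive e) (ℕₚ.≤-trans (ℕₚ.*-monoˡ-≤ p hi)
          (ℕₚ.≤-reflexive (trans (ℕₚ.*-assoc 3 c p) (cong (λ s → L ℕ.+ (L ℕ.+ s)) (ℕₚ.+-identityʳ L)))))

module ApproximateRoot where
  open RationalLemmas
  open GaussianRationals
  open ComplexNumbers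
  open NewtonIteration
  open CircleRotation
  open import Algebra.Apartness.Bundles using (HeytingField)
  open import Algebra.Bundles using (CommutativeRing)
  open import Data.Rational using (ℚ; 0ℚ; 1ℚ; ½; positive; _+_; _*_; -_; _-_; _≤_; _<_; ∣_∣)
  open import Data.Rational.Properties
  open import Data.Nat as ℕ using (ℕ; zero; suc)
  import Data.Nat.Properties as ℕₚ
  open import Data.Product
  open import Data.Sum using (_⊎_; inj₁; inj₂)
  open import Relation.Binary.PropositionalEquality
  open import Relation.Nullary
  open import Tactic.RingSolver using (solve-∀)

  open FieldOperations
  open FieldOps ℂ-heytingField using (_^_)

  seq-^ : ∀ x r n → seq (x ^ r) n ≡ seq x n ^G r
  seq-^ x zero    n = refl
  seq-^ x (suc r) n = cong (seq x n ⊗_) (seq-^ x r n)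

  4ℚ : ℚ
  4ℚ = 2ℚ + 2ℚ

  0≤4 : 0ℚ ≤ 4ℚ
  0≤4 = 0≤+ 0≤2 0≤2

  pow4 powLip : ℕ → ℚ
  pow4 zero    = 1ℚ
  pow4 (suc r) = 4ℚ * pow4 r
  powLip zero    = 0ℚ
  powLip (suc r) = powLip r * 4ℚ + pow4 r

  0≤pow4 : ∀ r → 0ℚ ≤ pow4 r
  0≤pow4 zero    = 0≤1
  0≤pow4 (suc r) = 0≤* 0≤4 (0≤pow4 r)

  0≤powLip : ∀ r → 0ℚ ≤ powLip r
  0≤powLip zero    = ≤-refl
  0≤powLip (suc r) = 0≤+ (0≤* (0≤powLip r) 0≤4) (0≤pow4 r)

  powLip-step : ∀ r → powLip r ≤ powLip (suc r)
  powLip-step r = ≤-by {powLip r} {powLip (suc r)} (0≤+ (0≤* {powLip r} {2ℚ + 1ℚ} (0≤powLip r) (0≤+ 0≤2 0≤1)) (0≤pow4 r)) (eq (powLip r) (pow4 r))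
    where
    eq : ∀ a b → a * (1ℚ + 1ℚ + (1ℚ + 1ℚ)) + b - a ≡ a * (1ℚ + 1ℚ + 1ℚ) + b
    eq = solve-∀ ℚ-ring

  powLip-mono : ∀ {r c} → r ℕ.≤ c → powLip r ≤ powLip c
  powLip-mono {r} {c} r≤c = subst (λ n → powLip r ≤ powLip n) (ℕₚ.m∸n+n≡m r≤c) (go (c ℕ.∸ r))
    where
    go : ∀ k → powLip r ≤ powLip (k ℕ.+ r)
    go zero    = ≤-refl {powLip r}
    go (suc k) = ≤-trans (go k) (powLip-step (k ℕ.+ r))

  pow4-bound : ∀ a → ∥ a ∥ ≤ 4ℚ → ∀ r → ∥ a ^G r ∥ ≤ pow4 r
  pow4-bound a p zero    = ≤-reflexive ∥1∥
  pow4-bound a p (suc r) = ≤-trans (∥⊗∥ a (a ^G r)) (*-mono (0≤∥∥ a) (0≤pow4 r) p (pow4-bound a p r))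

  powLip-bound : ∀ a b → ∥ a ∥ ≤ 4ℚ → ∥ b ∥ ≤ 4ℚ → ∀ r → ∥ a ^G r ⊖ b ^G r ∥ ≤ powLip r * ∥ a ⊖ b ∥
  powLip-bound a b p q zero    = ≤-reflexive (sym (*-zeroˡ (∥ a ⊖ b ∥)))
  powLip-bound a b p q (suc r) = ≤-trans (⊗-diff a (a ^G r) b (b ^G r)) (≤-trans
    (+-mono-≤ (*-mono (0≤∥∥ (a ^G r ⊖ b ^G r)) 0≤4 (powLip-bound a b p q r) p)
              (*-monoˡ (∥ a ⊖ b ∥) (0≤∥∥ (a ⊖ b)) (pow4-bound b q r)))
    (≤-reflexive (eq (powLip r) (∥ a ⊖ b ∥) (pow4 r))))
    where
    eq : ∀ l d m → l * d * (1ℚ + 1ℚ + (1ℚ + 1ℚ)) + d * m ≡ (l * (1ℚ + 1ℚ + (1ℚ + 1ℚ)) + m) * d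
    eq = solve-∀ ℚ-ring

  -- the rational point ((1 - s²) + 2si) / (1 + s²) of the unit circle
  module _ {s h : ℚ} (0<s : 0ℚ < s) (s<1 : s < 1ℚ) (0<h : 0ℚ < h) (sh : (1ℚ + s * s) * h ≡ 1ℚ) where
    circC circS : ℚ
    circC = (1ℚ - s * s) * h
    circS = (s + s) * h

    private
      0≤s = <⇒≤ 0<s
      0≤h = <⇒≤ 0<h

    circ-0<C : 0ℚ < circC
    circ-0<C = 0<* (subst (0ℚ <_) (eq s) (0<* (0<- s<1) (0<+≤ 0<1 0≤s))) 0<h
      where
      eq : ∀ s → (1ℚ - s) * (1ℚ + s) ≡ 1ℚ - s * s
      eq = solve-∀ ℚ-ring

    circ-0<S : 0ℚ < circS
    circ-0<S = 0<* (0<+ 0<s 0<s) 0<h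

    circ-1-C : 1ℚ - circC ≡ s * s * h + s * s * h
    circ-1-C = trans (cong (_- circC) (sym sh)) (eq s h)
      where
      eq : ∀ s h → (1ℚ + s * s) * h - (1ℚ - s * s) * h ≡ s * s * h + s * s * h
      eq = solve-∀ ℚ-ring

    circ-C≤1 : circC ≤ 1ℚ
    circ-C≤1 = ≤-by {circC} {1ℚ} (0≤+ 0≤ssh 0≤ssh) circ-1-C
      where 0≤ssh = 0≤* (0≤* 0≤s 0≤s) 0≤h

    circ-1-C≤S : 1ℚ - circC ≤ circS
    circ-1-C≤S = ≤-trans (≤-reflexive circ-1-C) (≤-by (0≤* (0≤* (0≤+ 0≤s 0≤s) (0≤- (<⇒≤ s<1))) 0≤h) (eq s h))
      where
      eq : ∀ s h → (s + s) * h - (s * s * h + s * s * h) ≡ (s + s) * (1ℚ - s) * h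
      eq = solve-∀ ℚ-ring

    circ-unit : circC * circC + circS * circS ≡ 1ℚ
    circ-unit = trans (eq s h) (trans (cong₂ _*_ sh sh) (*-identityˡ 1ℚ))
      where
      eq : ∀ s h → (1ℚ - s * s) * h * ((1ℚ - s * s) * h) + (s + s) * h * ((s + s) * h) ≡ (1ℚ + s * s) * h * ((1ℚ + s * s) * h)
      eq = solve-∀ ℚ-ring

    circ-h≤1 : h ≤ 1ℚ
    circ-h≤1 = ≤-by {h} {1ℚ} (0≤* (0≤* 0≤s 0≤s) 0≤h) (trans (cong (_- h) (sym sh)) (eq s h))
      where
      eq : ∀ s h → (1ℚ + s * s) * h - h ≡ s * s * h
      eq = solve-∀ ℚ-ring

    circ-S≤ : circS ≤ s + s
    circ-S≤ = ≤-trans (*-monoˡ (s + s) (0≤+ 0≤s 0≤s) circ-h≤1) (≤-reflexive (*-identityʳ (s + s)))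

  module Assemble (c : ℕ) .{{_ : ℕ.NonZero c}} where
    record Data : Set where
      field
        γ d      : ℚ
        0≤γ      : 0ℚ ≤ γ
        γ≤1      : γ ≤ 1ℚ
        cγ       : ι c * γ ≡ 1ℚ
        0<d      : 0ℚ < d
        dA       : d * Newton.A c 0≤γ γ≤1 cγ ≤ ½
        8d≤1     : 8ℚ * d ≤ 1ℚ
        8dL      : powLip c * (8ℚ * d) ≤ ½
        d≤¼      : d ≤ ½ * ½
        w₀       : ℚ[i]
        w₀≤2     : ∥ w₀ ∥ ≤ 2ℚ
        w₀-root  : ∥ w₀ ^G c ⊖ 1G ∥ ≤ d
        w₀-left  : ∀ r → c ℕ.≤ 4 ℕ.* r → 4 ℕ.* r ℕ.≤ 3 ℕ.* c → re (w₀ ^G r) ≤ d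

    4r≤3c⇒r≤c : ∀ {r} → 4 ℕ.* r ℕ.≤ 3 ℕ.* c → r ℕ.≤ c
    4r≤3c⇒r≤c {r} p = ℕₚ.*-cancelˡ-≤ 4 (ℕₚ.≤-trans p (ℕₚ.*-monoˡ-≤ c (ℕₚ.n≤1+n 3)))

    module FromData (D : Data) where
      open Data D
      module Nw = Newton c 0≤γ γ≤1 cγ
      module I = Nw.Iterate w₀ d 0<d dA 8d≤1 w₀≤2 w₀-root

      ζ : ℂ
      ζ = I.root

      ζ-root : ζ ^ c ≈ 1ℂ
      ζ-root = mk≈ λ ε 0<ε → ev-map (λ {n} → subst (λ s → ∥ s ⊖ 1G ∥ ≤ ε) (sym (seq-^ ζ c n))) (I.root-close ε 0<ε)

      far : ∀ r → c ℕ.≤ 4 ℕ.* r → 4 ℕ.* r ℕ.≤ 3 ℕ.* c → ∀ n → ½ * ½ ≤ ∥ I.w n ^G r ⊖ 1G ∥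
      far r lo hi n = ≤-trans (≤-by (0≤+ (0≤- xr≤) (0≤- d≤¼)) (eq x d)) (≤-trans (-a≤∣a∣ (x - 1ℚ)) (∥re∥ (I.w n ^G r ⊖ 1G)))
        where
        x = re (I.w n ^G r)
        eq : ∀ x d → - (x - 1ℚ) - ½ * ½ ≡ (d + ½ - x) + (½ * ½ - d)
        eq = solve-∀ ℚ-ring
        close-pow : ∥ I.w n ^G r ⊖ w₀ ^G r ∥ ≤ ½
        close-pow = ≤-trans (powLip-bound (I.w n) w₀ (I.w≤4 n) (≤-trans w₀≤2 (≤-by {2ℚ} {4ℚ} 0≤2 refl)) r)
          (≤-trans (*-mono (0≤powLip r) (0≤* 0≤8 (<⇒≤ 0<d)) (powLip-mono {r} (4r≤3c⇒r≤c {r} hi)) (I.near n)) 8dL)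
        xr≤ : x ≤ d + ½
        xr≤ = ≤-trans (≤-ball {x} {re (w₀ ^G r)} (≤-trans (∥re∥ (I.w n ^G r ⊖ w₀ ^G r)) close-pow))
           (+-monoˡ-≤ ½ (w₀-left r lo hi))

      ζ-far : ∀ r → c ℕ.≤ 4 ℕ.* r → 4 ℕ.* r ℕ.≤ 3 ℕ.* c → ζ ^ r # 1ℂ
      ζ-far r lo hi = mk# (½ * ½) (0<half 0<½) (0 , λ n _ →
        subst (λ s → ½ * ½ ≤ ∥ s ⊖ 1G ∥) (sym (seq-^ ζ r n)) (far r lo hi n))

    -- 1 / d and d / s are chosen larger than all the bounds they have to satisfy.
    data-exists : Data
    data-exists = go (inv (0<ι′ c))
      where
      0<ι′ : ∀ n .{{_ : ℕ.NonZero n}} → 0ℚ < ι n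
      0<ι′ (suc n) = 0<ι n

      1≤ι : ∀ n .{{_ : ℕ.NonZero n}} → 1ℚ ≤ ι n
      1≤ι (suc n) = ≤-by {1ℚ} {ι (suc n)} (0≤ι n) (eq (ι n))
        where
        eq : ∀ t → 1ℚ + t - 1ℚ ≡ t
        eq = solve-∀ ℚ-ring

      go : (∃ λ γ → 0ℚ < γ × ι c * γ ≡ 1ℚ) → Data
      go (γ , 0<γ , cγ) = record
        { γ = γ ; d = d ; 0≤γ = 0≤γ ; γ≤1 = γ≤1 ; cγ = cγ ; 0<d = 0<d
        ; dA = dA ; 8d≤1 = ≤-trans 8d≤ ¼≤1 ; 8dL = 8dL ; d≤¼ = d≤¼
        ; w₀ = St.w₀ ; w₀≤2 = St.w₀-norm
        ; w₀-root = ≤-trans St.w₀-root 9β≤d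
        ; w₀-left = λ r lo hi → ≤-trans (St.w₀-left r lo hi) 9β≤d }
        where
        0≤γ = <⇒≤ 0<γ
        γ≤1 : γ ≤ 1ℚ
        γ≤1 = ≤-trans (≤-trans (≤-reflexive (sym (*-identityˡ γ))) (*-monoʳ γ 0≤γ (1≤ι c))) (≤-reflexive cγ)
        module Nw = Newton c 0≤γ γ≤1 cγ
        ℓ = powLip c
        0≤ℓ = 0≤powLip c
        16ℚ : ℚ
        16ℚ = 8ℚ + 8ℚ
        0≤16 : 0ℚ ≤ 16ℚ
        0≤16 = 0≤+ 0≤8 0≤8
        0≤A : 0ℚ ≤ Nw.A
        0≤A = 0≤+ 0≤1 (0≤* 0≤2 (0≤remBound c))
        X : ℚ
        X = Nw.A + (16ℚ + 16ℚ * ℓ)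
        0<16 : 0ℚ < 16ℚ
        0<16 = positive⁻¹ 16ℚ
        0<X : 0ℚ < X
        0<X = +-mono-≤-< 0≤A (0<+≤ 0<16 (0≤* 0≤16 0≤ℓ))
        d = proj₁ (shrink 0<½ 0<X)
        0<d : 0ℚ < d
        0<d = proj₁ (proj₂ (shrink 0<½ 0<X))
        dX : d * X ≡ ½
        dX = proj₂ (proj₂ (shrink 0<½ 0<X))
        0≤d = <⇒≤ 0<d

        module Choice (d A ℓ : ℚ) (0≤d : 0ℚ ≤ d) (0≤A : 0ℚ ≤ A) (0≤ℓ : 0ℚ ≤ ℓ) (dX : d * (A + (16ℚ + 16ℚ * ℓ)) ≡ ½) where
          dA′ : d * A ≤ ½
          dA′ = ≤-trans (≤-by {d * A} {d * (A + (16ℚ + 16ℚ * ℓ))} (0≤* 0≤d (0≤+ 0≤16 (0≤* 0≤16 0≤ℓ))) (eq d A (16ℚ + 16ℚ * ℓ))) (≤-reflexive dX)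
            where
            eq : ∀ d a b → d * (a + b) - d * a ≡ d * b
            eq = solve-∀ ℚ-ring
          16d≤ : d * 16ℚ ≤ ½
          16d≤ = ≤-trans (≤-by {d * 16ℚ} {d * (A + (16ℚ + 16ℚ * ℓ))} (0≤* 0≤d (0≤+ 0≤A (0≤* 0≤16 0≤ℓ))) (eq d A 16ℚ (16ℚ * ℓ))) (≤-reflexive dX)
            where
            eq : ∀ d a x b → d * (a + (x + b)) - d * x ≡ d * (a + b)
            eq = solve-∀ ℚ-ring
          16dℓ≤ : d * (16ℚ * ℓ) ≤ ½
          16dℓ≤ = ≤-trans (≤-by {d * (16ℚ * ℓ)} {d * (A + (16ℚ + 16ℚ * ℓ))} (0≤* 0≤d (0≤+ 0≤A 0≤16)) (eq d A 16ℚ (16ℚ * ℓ))) (≤-reflexive dX)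
            where
            eq : ∀ d a x b → d * (a + (x + b)) - d * b ≡ d * (a + x)
            eq = solve-∀ ℚ-ring
          8d≤′ : 8ℚ * d ≤ ½ * ½
          8d≤′ = ≤-trans (≤-reflexive (eq d 8ℚ)) (*-monoˡ ½ (<⇒≤ 0<½) 16d≤)
            where
            eq : ∀ d e → e * d ≡ ½ * (d * (e + e))
            eq = solve-∀ ℚ-ring
          8dℓ : ℓ * (8ℚ * d) ≤ ½
          8dℓ = ≤-trans (≤-by {ℓ * (8ℚ * d)} {d * (16ℚ * ℓ)} (0≤* 0≤ℓ (0≤* 0≤8 0≤d)) (eq d 8ℚ ℓ)) 16dℓ≤
            where
            eq : ∀ d e l → d * ((e + e) * l) - l * (e * d) ≡ l * (e * d)
            eq = solve-∀ ℚ-ring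
          d≤ : d ≤ ½ * ½
          d≤ = ≤-trans (≤-by {d} {8ℚ * d} (0≤* (0≤+ 0≤2 (0≤+ 0≤2 (0≤+ 0≤2 0≤1))) 0≤d) (eq d)) 8d≤′
            where
            eq : ∀ d → (1ℚ + 1ℚ) * ((1ℚ + 1ℚ) * (1ℚ + 1ℚ)) * d - d ≡ ((1ℚ + 1ℚ) + ((1ℚ + 1ℚ) + ((1ℚ + 1ℚ) + 1ℚ))) * d
            eq = solve-∀ ℚ-ring

        module Ch = Choice d Nw.A ℓ 0≤d 0≤A 0≤ℓ dX
        dA = Ch.dA′
        8d≤ = Ch.8d≤′
        8dL = Ch.8dℓ
        d≤¼ = Ch.d≤
        ¼≤1 : ½ * ½ ≤ 1ℚ
        ¼≤1 = <⇒≤ (<-trans (half< 0<½) (≤-<-trans (≤-reflexive refl) ½<1))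
          where
          ½<1 : ½ < 1ℚ
          ½<1 = half< {1ℚ} 0<1

        y Y : ℚ
        y = 2ℚ + 2ℚ * ι c
        Y = 1ℚ + 4ℚ * (9ℚ * y)
          where
          9ℚ : ℚ
          9ℚ = 8ℚ + 1ℚ
        0≤y : 0ℚ ≤ y
        0≤y = 0≤+ 0≤2 (0≤* 0≤2 (0≤ι c))
        0≤9 : 0ℚ ≤ 8ℚ + 1ℚ
        0≤9 = 0≤+ 0≤8 0≤1
        0<Y : 0ℚ < Y
        0<Y = 0<+≤ 0<1 (0≤* 0≤4 (0≤* 0≤9 0≤y))
        s = proj₁ (shrink 0<d 0<Y)
        0<s : 0ℚ < s
        0<s = proj₁ (proj₂ (shrink 0<d 0<Y))
        sY : s * Y ≡ d
        sY = proj₂ (proj₂ (shrink 0<d 0<Y))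
        0≤s = <⇒≤ 0<s

        s≤d : ∀ s d z → 0ℚ ≤ s → 0ℚ ≤ z → s * (1ℚ + z) ≡ d → s ≤ d
        s≤d s d z p q e = ≤-trans (≤-by {s} {s * (1ℚ + z)} (0≤* p q) (eq s z)) (≤-reflexive e)
          where
          eq : ∀ s z → s * (1ℚ + z) - s ≡ s * z
          eq = solve-∀ ℚ-ring
        s<1 : s < 1ℚ
        s<1 = ≤-<-trans (s≤d s d (4ℚ * ((8ℚ + 1ℚ) * y)) 0≤s (0≤* 0≤4 (0≤* 0≤9 0≤y)) sY)
          (≤-<-trans d≤¼ (<-trans (half< 0<½) (half< {1ℚ} 0<1)))

        hh = inv (0<+≤ 0<1 (0≤sq s))
        h = proj₁ hh
        0<h : 0ℚ < h
        0<h = proj₁ (proj₂ hh)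
        sh : (1ℚ + s * s) * h ≡ 1ℚ
        sh = proj₂ (proj₂ hh)

        module Ro = Rotation (circC 0<s s<1 0<h sh) (circS 0<s s<1 0<h sh) (circ-0<C 0<s s<1 0<h sh) (circ-C≤1 0<s s<1 0<h sh)
          (circ-0<S 0<s s<1 0<h sh) (circ-1-C≤S 0<s s<1 0<h sh) (circ-unit 0<s s<1 0<h sh)
        module St = Ro.Start c

        final : ∀ s S y d → 0ℚ ≤ s → 0ℚ ≤ y → S ≤ s + s → s * (1ℚ + 4ℚ * ((8ℚ + 1ℚ) * y)) ≡ d →
          let b = y * (S + S) in (b + b + (b + b + b)) + (b + b + (b + b)) ≤ d
        final s S y d 0≤s 0≤y S≤ e = ≤-trans (≤-by
            {(b + b + (b + b + b)) + (b + b + (b + b))} {s * (1ℚ + 4ℚ * ((8ℚ + 1ℚ) * y))}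
            (0≤+ 0≤s (0≤* (0≤* 0≤9 0≤y) (0≤+ (0≤- S≤) (0≤- S≤)))) (eq s S y)) (≤-reflexive e)
          where
          b = y * (S + S)
          eq : ∀ s S y → s * (1ℚ + (1ℚ + 1ℚ + (1ℚ + 1ℚ)) * (((1ℚ + 1ℚ) * ((1ℚ + 1ℚ) * (1ℚ + 1ℚ)) + 1ℚ) * y)) -
             ((y * (S + S) + y * (S + S) + (y * (S + S) + y * (S + S) + y * (S + S))) + (y * (S + S) + y * (S + S) + (y * (S + S) + y * (S + S))))
             ≡ s + ((1ℚ + 1ℚ) * ((1ℚ + 1ℚ) * (1ℚ + 1ℚ)) + 1ℚ) * y * ((s + s - S) + (s + s - S))
          eq = solve-∀ ℚ-ring

        9β≤d : St.9β ≤ d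
        9β≤d = final s (circS 0<s s<1 0<h sh) y d 0≤s 0≤y (circ-S≤ 0<s s<1 0<h sh) sY

open import Data.Nat as ℕ using (ℕ; zero; suc; NonZero)
open import Data.Product using (_,_)
open import Data.Rational using (1ℚ; _≤_)
open import Data.Rational.Properties using (≤-reflexive; ≤-trans)
open import Relation.Binary.PropositionalEquality as ≡ using (_≡_)

open Counting public using (p′; solutions; ∈-solutions; solutions-unique)
open FieldTheory public using (module Field)
open SeriesTheory public using (module RingOps; module PowerSeries)
open Sums public using (module FourierDedekind)
open RationalLemmas using (0<1; ι; ι-mono)
open GaussianRationals using (0G; 1G; _⊕_; _⊖_; ∥_∥; ⊕-comm; ⊕-idˡ)
open ComplexNumbers using (ℂ; seq; 1ℂ; mk#; ℂ-heytingField) public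
open NewtonIteration using (ιG; ∥ιG∥)

private module C = Field ℂ-heytingField

abstract
  ℂ-char0 : C.CharZero
  ℂ-char0 (suc n) = mk# 1ℚ 0<1 (0 , λ k _ → ≤-trans (1≤ n)
    (≤-reflexive (≡.trans (≡.sym (∥ιG∥ (suc n))) (≡.cong ∥_∥ (≡.trans (⊖0 (ιG (suc n))) (≡.cong (_⊖ 0G) (seq-× (suc n) k)))))))
    where
    seq-× : ∀ n k → ιG n ≡ seq (n C.× 1ℂ) k
    seq-× zero    k = ≡.refl
    seq-× (suc n) k = ≡.cong (1G ⊕_) (seq-× n k)
    ⊖0 : ∀ z → z ≡ z ⊖ 0G
    ⊖0 z = ≡.sym (≡.trans (⊕-comm z 0G) (⊕-idˡ z))
    1≤ : ∀ n → 1ℚ ≤ ι (suc n)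
    1≤ n = ι-mono {1} {suc n} (ℕ.s≤s ℕ.z≤n)

  ℂ-primitiveRoot : ∀ n .{{_ : NonZero n}} → C.PrimitiveRoot n
  ℂ-primitiveRoot n = record
    { ζ = ζ ; ζ^n≈1 = ζ-root ; order = C.primitive-from-middle n ζ ζ-root ζ-far }
    where
    open ApproximateRoot.Assemble n
    open FromData data-exists

ℂ-roots : ∀ n .{{_ : NonZero n}} → C.NontrivialRoots n
ℂ-roots n = C.nontrivialRoots ℂ-char0 n (ℂ-primitiveRoot n)

open FourierDedekind ℂ-heytingField ℂ-char0 ℂ-roots public using (σ; R′)

{-# OPTIONS --safe #-}
-- Let d_A(t) be the difference of the two sides, for t ≥ 1.  Removing an entry gives
--   d_A(t + aⱼ) = d_A(t) + d_{A∖j}(t)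
-- because each of the two sides satisfies this recurrence: the solutions of weight t + aⱼ have
-- mⱼ ≥ 2 or mⱼ = 1, and in the residue and the Fourier-Dedekind sums the extra factor z^aⱼ - 1
-- cancels.  For n = 1 the claim is the orthogonality of the roots of unity.  For n ≥ 2, induction
-- makes d_A periodic with the coprime periods a₁ and a₂, hence equal to a constant κ_A.  With
-- B = (1, A) the recurrence for the new entry turns d_B into an arithmetic progression with
-- difference κ_A, and the recurrence for aᵢ then gives aᵢ κ_A = κ_{B∖aᵢ}.  Iterating replaces
-- every entry by 1, and κ_{(1,…,1)} = d(1) = 0 is evaluated directly.
module Submission where

open import Defs

-- Removing an entry from the counting function.

module CountingRecurrence where
  open Counting using (weight)
  open import Data.Nat using (ℕ; zero; suc; _+_; _*_; _<_; s≤s; z≤n; pred; NonZero; >-nonZero)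
  import Data.Nat.Properties as ℕₚ
  open import Data.Fin using (Fin; zero; suc; punchIn; punchOut)
  import Data.Fin.Properties as Finₚ
  open import Data.List using (List; []; _∷_; _++_; map)
  open import Data.List.Properties using (length-++; length-map)
  open import Data.List.Membership.Propositional using (_∈_)
  open import Data.List.Membership.Propositional.Properties
    using (∈-++⁺ˡ; ∈-++⁺ʳ; ∈-++⁻; ∈-map⁺; ∈-map⁻)
  open import Data.List.Membership.Propositional.Properties.WithK using (unique∧set⇒bag)
  open import Data.List.Relation.Unary.Any using (here)
  open import Data.List.Relation.Unary.Unique.Propositional using (Unique)
  import Data.List.Relation.Unary.Unique.Propositional.Properties as Unique
  open import Data.List.Relation.Binary.BagAndSetEquality using (∼bag⇒↭)
  open import Data.List.Relation.Binary.Permutation.Propositional.Properties using (↭-length)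
  open import Data.Empty using (⊥)
  open import Data.Product using (_,_; proj₁; _×_)
  open import Data.Sum using (inj₁; inj₂)
  open import Data.Vec using (Vec; lookup; updateAt; insertAt) renaming (removeAt to remove)
  import Data.Vec.Properties as Vecₚ
  open import Data.Vec.Functional using (Vector; removeAt)
  open import Function using (_∘_; mk⇔; Equivalence)
  open import Relation.Nullary using (yes; no; contradiction)
  open import Relation.Binary.PropositionalEquality
  open import Algebra.Properties.Semiring.Sum ℕₚ.+-*-semiring using (sum; sum-cong-≗; sum-remove)

  Solution : ∀ {n} → Vector ℕ n → ℕ → Vec ℕ n → Set
  Solution a t m = (∀ k → 0 < lookup m k) × weight a m ≡ t

  weight-remove : ∀ {n} (a : Vector ℕ (suc n)) j m →
    weight a m ≡ lookup m j * a j + sum (λ k → lookup m (punchIn j k) * removeAt a j k)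
  weight-remove a j m = sum-remove (λ k → lookup m k * a k)

  weight-insertAt : ∀ {n} (a : Vector ℕ (suc n)) j x m →
    weight a (insertAt m j x) ≡ x * a j + weight (removeAt a j) m
  weight-insertAt a j x m = trans (weight-remove a j (insertAt m j x)) (cong₂ _+_
    (cong (_* a j) (Vecₚ.insertAt-lookup m j x))
    (sum-cong-≗ (λ k → cong (_* removeAt a j k) (Vecₚ.insertAt-punchIn m j x k))))

  weight-increment : ∀ {n} (a : Vector ℕ (suc n)) j m → weight a (updateAt m j suc) ≡ weight a m + a j
  weight-increment a j m = begin
    weight a (updateAt m j suc)
      ≡⟨ weight-remove a j (updateAt m j suc) ⟩
    lookup (updateAt m j suc) j * a j + sum (λ k → lookup (updateAt m j suc) (punchIn j k) * removeAt a j k)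
      ≡⟨ cong₂ _+_ (cong (_* a j) (Vecₚ.lookup∘updateAt j m))
           (sum-cong-≗ λ k → cong (_* removeAt a j k) (Vecₚ.lookup∘updateAt′ (punchIn j k) j (Finₚ.punchInᵢ≢i j k) m)) ⟩
    a j + lookup m j * a j + sum (λ k → lookup m (punchIn j k) * removeAt a j k)
      ≡⟨ ℕₚ.+-assoc (a j) _ _ ⟩
    a j + (lookup m j * a j + sum (λ k → lookup m (punchIn j k) * removeAt a j k))
      ≡⟨ cong (a j +_) (weight-remove a j m) ⟨
    a j + weight a m
      ≡⟨ ℕₚ.+-comm (a j) _ ⟩
    weight a m + a j ∎
    where open ≡-Reasoning

  module _ {n} (a : Vector ℕ (suc n)) (a>0 : ∀ k → NonZero (a k)) (j : Fin (suc n)) (t : ℕ) where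
    increment insert-one : Vec ℕ _ → Vec ℕ (suc n)
    increment m = updateAt m j suc
    insert-one m = insertAt m j 1

    -- A solution has mⱼ ≥ 2 or mⱼ = 1.
    split : List (Vec ℕ (suc n))
    split = map increment (solutions a t) ++ map insert-one (solutions (removeAt a j) t)

    increment-solution : ∀ m → Solution a t m → Solution a (t + a j) (increment m)
    increment-solution m (m>0 , e) = positive , trans (weight-increment a j m) (cong (_+ a j) e)
      where
      positive : ∀ k → 0 < lookup (increment m) k
      positive k with k Finₚ.≟ j
      ... | yes refl = subst (0 <_) (sym (Vecₚ.lookup∘updateAt j m)) (s≤s z≤n)
      ... | no k≢j   = subst (0 <_) (sym (Vecₚ.lookup∘updateAt′ k j k≢j m)) (m>0 k)

    insert-solution : ∀ m → Solution (removeAt a j) t m → Solution a (t + a j) (insert-one m)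
    insert-solution m (m>0 , e) = positive ,
      trans (weight-insertAt a j 1 m) (trans (cong₂ _+_ (ℕₚ.*-identityˡ (a j)) e) (ℕₚ.+-comm (a j) t))
      where
      positive : ∀ k → 0 < lookup (insert-one m) k
      positive k with j Finₚ.≟ k
      ... | yes refl = subst (0 <_) (sym (Vecₚ.insertAt-lookup m j 1)) (s≤s z≤n)
      ... | no j≢k   = subst (λ l → 0 < lookup (insert-one m) l) (Finₚ.punchIn-punchOut j≢k)
        (subst (0 <_) (sym (Vecₚ.insertAt-punchIn m j 1 (punchOut j≢k))) (m>0 (punchOut j≢k)))

    -- Lowering coordinate j, or deleting it when it is 1, inverts the two maps. The coordinate is
    -- repeated as the argument `x` so that its value can be matched on.
    solution⇒split : ∀ m x → lookup m j ≡ x → Solution a (t + a j) m → m ∈ split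
    solution⇒split m zero    e (m>0 , w) = contradiction (subst (0 <_) e (m>0 j)) λ ()
    solution⇒split m (suc zero) e (m>0 , w) =
      ∈-++⁺ʳ (map increment (solutions a t)) (subst (_∈ map insert-one (solutions (removeAt a j) t)) m′⇒m
        (∈-map⁺ insert-one (Equivalence.from (∈-solutions (removeAt a j) (a>0 ∘ punchIn j) t m′)
          ((λ k → subst (0 <_) (lookup-m′ k) (m>0 (punchIn j k)))
          , ℕₚ.+-cancelˡ-≡ (a j) _ _ (trans (cong (_+ weight (removeAt a j) m′) (sym (ℕₚ.*-identityˡ (a j))))
              (trans (sym (weight-insertAt a j 1 m′)) (trans (cong (weight a) m′⇒m) (trans w (ℕₚ.+-comm t (a j))))))))))
      where
      m′ = remove m j
      m′⇒m : insert-one m′ ≡ m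
      m′⇒m = trans (cong (insertAt m′ j) (sym e)) (Vecₚ.insertAt-removeAt m j)
      lookup-m′ : ∀ k → lookup m (punchIn j k) ≡ lookup m′ k
      lookup-m′ k = trans (cong (λ v → lookup v (punchIn j k)) (sym m′⇒m)) (Vecₚ.insertAt-punchIn m′ j 1 k)
    solution⇒split m (suc (suc x)) e (m>0 , w) =
      ∈-++⁺ˡ (subst (_∈ map increment (solutions a t)) m′⇒m
        (∈-map⁺ increment (Equivalence.from (∈-solutions a a>0 t m′)
          (positive , ℕₚ.+-cancelʳ-≡ (a j) _ _ (trans (sym (weight-increment a j m′)) (trans (cong (weight a) m′⇒m) w))))))
      where
      m′ = updateAt m j (λ _ → suc x)
      m′⇒m : increment m′ ≡ m
      m′⇒m = trans (Vecₚ.updateAt-updateAt j m) (Vecₚ.updateAt-id-local j m (sym e))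
      positive : ∀ k → 0 < lookup m′ k
      positive k with k Finₚ.≟ j
      ... | yes refl = subst (0 <_) (sym (Vecₚ.lookup∘updateAt j m)) (s≤s z≤n)
      ... | no k≢j   = subst (0 <_) (sym (Vecₚ.lookup∘updateAt′ k j k≢j m)) (m>0 k)

    split⇒solution : ∀ m → m ∈ split → Solution a (t + a j) m
    split⇒solution m m∈ with ∈-++⁻ (map increment (solutions a t)) m∈
    ... | inj₁ p with m′ , q , refl ← ∈-map⁻ increment p =
      increment-solution m′ (Equivalence.to (∈-solutions a a>0 t m′) q)
    ... | inj₂ p with m′ , q , refl ← ∈-map⁻ insert-one p =
      insert-solution m′ (Equivalence.to (∈-solutions (removeAt a j) (a>0 ∘ punchIn j) t m′) q)

    -- Both maps have left inverses: lowering coordinate j, and deleting it.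
    split-unique : Unique split
    split-unique = Unique.++⁺
      (Unique.map⁺ increment-injective (solutions-unique a t))
      (Unique.map⁺ insert-injective (solutions-unique (removeAt a j) t))
      disjoint
      where
      increment-injective : ∀ {m m′} → increment m ≡ increment m′ → m ≡ m′
      increment-injective {m} {m′} e = trans (sym (decrement m)) (trans (cong (λ v → updateAt v j pred) e) (decrement m′))
        where
        decrement : ∀ m → updateAt (increment m) j pred ≡ m
        decrement m = trans (Vecₚ.updateAt-updateAt j m) (Vecₚ.updateAt-id j m)
      insert-injective : ∀ {m m′} → insert-one m ≡ insert-one m′ → m ≡ m′
      insert-injective {m} {m′} e =
        trans (sym (Vecₚ.removeAt-insertAt m j 1)) (trans (cong (λ v → remove v j) e) (Vecₚ.removeAt-insertAt m′ j 1))
      -- A common element would be an incremented solution with j-th coordinate 1, so the solution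
      -- itself would have a zero there.
      disjoint : ∀ {m} → m ∈ map increment (solutions a t) × m ∈ map insert-one (solutions (removeAt a j) t) → ⊥
      disjoint (p , q) with m₁ , p₁ , refl ← ∈-map⁻ increment p | m₂ , _ , e ← ∈-map⁻ insert-one q =
        contradiction (ℕₚ.suc-injective (trans (sym (Vecₚ.lookup∘updateAt j m₁)) (trans (cong (λ v → lookup v j) e) (Vecₚ.insertAt-lookup m₂ j 1))))
          (ℕₚ.>⇒≢ (proj₁ (Equivalence.to (∈-solutions a a>0 t m₁) p₁) j))

    -- The solutions of weight t + aⱼ and `split` are repetition-free lists with the same members,
    -- hence permutations of each other. This includes t = 0, where the empty tuple counts as one
    -- solution.
    p′-step : p′ a (t + a j) ≡ p′ a t + p′ (removeAt a j) t
    p′-step = trans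
      (↭-length (∼bag⇒↭ (unique∧set⇒bag (solutions-unique a (t + a j)) split-unique λ {m} → mk⇔
        (λ m∈ → solution⇒split m (lookup m j) refl (Equivalence.to (∈-solutions a a>0 (t + a j) m) m∈))
        (λ m∈ → Equivalence.from (∈-solutions a a>0 (t + a j) m) (split⇒solution m m∈)))))
      (trans (length-++ (map increment (solutions a t)))
        (cong₂ _+_ (length-map increment (solutions a t)) (length-map insert-one (solutions (removeAt a j) t))))

  -- A solution has mⱼ ≥ 1, so its weight is at least aⱼ.
  p′-small : ∀ {n} (a : Vector ℕ (suc n)) → (∀ k → NonZero (a k)) → ∀ j t → t < a j → p′ a t ≡ 0
  p′-small a a>0 j t t<aⱼ with solutions a t in eq
  ... | []     = refl
  ... | m ∷ ms with m>0 , refl ← Equivalence.to (∈-solutions a a>0 t m) (subst (m ∈_) (sym eq) (here refl)) =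
    contradiction (ℕₚ.<-≤-trans t<aⱼ (ℕₚ.≤-trans (ℕₚ.m≤n*m (a j) (lookup m j) {{>-nonZero (m>0 j)}})
      (ℕₚ.≤-trans (ℕₚ.m≤m+n _ _) (ℕₚ.≤-reflexive (sym (weight-remove a j m)))))) (ℕₚ.<-irrefl refl)

-- Sums and products with one entry removed.

module RemovalLemmas where
  open import Algebra.Bundles using (CommutativeMonoid; CommutativeRing)
  open import Data.Nat as ℕ using (ℕ; suc)
  open import Data.Fin using (zero; suc; punchIn)
  open import Data.Vec.Functional using (Vector; removeAt)
  open import Function using (_∘_)

  module _ {c ℓ} (M : CommutativeMonoid c ℓ) where
    open CommutativeMonoid M
    open import Algebra.Properties.CommutativeMonoid.Sum M using (sum; sum-remove; sum-cong-≋; ∑-distrib-+)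
    open import Algebra.Properties.CommutativeSemigroup commutativeSemigroup using (x∙yz≈y∙xz)

    -- Entry j survives the removal of entry `punchIn j i`. Read multiplicatively, this isolates the
    -- factor of a Fourier-Dedekind denominator that is to cancel.
    sum-removeAt-punchIn : ∀ {n} (g : Vector Carrier (suc (suc n))) j i →
      sum (removeAt g (punchIn j i)) ≈ g j ∙ sum (removeAt (removeAt g j) i)
    sum-removeAt-punchIn g zero    i       = refl
    sum-removeAt-punchIn g (suc j) zero    = sum-remove (g ∘ suc)
    sum-removeAt-punchIn {suc n} g (suc j) (suc i) =
      trans (∙-congˡ (sum-removeAt-punchIn (g ∘ suc) j i)) (x∙yz≈y∙xz _ _ _)

    -- Meant for the sum over the omitted entries: term j is unchanged, and every other term gains
    -- the corresponding term of the system without entry j.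
    sum-split : ∀ {n} (f f′ : Vector Carrier (suc n)) (g : Vector Carrier n) j →
      f′ j ≈ f j → (∀ i → f′ (punchIn j i) ≈ f (punchIn j i) ∙ g i) → sum f′ ≈ sum f ∙ sum g
    sum-split f f′ g j eq eqs = begin
      sum f′                               ≈⟨ sum-remove f′ ⟩
      f′ j ∙ sum (removeAt f′ j)           ≈⟨ ∙-cong eq (trans (sum-cong-≋ eqs) (∑-distrib-+ (removeAt f j) g)) ⟩
      f j ∙ (sum (removeAt f j) ∙ sum g)   ≈⟨ assoc _ _ _ ⟨
      f j ∙ sum (removeAt f j) ∙ sum g     ≈⟨ ∙-congʳ (sum-remove f) ⟨
      sum f ∙ sum g                        ∎
      where open import Relation.Binary.Reasoning.Setoid setoid

  module _ {c ℓ} (R : CommutativeRing c ℓ) where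
    open RingOps R
    open import Algebra.Properties.CommutativeMonoid.Sum *-commutativeMonoid using (sum-remove)
    open import Algebra.Properties.Group +-group using (//-rightDividesˡ)

    -- Write z^aⱼ = 1 + (z^aⱼ - 1); the second summand times qⱼ is w. In the application z^aⱼ - 1 is
    -- a power series with constant term 0, hence not invertible, so the quotients are characterised
    -- by an equation instead.
    shifted-product : ∀ {n} z w (a : Vector ℕ (suc n)) (q : Vector Carrier (suc n)) →
      (∀ j → q j * (z ^ a j - 1#) ≈ w) → ∀ u j →
      z ^ (u ℕ.+ a j) * product q ≈ z ^ u * product q + w * (z ^ u * product (removeAt q j))
    shifted-product z w a q q-quotient u j = begin
      z ^ (u ℕ.+ a j) * product q                   ≈⟨ *-congʳ (^-homo-* z u (a j)) ⟩
      z ^ u * z ^ a j * product q                   ≈⟨ *-assoc _ _ _ ⟩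
      z ^ u * (z ^ a j * product q)                 ≈⟨ *-congˡ (*-congʳ (trans (+-comm 1# _) (//-rightDividesˡ 1# (z ^ a j)))) ⟨
      z ^ u * ((1# + (z ^ a j - 1#)) * product q)   ≈⟨ *-congˡ (trans (distribʳ _ _ _) (+-congʳ (*-identityˡ _))) ⟩
      z ^ u * (product q + (z ^ a j - 1#) * product q)
        ≈⟨ *-congˡ (+-congˡ (trans (*-congˡ (sum-remove q)) (trans (sym (*-assoc _ _ _)) (*-congʳ (trans (*-comm _ _) (q-quotient j)))))) ⟩
      z ^ u * (product q + w * product (removeAt q j)) ≈⟨ distribˡ _ _ _ ⟩
      z ^ u * product q + z ^ u * (w * product (removeAt q j)) ≈⟨ +-congˡ (x∙yz≈y∙xz _ _ _) ⟩
      z ^ u * product q + w * (z ^ u * product (removeAt q j)) ∎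

-- The removal recurrence for both sides of the formula.

module Recurrences where
  open RemovalLemmas
  open import Algebra.Apartness.Bundles using (HeytingField)
  open import Algebra.Bundles using (CommutativeRing)
  open import Data.Nat as ℕ using (ℕ; zero; suc; NonZero)
  open import Data.Nat.Coprimality using (Coprime)
  open import Data.Fin as Fin using (Fin; punchIn)
  open import Data.Fin.Properties using (punchInᵢ≢i; punchIn-injective)
  open import Data.Vec.Functional using (Vector; removeAt)
  open import Function using (_∘_)
  open import Relation.Binary.PropositionalEquality as ≡ using (_≡_; _≢_)

  record PairwiseCoprime (n : ℕ) : Set where
    field
      a        : Vector ℕ n
      positive : ∀ k → NonZero (a k)
      coprime  : ∀ i j → i ≢ j → Coprime (a i) (a j)

  open PairwiseCoprime

  without : ∀ {n} → PairwiseCoprime (suc n) → Fin (suc n) → PairwiseCoprime n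
  without A j = record
    { a        = removeAt (a A) j
    ; positive = positive A ∘ punchIn j
    ; coprime  = λ i i′ i≢i′ → coprime A (punchIn j i) (punchIn j i′) (i≢i′ ∘ punchIn-injective j i i′) }

  module OverField {c ℓ₁ ℓ₂} (F : HeytingField c ℓ₁ ℓ₂) (char0 : Field.CharZero F)
    (roots : ∀ n .{{_ : NonZero n}} → Field.NontrivialRoots F n) where
    open Field F
    open PowerSeries F
    open Sums.FourierDedekind F char0 roots using (denominator; denominator#0) renaming (σ to σ[F]; R′ to R′[F])
    open LaurentExpansion
    open import Relation.Binary.Reasoning.Setoid setoid
    open import Algebra.Properties.Group (CommutativeRing.+-group commutativeRing) using (//-rightDividesˡ)
    open import Algebra.Properties.CommutativeSemigroup (CommutativeRing.+-commutativeSemigroup commutativeRing)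
      using (interchange)
    open import Algebra.Properties.AbelianGroup (CommutativeRing.+-abelianGroup commutativeRing) using (⁻¹-∙-comm)

    -- An inverse is extracted from an apartness proof; uniqueness of inverses makes it independent
    -- of that proof.
    ⁻¹-cong : ∀ {x y} (p : x # 0#) (q : y # 0#) → x ≈ y → x ⁻¹[ p ] ≈ y ⁻¹[ q ]
    ⁻¹-cong {x} {y} p q e = begin
      x ⁻¹[ p ]                    ≈⟨ *-identityʳ _ ⟨
      x ⁻¹[ p ] * 1#               ≈⟨ *-congˡ (⁻¹-inverse q) ⟨
      x ⁻¹[ p ] * (y * y ⁻¹[ q ])  ≈⟨ *-assoc _ _ _ ⟨
      x ⁻¹[ p ] * y * y ⁻¹[ q ]    ≈⟨ *-congʳ (trans (*-comm _ _) (trans (*-congʳ (sym e)) (⁻¹-inverse p))) ⟩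
      1# * y ⁻¹[ q ]               ≈⟨ *-identityˡ _ ⟩
      y ⁻¹[ q ]                    ∎

    -- w / (z^aₖ - 1)
    quotients : ∀ {n} (a : Vector ℕ n) → (∀ k → NonZero (a k)) → Vector Series n
    quotients a a>0 k = coeff (reciprocal char0 (a k) {{a>0 k}})

    quotients-correct : ∀ {n} (a : Vector ℕ n) a>0 k → quotients a a>0 k ⊛ ((z S.^ a k) S.- 1S) ≋ w
    quotients-correct a a>0 k m = trans (expansion (reciprocal char0 (a k) {{a>0 k}}) m)
      (trans (S.*-identityʳ (w S.^ 1) m) (S.*-identityʳ w m))

    reciprocals-order : ∀ {n} (a : Vector ℕ n) a>0 → order (reciprocals char0 a a>0) ≡ n
    reciprocals-order {zero}  a a>0 = ≡.refl
    reciprocals-order {suc n} a a>0 = ≡.cong suc (reciprocals-order (a ∘ Fin.suc) (a>0 ∘ Fin.suc))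

    reciprocals-coeff : ∀ {n} (a : Vector ℕ n) a>0 → coeff (reciprocals char0 a a>0) ≋ S.product (quotients a a>0)
    reciprocals-coeff {zero}  a a>0 = λ m → refl
    reciprocals-coeff {suc n} a a>0 =
      ⊛-cong {quotients a a>0 Fin.zero} (λ m → refl) (reciprocals-coeff (a ∘ Fin.suc) (a>0 ∘ Fin.suc))

    0+-cong : ∀ {f g} → f ≋ g → 0+ f ≋ 0+ g
    0+-cong f≋g zero    = refl
    0+-cong f≋g (suc m) = f≋g m

    -- Sealed: conversion checking would otherwise unfold them down to the field axioms.
    abstract
      residueTerm : ℕ → ∀ {n} (a : Vector ℕ n) → (∀ k → NonZero (a k)) → Carrier
      residueTerm = R′[F]

      residueTerm≡ : ∀ t {n} (a : Vector ℕ n) a>0 → residueTerm t a a>0 ≡ R′[F] t a a>0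
      residueTerm≡ t a a>0 = ≡.refl

      fourierDedekind : ℕ → ∀ {m} (cs : Vector ℕ m) (c : ℕ) .{{_ : NonZero c}} → (∀ i → Coprime (cs i) c) → Carrier
      fourierDedekind = σ[F]

      fourierDedekind≡ : ∀ t {m} (cs : Vector ℕ m) (c : ℕ) .{{_ : NonZero c}} (coprime : ∀ i → Coprime (cs i) c) →
        fourierDedekind t cs c coprime ≡ σ[F] t cs c coprime
      fourierDedekind≡ t cs c coprime = ≡.refl

    -- The expansion is written with a pole of order n, so the residue is the coefficient of index n
    -- - 1 in z^u times the product of the w / (z^aₖ - 1). The shift `0+` expresses this index and
    -- gives 0 for n = 0.
    residueTerm-coefficient : ∀ u {n} (a : Vector ℕ n) a>0 → residueTerm (suc u) a a>0 ≈ (0+ ((z S.^ u) ⊛ S.product (quotients a a>0))) n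
    residueTerm-coefficient u {n} a a>0 = trans (reflexive (residueTerm≡ (suc u) a a>0)) (trans
      (reflexive (≡.cong (0+ ((z S.^ u) ⊛ coeff (reciprocals char0 a a>0))) (reciprocals-order a a>0)))
      (0+-cong (⊛-cong {z S.^ u} (λ m → refl) (reciprocals-coeff a a>0)) n))

    -- The factor w left over by the cancellation shifts the coefficients by one, which matches the
    -- smaller pole order of the system with entry j removed.
    residueTerm-step : ∀ u {n} (a : Vector ℕ (suc n)) a>0 j →
      residueTerm (suc (u ℕ.+ a j)) a a>0 ≈ residueTerm (suc u) a a>0 + residueTerm (suc u) (removeAt a j) (a>0 ∘ punchIn j)
    residueTerm-step u {n} a a>0 j = begin
      residueTerm (suc (u ℕ.+ a j)) a a>0
        ≈⟨ residueTerm-coefficient (u ℕ.+ a j) a a>0 ⟩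
      ((z S.^ (u ℕ.+ a j)) ⊛ S.product q) n
        ≈⟨ shifted-product seriesRing z w a q (quotients-correct a a>0) u j n ⟩
      ((z S.^ u) ⊛ S.product q) n + (w ⊛ ((z S.^ u) ⊛ S.product (removeAt q j))) n
        ≈⟨ +-cong (residueTerm-coefficient u a a>0) (trans (residueTerm-coefficient u (removeAt a j) (a>0 ∘ punchIn j))
             (sym (w⊛shift (0+ ((z S.^ u) ⊛ S.product (removeAt q j))) refl n))) ⟨
      residueTerm (suc u) a a>0 + residueTerm (suc u) (removeAt a j) (a>0 ∘ punchIn j) ∎
      where
      q = quotients a a>0

    -- The Fourier-Dedekind sums.

    module _ (c : ℕ) .{{_ : NonZero c}} where
      open NontrivialRoots (roots c)

      -- For each root λ write λᵇ = 1 + (λᵇ - 1); by `factor`, the second summand turns the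
      -- reciprocal of the old denominator into that of the new one.
      fourierDedekind-step : ∀ t b {m m′} (cs : Vector ℕ m) (cs′ : Vector ℕ m′) coprime coprime′ →
        (∀ k → denominator cs c coprime k ≈ (root k ^ b - 1#) * denominator cs′ c coprime′ k) →
        fourierDedekind (t ℕ.+ b) cs c coprime ≈ fourierDedekind t cs c coprime + fourierDedekind t cs′ c coprime′
      fourierDedekind-step t b cs cs′ coprime coprime′ factor = begin
        fourierDedekind (t ℕ.+ b) cs c coprime
          ≡⟨ fourierDedekind≡ (t ℕ.+ b) cs c coprime ⟩
        σ[F] (t ℕ.+ b) cs c coprime
          ≈⟨ *-congˡ (trans (sum-cong-≋ {n = c ℕ.∸ 1} term) (∑-distrib-+ {n = c ℕ.∸ 1} _ _)) ⟩
        (c × 1#) ⁻¹[ char0 c ] * (∑[ k < c ℕ.∸ 1 ] _ + ∑[ k < c ℕ.∸ 1 ] _)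
          ≈⟨ distribˡ _ _ _ ⟩
        σ[F] t cs c coprime + σ[F] t cs′ c coprime′
          ≡⟨ ≡.cong₂ _+_ (fourierDedekind≡ t cs c coprime) (fourierDedekind≡ t cs′ c coprime′) ⟨
        fourierDedekind t cs c coprime + fourierDedekind t cs′ c coprime′ ∎
        where
        term : ∀ k →
          root k ^ (t ℕ.+ b) * denominator cs c coprime k ⁻¹[ denominator#0 cs c coprime k ] ≈
          root k ^ t * denominator cs c coprime k ⁻¹[ denominator#0 cs c coprime k ] +
          root k ^ t * denominator cs′ c coprime′ k ⁻¹[ denominator#0 cs′ c coprime′ k ]
        term k = begin
          x ^ (t ℕ.+ b) * d⁻¹                   ≈⟨ trans (*-congʳ (^-homo-* x t b)) (*-assoc _ _ _) ⟩
          x ^ t * (x ^ b * d⁻¹)                 ≈⟨ *-congˡ (*-congʳ (trans (+-comm 1# _) (//-rightDividesˡ 1# (x ^ b)))) ⟨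
          x ^ t * ((1# + (x ^ b - 1#)) * d⁻¹)   ≈⟨ *-congˡ (trans (distribʳ _ _ _) (+-cong (*-identityˡ _) cancel)) ⟩
          x ^ t * (d⁻¹ + d′⁻¹)                  ≈⟨ distribˡ _ _ _ ⟩
          x ^ t * d⁻¹ + x ^ t * d′⁻¹            ∎
          where
          x    = root k
          d    = denominator cs c coprime k
          d′   = denominator cs′ c coprime′ k
          d⁻¹  = d ⁻¹[ denominator#0 cs c coprime k ]
          d′⁻¹ = d′ ⁻¹[ denominator#0 cs′ c coprime′ k ]
          cancel : (x ^ b - 1#) * d⁻¹ ≈ d′⁻¹
          cancel = begin
            (x ^ b - 1#) * d⁻¹                 ≈⟨ *-identityʳ _ ⟨
            (x ^ b - 1#) * d⁻¹ * 1#            ≈⟨ *-congˡ (⁻¹-inverse (denominator#0 cs′ c coprime′ k)) ⟨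
            (x ^ b - 1#) * d⁻¹ * (d′ * d′⁻¹)   ≈⟨ *-assoc _ _ _ ⟨
            (x ^ b - 1#) * d⁻¹ * d′ * d′⁻¹     ≈⟨ *-congʳ (trans (*-congʳ (*-comm _ _)) (trans (*-assoc _ _ _) (trans (*-congˡ (sym (factor k))) (trans (*-comm _ _) (⁻¹-inverse (denominator#0 cs c coprime k)))))) ⟩
            1# * d′⁻¹                          ≈⟨ *-identityˡ _ ⟩
            d′⁻¹                               ∎

      fourierDedekind-periodic : ∀ t {m} (cs : Vector ℕ m) coprime → fourierDedekind (t ℕ.+ c) cs c coprime ≈ fourierDedekind t cs c coprime
      fourierDedekind-periodic t cs coprime = begin
        fourierDedekind (t ℕ.+ c) cs c coprime  ≡⟨ fourierDedekind≡ (t ℕ.+ c) cs c coprime ⟩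
        σ[F] (t ℕ.+ c) cs c coprime             ≈⟨ *-congˡ (sum-cong-≋ {n = c ℕ.∸ 1} λ k → *-congʳ
          (trans (^-homo-* (root k) t c) (trans (*-congˡ (root^n≈1 k)) (*-identityʳ _)))) ⟩
        σ[F] t cs c coprime                     ≡⟨ fourierDedekind≡ t cs c coprime ⟨
        fourierDedekind t cs c coprime          ∎

    fourierDedekind-at : ∀ {n} (A : PairwiseCoprime (suc n)) → ℕ → Fin (suc n) → Carrier
    fourierDedekind-at A t j = fourierDedekind t (removeAt (a A) j) (a A j) {{positive A j}} (λ i → coprime A (punchIn j i) j (punchInᵢ≢i j i))

    fourierDedekind-sum : ∀ {n} → PairwiseCoprime (suc n) → ℕ → Carrier
    fourierDedekind-sum {n} A t = ∑[ j < suc n ] fourierDedekind-at A t j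

    product-removeAt-punchIn : ∀ {n} (g : Vector Carrier (suc (suc n))) j i →
      product (removeAt g (punchIn j i)) ≈ g j * product (removeAt (removeAt g j) i)
    product-removeAt-punchIn = sum-removeAt-punchIn *-commutativeMonoid

    fourierDedekind-sum-step : ∀ {n} (A : PairwiseCoprime (suc (suc n))) t j →
      fourierDedekind-sum A (t ℕ.+ a A j) ≈ fourierDedekind-sum A t + fourierDedekind-sum (without A j) t
    fourierDedekind-sum-step {n} A t j = sum-split +-commutativeMonoid
      (fourierDedekind-at A t) (fourierDedekind-at A (t ℕ.+ a A j)) (fourierDedekind-at (without A j) t) j
      -- The term at j has modulus aⱼ itself, and λ^aⱼ = 1 for its roots.
      (fourierDedekind-periodic (a A j) {{positive A j}} t (removeAt (a A) j) (λ i → coprime A (punchIn j i) j (punchInᵢ≢i j i)))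
      other
      where
      other : ∀ i → fourierDedekind-at A (t ℕ.+ a A j) (punchIn j i) ≈ fourierDedekind-at A t (punchIn j i) + fourierDedekind-at (without A j) t i
      other i = fourierDedekind-step (a A i′) {{positive A i′}} t (a A j) (removeAt (a A) i′) (removeAt (a (without A j)) i)
        (λ l → coprime A (punchIn i′ l) i′ (punchInᵢ≢i i′ l))
        (λ l → coprime (without A j) (punchIn i l) i (punchInᵢ≢i i l))
        (λ k → product-removeAt-punchIn (λ l → NontrivialRoots.root (roots (a A i′) {{positive A i′}}) k ^ a A l - 1#) j i)
        where
        i′ = punchIn j i

    -- The difference of the two sides.

    defect : ∀ {n} → PairwiseCoprime (suc n) → ℕ → Carrier
    defect A t = p′ (a A) t × 1# - (residueTerm t (a A) (positive A) + fourierDedekind-sum A t)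

    -- The three recurrences subtracted. The argument is a successor because the exponent t - 1 in
    -- the residue is truncated at t = 0.
    defect-step : ∀ {n} (A : PairwiseCoprime (suc (suc n))) u j →
      defect A (suc u ℕ.+ a A j) ≈ defect A (suc u) + defect (without A j) (suc u)
    defect-step A u j = begin
      defect A (suc u ℕ.+ a A j)
        ≈⟨ +-cong (trans (×-cong (CountingRecurrence.p′-step (a A) (positive A) j (suc u)) refl) (×-homo-+ 1# (p′ (a A) (suc u)) _))
             (-‿cong (trans (+-cong (residueTerm-step u (a A) (positive A) j) (fourierDedekind-sum-step A (suc u) j)) (interchange _ _ _ _))) ⟩
      (p + p⁻) - ((R + s) + (R⁻ + s⁻))
        ≈⟨ +-congˡ (⁻¹-∙-comm (R + s) (R⁻ + s⁻)) ⟨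
      (p + p⁻) + (- (R + s) - (R⁻ + s⁻))
        ≈⟨ interchange _ _ _ _ ⟩
      defect A (suc u) + defect (without A j) (suc u) ∎
      where
      p  = p′ (a A) (suc u) × 1#
      p⁻ = p′ (removeAt (a A) j) (suc u) × 1#
      R  = residueTerm (suc u) (a A) (positive A)
      R⁻ = residueTerm (suc u) (removeAt (a A) j) (positive A ∘ punchIn j)
      s  = fourierDedekind-sum A (suc u)
      s⁻ = fourierDedekind-sum (without A j) (suc u)

-- Vanishing of the difference.

module Vanishing where
  open Recurrences
  open CountingRecurrence using (p′-step; p′-small)
  open import Algebra.Apartness.Bundles using (HeytingField)
  open import Algebra.Bundles using (CommutativeRing)
  open import Data.Nat as ℕ using (ℕ; zero; suc; NonZero)
  import Data.Nat.Properties as ℕₚ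
  open import Data.Nat.Coprimality as Coprimality using (Coprime; coprime-Bézout; 1-coprimeTo)
  open import Data.Nat.DivMod using (_%_; _/_; m≡m%n+[m/n]*n; m%n<n)
  open import Data.Nat.GCD using (module Bézout)
  open Bézout.Identity using (+-; -+)
  open import Data.Fin as Fin using (Fin; toℕ; fromℕ; punchIn)
  open import Data.Fin.Properties as Finₚ using (punchInᵢ≢i)
  open import Data.Vec.Functional using (Vector; removeAt; _∷_)
  open import Function using (_∘_)
  open import Relation.Binary.PropositionalEquality as ≡ using (_≡_; _≢_)

  open PairwiseCoprime

  adjoin-1 : ∀ {n} → PairwiseCoprime n → PairwiseCoprime (suc n)
  adjoin-1 A = record { a = 1 ∷ a A ; positive = positive′ ; coprime = coprime′ }
    where
    positive′ : ∀ k → NonZero ((1 ∷ a A) k)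
    positive′ Fin.zero    = _
    positive′ (Fin.suc k) = positive A k
    coprime′ : ∀ i j → i ≢ j → Coprime ((1 ∷ a A) i) ((1 ∷ a A) j)
    coprime′ Fin.zero    j           i≢j = 1-coprimeTo ((1 ∷ a A) j)
    coprime′ (Fin.suc i) Fin.zero    i≢j = Coprimality.sym (1-coprimeTo (a A i))
    coprime′ (Fin.suc i) (Fin.suc j) i≢j = coprime A i j (i≢j ∘ ≡.cong Fin.suc)

  toℕ-punchIn-fromℕ : ∀ {n} (i : Fin n) → toℕ (punchIn (fromℕ n) i) ≡ toℕ i
  toℕ-punchIn-fromℕ Fin.zero    = ≡.refl
  toℕ-punchIn-fromℕ (Fin.suc i) = ≡.cong suc (toℕ-punchIn-fromℕ i)

  module _ {c ℓ₁ ℓ₂} (F : HeytingField c ℓ₁ ℓ₂) where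
    open Field F

    module _ (char0 : CharZero)
      (roots : ∀ n .{{_ : NonZero n}} → NontrivialRoots n)
      (primitiveRoot : ∀ n .{{_ : NonZero n}} → PrimitiveRoot n)
      -- The case of one entry sums a geometric series, so the enumerated roots have to be
      -- successive powers of ζ.
      (root≈ζ^ : ∀ n .{{_ : NonZero n}} k → NontrivialRoots.root (roots n) k ≈ PrimitiveRoot.ζ (primitiveRoot n) ^ suc (toℕ k)) where
      open PowerSeries F
      open import Relation.Binary.Reasoning.Setoid setoid
      open import Algebra.Properties.Ring ring using (-0#≈0#)
      open import Algebra.Properties.Group (CommutativeRing.+-group commutativeRing)
        using (//-rightDividesʳ; ∙-cancelˡ)
      open import Algebra.Properties.Semiring.Mult semiring using (×-assoc-*)

      open OverField F char0 roots
      open Sums.FourierDedekind F char0 roots using () renaming (σ to σ[F]; R′ to R′[F])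

      -- The recurrence fails at t = 0, so t is replaced by u + 1.
      defect⁺ : ∀ {n} → PairwiseCoprime (suc n) → ℕ → Carrier
      defect⁺ A u = defect A (suc u)

      -- A single entry: orthogonality of the roots of unity.

      module _ (a : ℕ) .{{_ : NonZero a}} where
        open PrimitiveRoot (primitiveRoot a)

        -- The mean of the t-th powers of all a-th roots of unity, which is the indicator function
        -- of the multiples of a.
        average : ℕ → Carrier
        average t = (a × 1#) ⁻¹[ char0 a ] * geometric (ζ ^ t) a

        ζ^t^a : ∀ t → (ζ ^ t) ^ a ≈ 1#
        ζ^t^a t = trans (^-swap ζ t a) (trans (^-congˡ t ζ^n≈1) (1^ t))

        geometric-cong : ∀ {x y} → x ≈ y → geometric x a ≈ geometric y a
        geometric-cong x≈y = sum-cong-≋ {n = a} (λ k → ^-congˡ (toℕ k) x≈y)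

        average-0 : average 0 ≈ 1#
        average-0 = trans (*-congˡ (geometric-1 char0 a (primitiveRoot a))) (trans (*-comm _ _) (⁻¹-inverse (char0 a)))

        average-small : ∀ t → 0 ℕ.< t → t ℕ.< a → average t ≈ 0#
        average-small t 0<t t<a = trans
          (*-congˡ (geometric-root char0 a (primitiveRoot a) (ζ^t^a t) (order t 0<t t<a)))
          (zeroʳ _)

        average-periodic : ∀ t → average (t ℕ.+ a) ≈ average t
        average-periodic t = *-congˡ (geometric-cong
          (trans (^-homo-* ζ t a) (trans (*-congˡ ζ^n≈1) (*-identityʳ _))))

        -- p′ b is the indicator function of the multiples of a, except that it vanishes at t = 0; the
        -- second summand, which is 1 at t = 0 only, makes the sum periodic from t = 0 on.
        p′-average : (b : Vector ℕ 1) → b Fin.zero ≡ a → ∀ t →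
          (p′ b t ℕ.+ p′ (removeAt b Fin.zero) t) × 1# ≈ average t
        p′-average b ≡.refl t = trans (reflexive (≡.cong count t≡)) (trans (step (t / a)) (reflexive (≡.cong average (≡.sym t≡))))
          where
          count : ℕ → Carrier
          count t = (p′ b t ℕ.+ p′ (removeAt b Fin.zero) t) × 1#
          t≡ : t ≡ t % a ℕ.+ (t / a) ℕ.* a
          t≡ = m≡m%n+[m/n]*n t a
          b>0 : ∀ k → NonZero (b k)
          b>0 Fin.zero = ℕ.≢-nonZero (ℕ.≢-nonZero⁻¹ a)
          p′-empty : ∀ t → 0 ℕ.< t → p′ (removeAt b Fin.zero) t ≡ 0
          p′-empty (suc t) _ = ≡.refl
          small : ∀ r → r ℕ.< a → count r ≈ average r
          small zero    r<a = trans (×-cong (≡.cong (ℕ._+ 1) (p′-small b b>0 Fin.zero 0 r<a)) refl) (trans (+-identityʳ 1#) (sym average-0))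
          small (suc r) r<a = trans (×-cong (≡.cong (ℕ._+ 0) (p′-small b b>0 Fin.zero (suc r) r<a)) refl)
            (sym (average-small (suc r) (ℕ.s≤s ℕ.z≤n) r<a))
          step : ∀ q → count (t % a ℕ.+ q ℕ.* a) ≈ average (t % a ℕ.+ q ℕ.* a)
          step zero    = trans (reflexive (≡.cong count (ℕₚ.+-identityʳ (t % a))))
            (trans (small (t % a) (m%n<n t a)) (reflexive (≡.cong average (≡.sym (ℕₚ.+-identityʳ (t % a))))))
          step (suc q) = begin
            count (t % a ℕ.+ (a ℕ.+ q ℕ.* a))   ≈⟨ reflexive (≡.cong count e) ⟩
            -- The recurrence for `p′ b` yields exactly the second summand of `count s`, while that
            -- summand of `count (s + a)` is 0 because s + a is positive.
            count (s ℕ.+ a)                     ≈⟨ ×-cong (≡.trans (≡.cong₂ ℕ._+_ (p′-step b b>0 Fin.zero s)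
                                                     (p′-empty (s ℕ.+ a) (ℕₚ.<-≤-trans (ℕ.>-nonZero⁻¹ a) (ℕₚ.m≤n+m a s)))) (ℕₚ.+-identityʳ _)) refl ⟩
            count s                             ≈⟨ step q ⟩
            average s                           ≈⟨ average-periodic s ⟨
            average (s ℕ.+ a)                   ≈⟨ reflexive (≡.cong average (≡.sym e)) ⟩
            average (t % a ℕ.+ (a ℕ.+ q ℕ.* a)) ∎
            where
            s = t % a ℕ.+ q ℕ.* a
            e : t % a ℕ.+ (a ℕ.+ q ℕ.* a) ≡ s ℕ.+ a
            e = ≡.trans (≡.cong (t % a ℕ.+_) (ℕₚ.+-comm a (q ℕ.* a))) (≡.sym (ℕₚ.+-assoc (t % a) (q ℕ.* a) a))

        geometric-tail : ∀ x m .{{_ : NonZero m}} → geometric x m ≈ 1# + ∑[ k < m ℕ.∸ 1 ] (x ^ suc (toℕ k))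
        geometric-tail x (suc m) = refl

        -- The summand 1 / a is the missing term λ = 1. Since the other roots are the ζ^(k+1),
        -- exchanging the exponents gives a geometric sum in ζ^t.
        fourierDedekind-empty : ∀ t (cs : Vector ℕ 0) coprime →
          (a × 1#) ⁻¹[ char0 a ] + fourierDedekind t cs a coprime ≈ average t
        fourierDedekind-empty t cs coprime = begin
          i + fourierDedekind t cs a coprime                      ≡⟨ ≡.cong (i +_) (fourierDedekind≡ t cs a coprime) ⟩
          i + i * ∑[ k < a ℕ.∸ 1 ] _                              ≈⟨ +-cong (sym (*-identityʳ i)) (*-congˡ (sum-cong-≋ {n = a ℕ.∸ 1} term)) ⟩
          i * 1# + i * ∑[ k < a ℕ.∸ 1 ] ((ζ ^ t) ^ suc (toℕ k))   ≈⟨ distribˡ _ _ _ ⟨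
          i * (1# + ∑[ k < a ℕ.∸ 1 ] ((ζ ^ t) ^ suc (toℕ k)))     ≈⟨ *-congˡ (geometric-tail (ζ ^ t) a) ⟨
          average t ∎
          where
          i = (a × 1#) ⁻¹[ char0 a ]
          1⁻¹ : ∀ (p : 1# # 0#) → 1# ⁻¹[ p ] ≈ 1#
          1⁻¹ p = trans (sym (*-identityˡ _)) (⁻¹-inverse p)
          term : ∀ k → NontrivialRoots.root (roots a) k ^ t * 1# ⁻¹[ _ ] ≈ (ζ ^ t) ^ suc (toℕ k)
          term k = trans (trans (*-congˡ (1⁻¹ _)) (*-identityʳ _)) (trans (^-congˡ t (root≈ζ^ a k)) (^-swap ζ (suc (toℕ k)) t))

      -- The pole is simple: z^a - 1 begins with a w, and z^u has constant term 1.
      residueTerm-single : ∀ u (a : Vector ℕ 1) a>0 →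
        residueTerm (suc u) a a>0 ≈ (a Fin.zero × 1#) ⁻¹[ char0 (a Fin.zero) {{a>0 Fin.zero}} ]
      residueTerm-single u a a>0 = begin
        residueTerm (suc u) a a>0            ≡⟨ residueTerm≡ (suc u) a a>0 ⟩
        (z S.^ u) 0 * (q 0 * 1# + 0#) + 0#   ≈⟨ trans (+-identityʳ _) (trans (*-cong (z^0 u) (+-identityʳ _)) (trans (*-identityˡ _) (*-identityʳ _))) ⟩
        q 0                                  ≈⟨ ⁻¹-cong _ (char0 (a Fin.zero) {{a>0 Fin.zero}})
                                                  (trans (+-cong (z^1 (a Fin.zero)) -0#≈0#) (+-identityʳ _)) ⟩
        (a Fin.zero × 1#) ⁻¹[ char0 (a Fin.zero) {{a>0 Fin.zero}} ] ∎
        where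
        q = quotients a a>0 Fin.zero

      -- The residue 1 / a supplies the root 1 omitted from the Fourier-Dedekind sum. No empty tuple
      -- has the positive weight u + 1, so the count alone equals `average`.
      defect⁺-single : (A : PairwiseCoprime 1) → ∀ u → defect⁺ A u ≈ 0#
      defect⁺-single A u = trans (+-cong
        (trans (×-cong (≡.sym (ℕₚ.+-identityʳ (p′ (a A) (suc u)))) refl) (p′-average a₀ {{a₀>0}} (a A) ≡.refl (suc u)))
        (-‿cong (trans (+-cong (residueTerm-single u (a A) (positive A)) (+-identityʳ _)) (fourierDedekind-empty a₀ {{a₀>0}} (suc u) _ _))))
        (-‿inverseʳ _)
        where
        a₀ = a A Fin.zero
        a₀>0 = positive A Fin.zero

      -- Coprime periods and arithmetic progressions.

      module _ (f : ℕ → Carrier) where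
        multiple-period : ∀ d → (∀ u → f (u ℕ.+ d) ≈ f u) → ∀ m u → f (u ℕ.+ m ℕ.* d) ≈ f u
        multiple-period d period zero    u = reflexive (≡.cong f (ℕₚ.+-identityʳ u))
        multiple-period d period (suc m) u = trans (reflexive (≡.cong f (≡.sym (ℕₚ.+-assoc u d (m ℕ.* d)))))
          (trans (multiple-period d period m (u ℕ.+ d)) (period u))

        -- By Bézout, 1 is the difference of a multiple of one period and a multiple of the other,
        -- so f agrees at u and u + 1.
        coprime-periods : ∀ {d e} → Coprime d e → (∀ u → f (u ℕ.+ d) ≈ f u) → (∀ u → f (u ℕ.+ e) ≈ f u) →
          ∀ u → f u ≈ f 0
        coprime-periods {d} {e} coprime d-period e-period zero    = refl
        coprime-periods {d} {e} coprime d-period e-period (suc u) =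
          trans (step (coprime-Bézout coprime)) (coprime-periods coprime d-period e-period u)
          where
          -- From u + 1 go forward by y e, which leads to u + x d, then back by x d. The two signs
          -- in Bézout's identity exchange the periods.
          walk : ∀ {d e} → (∀ u → f (u ℕ.+ d) ≈ f u) → (∀ u → f (u ℕ.+ e) ≈ f u) →
            ∀ x y → suc (y ℕ.* e) ≡ x ℕ.* d → f (suc u) ≈ f u
          walk {d} {e} d-period e-period x y eq = begin
            f (suc u)                  ≈⟨ multiple-period e e-period y (suc u) ⟨
            f (suc (u ℕ.+ y ℕ.* e))    ≈⟨ reflexive (≡.cong f (≡.trans (≡.sym (ℕₚ.+-suc u _)) (≡.cong (u ℕ.+_) eq))) ⟩
            f (u ℕ.+ x ℕ.* d)          ≈⟨ multiple-period d d-period x u ⟩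
            f u                        ∎
          step : Bézout.Identity 1 d e → f (suc u) ≈ f u
          step (+- x y eq) = walk d-period e-period x y eq
          step (-+ x y eq) = walk e-period d-period y x eq

        progression : ∀ {κ} → (∀ u → f (u ℕ.+ 1) ≈ f u + κ) → ∀ m → f m ≈ f 0 + m × κ
        progression increment zero    = sym (+-identityʳ _)
        progression {κ} increment (suc m) = begin
          f (suc m)             ≈⟨ reflexive (≡.cong f (ℕₚ.+-comm 1 m)) ⟩
          f (m ℕ.+ 1)           ≈⟨ increment m ⟩
          f m + κ               ≈⟨ +-congʳ (progression increment m) ⟩
          f 0 + m × κ + κ       ≈⟨ +-assoc _ _ _ ⟩
          f 0 + (m × κ + κ)     ≈⟨ +-congˡ (+-comm _ _) ⟩
          f 0 + suc m × κ       ∎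

      -- All entries equal to 1.

      module _ {n} (A : PairwiseCoprime (suc (suc n))) (a≡1 : ∀ i → a A i ≡ 1) where
        -- At least two entries force weight at least 2. Formally, the recurrence leads from 1 to
        -- weight 0, which neither A nor the still nonempty shorter tuple attains.
        p′-ones : p′ (a A) 1 ≡ 0
        p′-ones = ≡.trans (≡.cong (p′ (a A)) (≡.sym (a≡1 Fin.zero)))
          (≡.trans (p′-step (a A) (positive A) Fin.zero 0)
            (≡.cong₂ ℕ._+_ (p′-small (a A) (positive A) Fin.zero 0 (0<a Fin.zero))
              (p′-small (removeAt (a A) Fin.zero) (positive A ∘ Fin.suc) Fin.zero 0 (0<a (Fin.suc Fin.zero)))))
          where
          0<a : ∀ i → 0 ℕ.< a A i
          0<a i = ≡.subst (0 ℕ.<_) (≡.sym (a≡1 i)) (ℕ.s≤s ℕ.z≤n)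

        q : Vector Series (suc (suc n))
        q = quotients (a A) (positive A)

        -- Here z^1 - 1 is w, so q w = w. Multiplication by w shifts the index, hence comparing
        -- coefficients at m + 1 cancels w.
        q≋1 : ∀ k → q k ≋ 1S
        q≋1 k m = begin
          q k m                      ≈⟨ w⊛shift (0+ q k) refl (suc m) ⟨
          (w ⊛ q k) (suc m)          ≈⟨ ⊛-comm w (q k) (suc m) ⟩
          (q k ⊛ w) (suc m)          ≈⟨ ⊛-cong {q k} (λ _ → refl) z-1≋w (suc m) ⟨
          (q k ⊛ ((z S.^ a A k) S.- 1S)) (suc m)  ≈⟨ quotients-correct (a A) (positive A) k (suc m) ⟩
          1S m                       ∎
          where
          z-1≋w : (z S.^ a A k) S.- 1S ≋ w
          z-1≋w l = begin
            (z S.^ a A k) l - 1S l   ≈⟨ +-congʳ (reflexive (≡.cong (λ b → (z S.^ b) l) (a≡1 k))) ⟩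
            (z ⊛ 1S) l - 1S l        ≈⟨ +-congʳ (trans (S.*-identityʳ z l) (+-comm _ _)) ⟩
            w l + 1S l - 1S l        ≈⟨ //-rightDividesʳ (1S l) (w l) ⟩
            w l                      ∎

        product-1 : ∀ {m} (g : Vector Series m) → (∀ k → g k ≋ 1S) → S.product g ≋ 1S
        product-1 {zero}  g g≋1 = λ l → refl
        product-1 {suc m} g g≋1 = λ l → trans
          (⊛-cong (g≋1 Fin.zero) (product-1 (g ∘ Fin.suc) (g≋1 ∘ Fin.suc)) l) (⊛-identityˡ 1S l)

        -- The function is a pure power of w with a pole of order n + 2 ≥ 2, so its coefficient at 1
        -- / w is 0.
        residueTerm-ones : residueTerm 1 (a A) (positive A) ≈ 0#
        residueTerm-ones = begin
          residueTerm 1 (a A) (positive A)  ≈⟨ residueTerm-coefficient 0 (a A) (positive A) ⟩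
          (1S ⊛ S.product q) (suc n)        ≈⟨ ⊛-identityˡ (S.product q) (suc n) ⟩
          S.product q (suc n)               ≈⟨ product-1 q q≋1 (suc n) ⟩
          0#                                ∎

        fourierDedekind-1 : ∀ t {m} (cs : Vector ℕ m) c .{{_ : NonZero c}} coprime → c ≡ 1 → fourierDedekind t cs c coprime ≈ 0#
        fourierDedekind-1 t cs c coprime ≡.refl = trans (reflexive (fourierDedekind≡ t cs c coprime)) (zeroʳ _)

        fourierDedekind-ones : fourierDedekind-sum A 1 ≈ 0#
        fourierDedekind-ones = trans
          (sum-cong-≋ {n = suc (suc n)} λ j → fourierDedekind-1 1 (removeAt (a A) j) (a A j) {{positive A j}}
            (λ i → coprime A (punchIn j i) j (punchInᵢ≢i j i)) (a≡1 j))
          (sum-replicate-zero (suc (suc n)))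

        defect⁺-ones : defect⁺ A 0 ≈ 0#
        defect⁺-ones = trans (+-cong (×-cong p′-ones refl)
          (-‿cong (trans (+-cong residueTerm-ones fourierDedekind-ones) (+-identityʳ _)))) (-‿inverseʳ _)

      -- Induction on the number of entries.

      module _ {n} (vanish : ∀ (A : PairwiseCoprime (suc n)) u → defect⁺ A u ≈ 0#) where
        defect⁺-constant : ∀ (A : PairwiseCoprime (suc (suc n))) u → defect⁺ A u ≈ defect⁺ A 0
        defect⁺-constant A = coprime-periods (defect⁺ A) (coprime A Fin.zero (Fin.suc Fin.zero) λ ()) (period Fin.zero) (period (Fin.suc Fin.zero))
          where
          period : ∀ j u → defect⁺ A (u ℕ.+ a A j) ≈ defect⁺ A u
          period j u = trans (defect-step A u j) (trans (+-congˡ (vanish (without A j) u)) (+-identityʳ _))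

        -- The increase of `defect⁺ B` from 0 to aᵢ is computed twice: as aᵢ unit steps, each
        -- removing the new 1 and thus adding the constant of A, and as one step that removes aᵢ.
        defect⁺-multiple : ∀ (A : PairwiseCoprime (suc (suc n))) i →
          a A i × defect⁺ A 0 ≈ defect⁺ (without (adjoin-1 A) (Fin.suc i)) 0
        defect⁺-multiple A i = ∙-cancelˡ (defect⁺ B 0) (a A i × defect⁺ A 0) (defect⁺ (without B (Fin.suc i)) 0) (trans
          (sym (progression (defect⁺ B) (λ u → trans (defect-step B u Fin.zero) (+-congˡ (defect⁺-constant A u))) (a A i)))
          (defect-step B 0 (Fin.suc i)))
          where
          B = adjoin-1 A

        -- Induction on the number k of entries not yet known to be 1. Trading the last entry for a
        -- 1 in front multiplies the constant by that entry, which is invertible in characteristic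
        -- 0.
        defect⁺-origin : ∀ k m → m ℕ.+ k ≡ suc (suc n) → ∀ (A : PairwiseCoprime (suc (suc n))) →
          (∀ i → toℕ i ℕ.< m → a A i ≡ 1) → defect⁺ A 0 ≈ 0#
        defect⁺-origin zero    m e A ones = defect⁺-ones A λ i →
          ones i (≡.subst (toℕ i ℕ.<_) (≡.trans (≡.sym e) (ℕₚ.+-identityʳ m)) (Finₚ.toℕ<n i))
        defect⁺-origin (suc k) m e A ones = x*y≈0⇒y≈0 (char0 (a A last) {{positive A last}}) (begin
          (a A last × 1#) * defect⁺ A 0   ≈⟨ trans (×-assoc-* (a A last) 1# _) (×-congʳ (a A last) (*-identityˡ _)) ⟩
          a A last × defect⁺ A 0          ≈⟨ defect⁺-multiple A last ⟩
          defect⁺ B 0                     ≈⟨ defect⁺-origin k (suc m) (≡.trans (≡.sym (ℕₚ.+-suc m k)) e) B ones′ ⟩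
          0#                              ∎)
          where
          last : Fin (suc (suc n))
          last = fromℕ (suc n)
          B = without (adjoin-1 A) (Fin.suc last)
          ones′ : ∀ i → toℕ i ℕ.< suc m → a B i ≡ 1
          ones′ Fin.zero    _           = ≡.refl
          -- The leading ones move up by one position behind the new 1; deleting the last entry does
          -- not move them.
          ones′ (Fin.suc i) (ℕ.s≤s i<m) = ones (punchIn last i) (≡.subst (ℕ._< m) (≡.sym (toℕ-punchIn-fromℕ i)) i<m)

      defect⁺≈0 : ∀ {n} (A : PairwiseCoprime (suc n)) u → defect⁺ A u ≈ 0#
      defect⁺≈0 {zero}  A u = defect⁺-single A u
      defect⁺≈0 {suc n} A u = trans (defect⁺-constant defect⁺≈0 A u)
        -- With m = 0 no entry is assumed to be 1.
        (defect⁺-origin defect⁺≈0 (suc (suc n)) 0 ≡.refl A λ i ())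

      counting-formula : ∀ {n} (A : PairwiseCoprime (suc n)) t .{{_ : NonZero t}} →
        p′ (a A) t × 1# ≈
          R′[F] t (a A) (positive A) +
          ∑[ j < suc n ] σ[F] t (removeAt (a A) j) (a A j) {{positive A j}} (λ i → coprime A (punchIn j i) j (punchInᵢ≢i j i))
      counting-formula {n} A t@(suc u) = trans (x-y≈0⇒x≈y (defect⁺≈0 A u)) (+-cong
        (reflexive (residueTerm≡ t (a A) (positive A)))
        (sum-cong-≋ {n = suc n} λ j → reflexive (fourierDedekind≡ t (removeAt (a A) j) (a A j) {{positive A j}}
          (λ i → coprime A (punchIn j i) j (punchInᵢ≢i j i)))))

-- The formula over the complex numbers.

open import Data.Nat using (ℕ; suc; NonZero)
open import Data.Nat.Coprimality using (Coprime)
open import Data.Fin using (punchIn)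
open import Data.Fin.Properties using (punchInᵢ≢i)
open import Data.Vec.Functional using (Vector; removeAt)
open import Relation.Binary.PropositionalEquality using (_≢_)
open Field ℂ-heytingField using (_≈_; _+_; _×_; 1#; sum-syntax; refl)

theorem3 : ∀ {n} (a : Vector ℕ (suc n)) (a>0 : ∀ i → NonZero (a i))
    (coprime : ∀ i j → i ≢ j → Coprime (a i) (a j)) →
    ∀ t .{{_ : NonZero t}} →
    p′ a t × 1# ≈
    R′ t a a>0 +
    ∑[ j < suc n ] σ t (removeAt a j) (a j) {{a>0 j}} (λ i → coprime (punchIn j i) j (punchInᵢ≢i j i))
theorem3 a a>0 coprime = Vanishing.counting-formula ℂ-heytingField ℂ-char0 ℂ-roots ℂ-primitiveRoot
  -- `ℂ-roots` lists the powers of the primitive root by construction.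
  (λ n k → refl)
  (record { a = a ; positive = a>0 ; coprime = coprime })
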